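{- Let $n\ge2$. The skew column RSK map $\mathbf{cRSK}$ is an isomorphism of $(\widehat{\mathfrak{sl}}_n\oplus\widehat{\mathfrak{sl}}_n)$-crystals on $\bigsqcup_{\lambda,\rho\in\mathbb S}\mathrm{SST}(\lambda/\rho,n)^2$; that is, for all $G\in\{E^{(k)}_i,F^{(k)}_i:0\le i\le n-1,\ 1\le k\le2\}$, $$\mathbf{cRSK}\circ G=G\circ\mathbf{cRSK}$$ (with the convention $\mathbf{cRSK}(\mathbf 0)=\mathbf 0$).
   Context: A signature of length $\ell\ge0$ is a sequence of integers $\lambda=(\lambda_1\ge\dots\ge\lambda_\ell)$; $\mathbb S_\ell$ is the set of these, $\mathbb S=\bigsqcup_{\ell\ge0}\mathbb S_\ell$. Conjugate: $\lambda'_x=\#\{j:\lambda_j\ge x\}$, $x\in\mathbb Z$. $\kappa\preceq\mu$ (same length) means $\mu_1\ge\kappa_1\ge\mu_2\ge\kappa_2\ge\cdots$, equivalently $\mu'_x-\kappa'_x\in\{0,1\}$ for all $x$. For $\kappa\preceq\mu$, $\kappa\preceq\lambda$ in $\mathbb S_\ell$ put $a_x=\mu'_x-\kappa'_x$, $b_x=\lambda'_x-\kappa'_x$, $c_x=\max\{0,a_x+b_x+c_{x-1}-1\}$ with $c_x=0$ for $x\ll0$; $\overline{\mathsf F}(\kappa,\mu,\lambda)=\nu\in\mathbb S_\ell$ is given by $\nu'_x=\mu'_x+\lambda'_x-\kappa'_x+c_{x-1}-c_x$. $\mathscr C_n=\mathbb Z^2/\sim$, $(x,y)\sim(x+kn,y-kn)$,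 $k\in\mathbb Z$. A Fomin field is a map $\boldsymbol\lambda:\mathscr C_n\to\mathbb S_\ell$ with $\boldsymbol\lambda(p)\preceq\boldsymbol\lambda(p+\mathbf e_i)$ ($i=1,2$) and $\boldsymbol\lambda(p+\mathbf e_1+\mathbf e_2)=\overline{\mathsf F}(\boldsymbol\lambda(p),\boldsymbol\lambda(p+\mathbf e_1),\boldsymbol\lambda(p+\mathbf e_2))$. For $\rho,\lambda$ of the same length, $P\in\mathrm{SST}(\lambda/\rho,n)$ is a chain $\rho=\lambda^{(0)}\preceq\dots\preceq\lambda^{(n)}=\lambda$; equivalently a filling where cells $(j,k)$ (row $j$, column $k$) with $\lambda^{(i-1)}_j<k\le\lambda^{(i)}_j$ have label $i$. For $P=(\lambda^{(i)})_i$, $Q=(\mu^{(i)})_i$ in $\mathrm{SST}(\lambda/\rho,n)$, $\boldsymbol\lambda[P,Q]$ is the unique Fomin field on $\mathscr C_n$ with $\boldsymbol\lambda(i,0)=\lambda^{(i)}$, $\boldsymbol\lambda(0,i)=\mu^{(i)}$, $0\le i\le n$. With $\boldsymbol\lambda=\boldsymbol\lambda[P,Q]$ define the (invertible) maps $\iota_1(P,Q)=\big((\boldsymbol\lambda(1+i,0))_{i=0}^n,(\boldsymbol\lambda(1,i))_{i=0}^n\big)$, $\iota_2(P,Q)=\big((\boldsymbol\lambda(i,1))_{i=0}^n,(\boldsymbol\lambda(0,1+i))_{i=0}^n\big)$, $\mathbf{cRSK}(P,Q)=\big((\boldsymbol\lambda(n+i,0))_{i=0}^n,(\boldsymbol\lambda(n,i))_{i=0}^n\big)$.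 Kashiwara operators. For $1\le i\le n-1$ and a tableau $P$, take its row reading word (rows concatenated from bottom to top), replace each $i$ by ")" and each $i+1$ by "(", ignore other letters, delete successively adjacent pairs "(" ")" until the remaining string is $)\cdots)(\cdots($. $e_i(P)$ changes the $i+1$ of the leftmost remaining "(" into $i$ ($\mathbf 0$ if none); $f_i(P)$ changes the $i$ of the rightmost remaining ")" into $i+1$ ($\mathbf 0$ if none). On pairs, for $1\le i\le n-1$: $E^{(1)}_i=e_i\times\mathbf 1$, $F^{(1)}_i=f_i\times\mathbf 1$, $E^{(2)}_i=\mathbf 1\times e_i$, $F^{(2)}_i=\mathbf 1\times f_i$; and $E^{(k)}_0=\iota_k\circ E^{(k)}_1\circ\iota_k^{ -1}$, $F^{(k)}_0=\iota_k\circ F^{(k)}_1\circ\iota_k^{ -1}$ for $k=1,2$. -}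

module Defs where

open import Data.Bool.Base using (if_then_else_; true; false)
open import Data.Fin.Base as Fin using (Fin; zero; suc; toℕ; fromℕ; inject₁; fromℕ<)
import Data.Fin.Properties as Finₚ
open import Data.Fin.Relation.Unary.Top using (view; ‵fromℕ; ‵inject₁)
open import Data.Integer.Base as ℤ
  using (ℤ; +_; -[1+_]; 0ℤ; 1ℤ; _+_; _-_; -_; _*_; _⊔_; _⊓_; _≤_; _≥_; _<_; +≤+; +<+; ∣_∣; _/ℕ_; _%ℕ_)
import Data.Integer.DivMod as ℤ÷
import Data.Integer.Properties as ℤₚ
open import Data.Integer.Tactic.RingSolver using (solve-∀)
open import Data.List.Base as List
  using (List; []; _∷_; _++_; replicate; concatMap; mapMaybe; foldr; reverse; allFin)
open import Data.List.Membership.Propositional using (_∈_)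
import Data.List.Properties as Listₚ
open import Data.List.Relation.Unary.Any using (here; there)
open import Data.Maybe.Base as Maybe using (Maybe; just; nothing)
open import Data.Nat.Base as ℕ using (ℕ; zero; suc; 2+; z≤n; s≤s; NonZero)
import Data.Nat.Properties as ℕₚ
open import Data.Product.Base using (∃-syntax; _×_; _,_; proj₁; proj₂)
open import Data.Sum.Base using (_⊎_; inj₁; inj₂)
open import Data.Vec.Base as Vec
  using (Vec; []; _∷_; lookup; tabulate; head; last; init; _∷ʳ_; updateAt; _[_]≔_)
import Data.Vec.Properties as Vecₚ
open import Data.Vec.Relation.Unary.All as All using (All; []; _∷_)
open import Data.Vec.Relation.Unary.Linked using (Linked; []; [-]; _∷_; linked?)
import Data.Vec.Relation.Unary.Linked.Properties as Linkedₚ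
open import Function.Base using (_∘_; id; flip)
open import Function.Bundles using (_↔_; mk↔ₛ′; Inverse)
open import Relation.Binary.Definitions using (DecidableEquality)
open import Relation.Binary.PropositionalEquality
  using (_≡_; _≢_; refl; sym; trans; cong; cong₂; subst; subst₂)
open import Relation.Nullary.Decidable
  using (Dec; yes; no; does; recompute; map′; _×-dec_; dec-true; dec-false)
open import Relation.Nullary.Negation using (¬_; contradiction)

private variable
  ℓ : ℕ

record Signature (ℓ : ℕ) : Set where
  constructor signature
  field
    parts       : Vec ℤ ℓ
    .decreasing : Linked _≥_ parts

open Signature public using (parts)

-- λ′ₓ = #{ j : λⱼ ≥ x }, as an integer.  (λ is a keyword, so partitions called λ are written ƛ.)
conj : Vec ℤ ℓ → ℤ → ℤ
conj v x = + Vec.count (x ℤₚ.≤?_) v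

infix 4 _≼_ _⪯_
infixr 5 _⨾_⨾_

-- κ ≼ μ : μ₁ ≥ κ₁ ≥ μ₂ ≥ κ₂ ≥ ⋯
data _≼_ : Vec ℤ ℓ → Vec ℤ ℓ → Set where
  []   : [] ≼ []
  [_]  : ∀ {κ μ} → κ ≤ μ → (κ ∷ []) ≼ (μ ∷ [])
  _⨾_⨾_ : ∀ {κ₁ κ₂ μ₁ μ₂} {κ μ : Vec ℤ ℓ} →
         κ₁ ≤ μ₁ → μ₂ ≤ κ₁ → (κ₂ ∷ κ) ≼ (μ₂ ∷ μ) → (κ₁ ∷ κ₂ ∷ κ) ≼ (μ₁ ∷ μ₂ ∷ μ)

_⪯_ : Signature ℓ → Signature ℓ → Set
κ ⪯ μ = parts κ ≼ parts μ

-- ν = F̄(κ, μ, ƛ), characterised by conjugates.  For κ ≼ μ and κ ≼ ƛ such a ν exists (insert-rule)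
-- and is the only weakly decreasing one (rule-unique).
record LocalRule (κ μ ƛ ν : Vec ℤ ℓ) : Set where
  a : ℤ → ℤ
  a x = conj μ x - conj κ x
  b : ℤ → ℤ
  b x = conj ƛ x - conj κ x
  field
    c        : ℤ → ℤ
    c-start  : ∃[ x₀ ] ∀ x → x ≤ x₀ → c x ≡ 0ℤ
    c-carry  : ∀ x → c x ≡ 0ℤ ⊔ (a x + b x + c (x - 1ℤ) - 1ℤ)
    ν-conj   : ∀ x → conj ν x ≡ conj μ x + conj ƛ x - conj κ x + c (x - 1ℤ) - c x

-- A map on the cylinder ℤ²/(x , y) ∼ (x + k n , y - k n), given as a map on ℤ² that is constant on classes.
record FominField (n ℓ : ℕ) : Set where
  field
    at       : ℤ → ℤ → Signature ℓ
    periodic : ∀ k x y → at (x + k * + n) (y - k * + n) ≡ at x y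
    right    : ∀ x y → at x y ⪯ at (ℤ.suc x) y
    up       : ∀ x y → at x y ⪯ at x (ℤ.suc y)
    rule     : ∀ x y → LocalRule (parts (at x y)) (parts (at (ℤ.suc x) y)) (parts (at x (ℤ.suc y)))
                                 (parts (at (ℤ.suc x) (ℤ.suc y)))

open FominField public using (at)

-- Only the chain is relevant, so two tableaux of the same shape are equal as soon as their chains are.
record SST (ρ ƛ : Signature ℓ) (n : ℕ) : Set where
  constructor sst
  field
    chain   : Vec (Signature ℓ) (suc n)
    .linked : Linked _⪯_ chain
    .start  : Vec.head chain ≡ ρ
    .end    : Vec.last chain ≡ ƛ

open SST public using (chain)

-- The disjoint union over all lengths and all λ, ρ of SST(λ/ρ, n)².
record Pairs (n : ℕ) : Set where
  constructor pair
  field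
    {length} : ℕ
    {ρ ƛ}    : Signature length
    P Q      : SST ρ ƛ n

open Pairs public using (P; Q)

module Int where

  lin : ∀ {a b c d} → a ≤ b → d - c ≡ b - a → c ≤ d
  lin {a} {b} {c} {d} p e = ℤₚ.0≤i-j⇒j≤i (subst (0ℤ ≤_) (sym e) (ℤₚ.i≤j⇒0≤j-i p))

  lt : ∀ {a b} → ¬ (a ≤ b) → b ≤ a - 1ℤ
  lt {a} {b} p = lin (ℤₚ.i<j⇒suc[i]≤j (ℤₚ.≰⇒> p)) (e a b)
    where e : ∀ a b → a - 1ℤ - b ≡ a - (1ℤ + b)
          e = solve-∀

  pred≤ : ∀ a → a - 1ℤ ≤ a
  pred≤ a = lin (+≤+ (z≤n {1})) (e a)
    where e : ∀ a → a - (a - 1ℤ) ≡ 1ℤ - 0ℤ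
          e = solve-∀

  not≤ : ∀ {a b} → b ≤ a - 1ℤ → ¬ (a ≤ b)
  not≤ {a} {b} p q with lin {c = 0ℤ} {ℤ.-1ℤ} (ℤₚ.≤-trans q p) (e a)
    where e : ∀ a → ℤ.-1ℤ - 0ℤ ≡ a - 1ℤ - a
          e = solve-∀
  ... | ()

  ind : ℤ → ℤ → ℤ
  ind x t = if does (x ℤₚ.≤? t) then 1ℤ else 0ℤ

  ind-yes : ∀ {x t} → x ≤ t → ind x t ≡ 1ℤ
  ind-yes {x} {t} p rewrite dec-true (x ℤₚ.≤? t) p = refl

  ind-no : ∀ {x t} → t ≤ x - 1ℤ → ind x t ≡ 0ℤ
  ind-no {x} {t} p rewrite dec-false (x ℤₚ.≤? t) (not≤ p) = refl

  conj-∷ : ∀ t (v : Vec ℤ ℓ) x → conj (t ∷ v) x ≡ ind x t + conj v x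
  conj-∷ t v x with does (x ℤₚ.≤? t)
  ... | true  = refl
  ... | false = refl

  conj-yes : ∀ {t x} (v : Vec ℤ ℓ) → x ≤ t → conj (t ∷ v) x ≡ 1ℤ + conj v x
  conj-yes {t = t} {x} v p = trans (conj-∷ t v x) (cong (_+ conj v x) (ind-yes p))

  conj-zero : ∀ {x y} {v : Vec ℤ ℓ} → All (_≤ y) v → y ≤ x - 1ℤ → conj v x ≡ 0ℤ
  conj-zero [] _ = refl
  conj-zero {x = x} {v = t ∷ v} (p ∷ ps) q =
    trans (conj-∷ t v x) (cong₂ _+_ (ind-no {x} {t} (ℤₚ.≤-trans p q)) (conj-zero {x = x} ps q))

open Int

≼-tailˡ : ∀ {κ μ κ₁ μ₁} → _≼_ {suc ℓ} (κ₁ ∷ κ) (μ₁ ∷ μ) → κ ≼ μ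
≼-tailˡ [ _ ] = []
≼-tailˡ (_ ⨾ _ ⨾ r) = r

≼-head : ∀ {κ μ κ₁ μ₁} → _≼_ {suc ℓ} (κ₁ ∷ κ) (μ₁ ∷ μ) → κ₁ ≤ μ₁
≼-head [ p ] = p
≼-head (p ⨾ _ ⨾ _) = p

≼-boundʳ : ∀ {κ μ κ₁ μ₁} → _≼_ {suc ℓ} (κ₁ ∷ κ) (μ₁ ∷ μ) → All (_≤ κ₁) μ
≼-boundʳ [ _ ] = []
≼-boundʳ (_ ⨾ q ⨾ r) = q ∷ All.map (λ s → ℤₚ.≤-trans s (ℤₚ.≤-trans (≼-head r) q)) (≼-boundʳ r)

≼-boundˡ : ∀ {κ μ κ₁ μ₁} → _≼_ {suc ℓ} (κ₁ ∷ κ) (μ₁ ∷ μ) → All (_≤ κ₁) κ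
≼-boundˡ [ _ ] = []
≼-boundˡ (_ ⨾ q ⨾ r) = ℤₚ.≤-trans (≼-head r) q ∷ All.map (λ s → ℤₚ.≤-trans s (ℤₚ.≤-trans (≼-head r) q)) (≼-boundˡ r)

≼-sortedˡ : {κ μ : Vec ℤ ℓ} → κ ≼ μ → Linked _≥_ κ
≼-sortedˡ [] = []
≼-sortedˡ [ _ ] = [-]
≼-sortedˡ (_ ⨾ q ⨾ r) = ℤₚ.≤-trans (≼-head r) q ∷ ≼-sortedˡ r

≼-sortedʳ : {κ μ : Vec ℤ ℓ} → κ ≼ μ → Linked _≥_ μ
≼-sortedʳ [] = []
≼-sortedʳ [ _ ] = [-]
≼-sortedʳ (p ⨾ q ⨾ r) = ℤₚ.≤-trans q p ∷ ≼-sortedʳ r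

_≼?_ : (κ μ : Vec ℤ ℓ) → Dec (κ ≼ μ)
[] ≼? [] = yes []
(κ ∷ []) ≼? (μ ∷ []) = map′ [_] (λ { [ p ] → p }) (κ ℤₚ.≤? μ)
(κ₁ ∷ κ₂ ∷ κ) ≼? (μ₁ ∷ μ₂ ∷ μ) =
  map′ (λ { (p , q , r) → p ⨾ q ⨾ r }) (λ { (p ⨾ q ⨾ r) → p , q , r })
       (κ₁ ℤₚ.≤? μ₁ ×-dec μ₂ ℤₚ.≤? κ₁ ×-dec (κ₂ ∷ κ) ≼? (μ₂ ∷ μ))

-- F̄ row by row, from the bottom row up: row j gets length μⱼ + ƛⱼ - κⱼ plus the carry from the rows below,
-- is truncated at κⱼ₋₁ (row 1 is not), and passes the excess on as the carry into row j - 1.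
carry : (κ μ ƛ : Vec ℤ ℓ) → ℤ → ℤ
fullRow : ℤ → ℤ → ℤ → (κ μ ƛ : Vec ℤ ℓ) → ℤ
carry [] [] [] x = 0ℤ
carry (κ₁ ∷ κ) (μ₁ ∷ μ) (ƛ₁ ∷ ƛ) x = 0ℤ ⊔ (fullRow κ₁ μ₁ ƛ₁ κ μ ƛ - x)
fullRow κ₁ μ₁ ƛ₁ κ μ ƛ = μ₁ + ƛ₁ - κ₁ + carry κ μ ƛ κ₁

fill : ℤ → (κ μ ƛ : Vec ℤ ℓ) → Vec ℤ ℓ
fill u [] [] [] = []
fill u (κ₁ ∷ κ) (μ₁ ∷ μ) (ƛ₁ ∷ ƛ) = (u ⊓ fullRow κ₁ μ₁ ƛ₁ κ μ ƛ) ∷ fill κ₁ κ μ ƛ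

insert : (κ μ ƛ : Vec ℤ ℓ) → Vec ℤ ℓ
insert [] [] [] = []
insert (κ₁ ∷ κ) (μ₁ ∷ μ) (ƛ₁ ∷ ƛ) = fullRow κ₁ μ₁ ƛ₁ κ μ ƛ ∷ fill κ₁ κ μ ƛ

-- The inverse of insert in its first argument, from the top row down.
remove′ : ℤ → (ν : Vec ℤ ℓ) (μ ƛ : Vec ℤ (suc ℓ)) → Vec ℤ (suc ℓ)
remove′ s [] (μ₁ ∷ []) (ƛ₁ ∷ []) = (μ₁ + ƛ₁ - s) ∷ []
remove′ s (ν₂ ∷ ν) (μ₁ ∷ μ) (ƛ₁ ∷ ƛ) =
  let t = μ₁ + ƛ₁ - s in (ν₂ ⊔ t) ∷ remove′ (ν₂ + (0ℤ ⊔ (ν₂ - t))) ν μ ƛ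

remove : (ν μ ƛ : Vec ℤ ℓ) → Vec ℤ ℓ
remove [] [] [] = []
remove (ν₁ ∷ ν) μ ƛ = remove′ ν₁ ν μ ƛ

private
  e1 : ∀ m l k → m + l - (m + l - k + 0ℤ) ≡ k
  e1 = solve-∀
  e2 : ∀ m l k c → m + l - (m + l - k + c) ≡ k - c
  e2 = solve-∀
  e3 : ∀ m l t k c → k - c ≡ m + l - t → m + l - k + c ≡ t
  e3 m l t k c e = trans (h m l k c) (trans (cong (λ z → m + l - z) e) (h′ m l t))
    where h : ∀ m l k c → m + l - k + c ≡ m + l - (k - c)
          h = solve-∀
          h′ : ∀ m l t → m + l - (m + l - t) ≡ t
          h′ = solve-∀

  max-s : ∀ k s → (k ⊓ s) ⊔ (k - (0ℤ ⊔ (s - k))) ≡ k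
  max-s k s with ℤₚ.≤-total s k
  ... | inj₁ p = trans (cong₂ (λ u v → u ⊔ (k - v)) (ℤₚ.i≥j⇒i⊓j≡j p)
                       (ℤₚ.i≥j⇒i⊔j≡i (lin p (h k s)))) (trans (cong (s ⊔_) (h′ k)) (ℤₚ.i≤j⇒i⊔j≡j p))
    where h : ∀ k s → 0ℤ - (s - k) ≡ k - s
          h = solve-∀
          h′ : ∀ k → k - 0ℤ ≡ k
          h′ = solve-∀
  ... | inj₂ p = trans (cong₂ (λ u v → u ⊔ (k - v)) (ℤₚ.i≤j⇒i⊓j≡i p) e) (ℤₚ.i≥j⇒i⊔j≡i (lin p (h′ k s)))
    where e : 0ℤ ⊔ (s - k) ≡ s - k
          e = ℤₚ.i≤j⇒i⊔j≡j (ℤₚ.i≤j⇒0≤j-i p)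
          h′ : ∀ k s → k - (k - (s - k)) ≡ s - k
          h′ = solve-∀

  next-s : ∀ k s → (k ⊓ s) + (0ℤ ⊔ ((k ⊓ s) - (k - (0ℤ ⊔ (s - k))))) ≡ s
  next-s k s with ℤₚ.≤-total s k
  ... | inj₁ p = trans (cong₂ (λ u v → u + (0ℤ ⊔ (u - (k - v)))) (ℤₚ.i≥j⇒i⊓j≡j p)
                       (ℤₚ.i≥j⇒i⊔j≡i (lin p (h k s))))
                     (trans (cong (λ z → s + z) (ℤₚ.i≥j⇒i⊔j≡i (lin p (h′ k s)))) (ℤₚ.+-identityʳ s))
    where h : ∀ k s → 0ℤ - (s - k) ≡ k - s
          h = solve-∀
          h′ : ∀ k s → 0ℤ - (s - (k - 0ℤ)) ≡ k - s
          h′ = solve-∀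
  ... | inj₂ p = trans (cong₂ (λ u v → u + (0ℤ ⊔ (u - (k - v)))) (ℤₚ.i≤j⇒i⊓j≡i p) e)
                      (trans (cong (λ z → k + z) (trans (cong (0ℤ ⊔_) (h k s)) e)) (h′ k s))
    where e : 0ℤ ⊔ (s - k) ≡ s - k
          e = ℤₚ.i≤j⇒i⊔j≡j (ℤₚ.i≤j⇒0≤j-i p)
          h : ∀ k s → k - (k - (s - k)) ≡ s - k
          h = solve-∀
          h′ : ∀ k s → k + (s - k) ≡ s
          h′ = solve-∀

remove′-insert : ∀ κ₁ μ₁ ƛ₁ (κ μ ƛ : Vec ℤ ℓ) →
  remove′ (fullRow κ₁ μ₁ ƛ₁ κ μ ƛ) (fill κ₁ κ μ ƛ) (μ₁ ∷ μ) (ƛ₁ ∷ ƛ) ≡ κ₁ ∷ κ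
remove′-insert κ₁ μ₁ ƛ₁ [] [] [] = cong (_∷ []) (e1 μ₁ ƛ₁ κ₁)
remove′-insert κ₁ μ₁ ƛ₁ (κ₂ ∷ κ) (μ₂ ∷ μ) (ƛ₂ ∷ ƛ)
  rewrite e2 μ₁ ƛ₁ κ₁ (carry (κ₂ ∷ κ) (μ₂ ∷ μ) (ƛ₂ ∷ ƛ) κ₁)
        | max-s κ₁ (fullRow κ₂ μ₂ ƛ₂ κ μ ƛ)
        | next-s κ₁ (fullRow κ₂ μ₂ ƛ₂ κ μ ƛ) = cong (κ₁ ∷_) (remove′-insert κ₂ μ₂ ƛ₂ κ μ ƛ)

remove-insert : (κ μ ƛ : Vec ℤ ℓ) → remove (insert κ μ ƛ) μ ƛ ≡ κ
remove-insert [] [] [] = refl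
remove-insert (κ₁ ∷ κ) (μ₁ ∷ μ) (ƛ₁ ∷ ƛ) = remove′-insert κ₁ μ₁ ƛ₁ κ μ ƛ

insert-remove′ : ∀ s (ν : Vec ℤ ℓ) μ ƛ → insert (remove′ s ν μ ƛ) μ ƛ ≡ s ∷ ν
insert-remove′ s [] (μ₁ ∷ []) (ƛ₁ ∷ []) = cong (_∷ []) (h μ₁ ƛ₁ s)
  where h : ∀ m l s → m + l - (m + l - s) + 0ℤ ≡ s
        h = solve-∀
insert-remove′ s (ν₂ ∷ ν) (μ₁ ∷ μ) (ƛ₁ ∷ ƛ) = step (remove′ s₂ ν μ ƛ) μ ƛ (insert-remove′ s₂ ν μ ƛ)
  where
  t = μ₁ + ƛ₁ - s
  s₂ = ν₂ + (0ℤ ⊔ (ν₂ - t))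
  cut : (ν₂ ⊔ t) ⊓ s₂ ≡ ν₂
  cut with ℤₚ.≤-total ν₂ t
  ... | inj₁ p = trans (cong₂ (λ u v → u ⊓ (ν₂ + v)) (ℤₚ.i≤j⇒i⊔j≡j p) (ℤₚ.i≥j⇒i⊔j≡i (lin p (h ν₂ t))))
          (trans (cong (t ⊓_) (ℤₚ.+-identityʳ ν₂)) (ℤₚ.i≥j⇒i⊓j≡j p))
    where h : ∀ k s → 0ℤ - (k - s) ≡ s - k
          h = solve-∀
  ... | inj₂ p = trans (cong (_⊓ s₂) (ℤₚ.i≥j⇒i⊔j≡i p)) (ℤₚ.i≤j⇒i⊓j≡i
           (lin (ℤₚ.i≤i⊔j 0ℤ (ν₂ - t)) (h ν₂ (0ℤ ⊔ (ν₂ - t)))))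
    where h : ∀ k s → k + s - k ≡ s - 0ℤ
          h = solve-∀
  full : (ν₂ ⊔ t) - (0ℤ ⊔ (s₂ - (ν₂ ⊔ t))) ≡ t
  full with ℤₚ.≤-total ν₂ t
  ... | inj₁ p = trans (cong₂ (λ u v → u - (0ℤ ⊔ (ν₂ + v - u))) (ℤₚ.i≤j⇒i⊔j≡j p) (ℤₚ.i≥j⇒i⊔j≡i (lin p (h ν₂ t))))
          (trans (cong (λ z → t - z) (ℤₚ.i≥j⇒i⊔j≡i (lin p (h″ ν₂ t)))) (h′ t))
    where h : ∀ k s → 0ℤ - (k - s) ≡ s - k
          h = solve-∀
          h″ : ∀ k s → 0ℤ - (k + 0ℤ - s) ≡ s - k
          h″ = solve-∀
          h′ : ∀ t → t - 0ℤ ≡ t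
          h′ = solve-∀
  ... | inj₂ p = trans (cong₂ (λ u v → u - (0ℤ ⊔ (ν₂ + v - u))) (ℤₚ.i≥j⇒i⊔j≡i p) e)
          (trans (cong (λ z → ν₂ - z) (trans (cong (0ℤ ⊔_) (h ν₂ t)) e)) (h′ ν₂ t))
    where e : 0ℤ ⊔ (ν₂ - t) ≡ ν₂ - t
          e = ℤₚ.i≤j⇒i⊔j≡j (ℤₚ.i≤j⇒0≤j-i p)
          h : ∀ k s → k + (k - s) - k ≡ k - s
          h = solve-∀
          h′ : ∀ k s → k - (k - s) ≡ s
          h′ = solve-∀
  step : ∀ κ μ ƛ → insert κ μ ƛ ≡ s₂ ∷ ν → insert ((ν₂ ⊔ t) ∷ κ) (μ₁ ∷ μ) (ƛ₁ ∷ ƛ) ≡ s ∷ ν₂ ∷ ν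
  step (κ₁ ∷ κ) (μ₂ ∷ μ) (ƛ₂ ∷ ƛ) e =
    cong₂ _∷_ (e3 μ₁ ƛ₁ s (ν₂ ⊔ t) _ (trans (cong (λ z → (ν₂ ⊔ t) - (0ℤ ⊔ (z - (ν₂ ⊔ t)))) (cong Vec.head e)) full))
              (cong₂ _∷_ (trans (cong ((ν₂ ⊔ t) ⊓_) (cong Vec.head e)) cut) (cong Vec.tail e))

insert-remove : (ν μ ƛ : Vec ℤ ℓ) → insert (remove ν μ ƛ) μ ƛ ≡ ν
insert-remove [] [] [] = refl
insert-remove (ν₁ ∷ ν) μ ƛ = insert-remove′ ν₁ ν μ ƛ

carry≥0 : (κ μ ƛ : Vec ℤ ℓ) → ∀ x → 0ℤ ≤ carry κ μ ƛ x
carry≥0 [] [] [] x = ℤₚ.≤-refl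
carry≥0 (κ₁ ∷ κ) (μ₁ ∷ μ) (ƛ₁ ∷ ƛ) x = ℤₚ.i≤i⊔j 0ℤ _

fullRow-comm : ∀ κ₁ μ₁ ƛ₁ (κ μ ƛ : Vec ℤ ℓ) → fullRow κ₁ μ₁ ƛ₁ κ μ ƛ ≡ fullRow κ₁ ƛ₁ μ₁ κ ƛ μ
carry-comm : (κ μ ƛ : Vec ℤ ℓ) → ∀ x → carry κ μ ƛ x ≡ carry κ ƛ μ x
fullRow-comm κ₁ μ₁ ƛ₁ κ μ ƛ = cong₂ (λ p q → p - κ₁ + q) (ℤₚ.+-comm μ₁ ƛ₁) (carry-comm κ μ ƛ κ₁)
carry-comm [] [] [] x = refl
carry-comm (κ₁ ∷ κ) (μ₁ ∷ μ) (ƛ₁ ∷ ƛ) x = cong (λ z → 0ℤ ⊔ (z - x)) (fullRow-comm κ₁ μ₁ ƛ₁ κ μ ƛ)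

fill-comm : ∀ u (κ μ ƛ : Vec ℤ ℓ) → fill u κ μ ƛ ≡ fill u κ ƛ μ
fill-comm u [] [] [] = refl
fill-comm u (κ₁ ∷ κ) (μ₁ ∷ μ) (ƛ₁ ∷ ƛ) = cong₂ (λ p q → (u ⊓ p) ∷ q) (fullRow-comm κ₁ μ₁ ƛ₁ κ μ ƛ) (fill-comm κ₁ κ μ ƛ)

insert-comm : (κ μ ƛ : Vec ℤ ℓ) → insert κ μ ƛ ≡ insert κ ƛ μ
insert-comm [] [] [] = refl
insert-comm (κ₁ ∷ κ) (μ₁ ∷ μ) (ƛ₁ ∷ ƛ) = cong₂ _∷_ (fullRow-comm κ₁ μ₁ ƛ₁ κ μ ƛ) (fill-comm κ₁ κ μ ƛ)

remove′-comm : ∀ s (ν : Vec ℤ ℓ) μ ƛ → remove′ s ν μ ƛ ≡ remove′ s ν ƛ μ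
remove′-comm s [] (μ₁ ∷ []) (ƛ₁ ∷ []) = cong (λ z → (z - s) ∷ []) (ℤₚ.+-comm μ₁ ƛ₁)
remove′-comm s (ν₂ ∷ ν) (μ₁ ∷ μ) (ƛ₁ ∷ ƛ) rewrite ℤₚ.+-comm μ₁ ƛ₁ = cong (_ ∷_) (remove′-comm _ ν μ ƛ)

remove-comm : (ν μ ƛ : Vec ℤ ℓ) → remove ν μ ƛ ≡ remove ν ƛ μ
remove-comm [] [] [] = refl
remove-comm (ν₁ ∷ ν) μ ƛ = remove′-comm ν₁ ν μ ƛ

fullRow≥ : ∀ {κ₁ μ₁ ƛ₁} (κ μ ƛ : Vec ℤ ℓ) → κ₁ ≤ ƛ₁ → μ₁ ≤ fullRow κ₁ μ₁ ƛ₁ κ μ ƛ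
fullRow≥ {κ₁ = κ₁} {μ₁} {ƛ₁} κ μ ƛ p = lin (ℤₚ.+-mono-≤ p (carry≥0 κ μ ƛ κ₁)) (h κ₁ μ₁ ƛ₁ (carry κ μ ƛ κ₁))
  where h : ∀ k m l c → m + l - k + c - m ≡ l + c - (k + 0ℤ)
        h = solve-∀

fill-≼ : ∀ {u κ₁ μ₁ ƛ₁} {κ μ ƛ : Vec ℤ ℓ} → μ₁ ≤ u → (κ₁ ∷ κ) ≼ (μ₁ ∷ μ) → (κ₁ ∷ κ) ≼ (ƛ₁ ∷ ƛ) →
  (μ₁ ∷ μ) ≼ fill u (κ₁ ∷ κ) (μ₁ ∷ μ) (ƛ₁ ∷ ƛ)
fill-≼ r [ p ] [ q ] = [ ℤₚ.⊓-glb r (fullRow≥ [] [] [] q) ]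
fill-≼ {κ = κ} {μ} {ƛ} r (p₁ ⨾ p₂ ⨾ p) (q₁ ⨾ q₂ ⨾ q) =
  ℤₚ.⊓-glb r (fullRow≥ κ μ ƛ q₁) ⨾ ℤₚ.≤-trans (ℤₚ.i⊓j≤i _ _) p₁ ⨾ fill-≼ p₂ p q

insert-≼μ : {κ μ ƛ : Vec ℤ ℓ} → κ ≼ μ → κ ≼ ƛ → μ ≼ insert κ μ ƛ
insert-≼μ [] [] = []
insert-≼μ [ p ] [ q ] = [ fullRow≥ [] [] [] q ]
insert-≼μ {κ = _ ∷ κ} {_ ∷ μ} {_ ∷ ƛ} (p₁ ⨾ p₂ ⨾ p) (q₁ ⨾ q₂ ⨾ q) =
  fullRow≥ κ μ ƛ q₁ ⨾ ℤₚ.≤-trans (ℤₚ.i⊓j≤i _ _) p₁ ⨾ fill-≼ p₂ p q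

insert-≼ƛ : {κ μ ƛ : Vec ℤ ℓ} → κ ≼ μ → κ ≼ ƛ → ƛ ≼ insert κ μ ƛ
insert-≼ƛ {κ = κ} {μ} {ƛ} p q = subst (ƛ ≼_) (insert-comm κ ƛ μ) (insert-≼μ q p)

remove′-≼ : ∀ {s ν₁} (ν : Vec ℤ ℓ) {μ ƛ} → ν₁ ≤ s → μ ≼ (ν₁ ∷ ν) → ƛ ≼ (ν₁ ∷ ν) → remove′ s ν μ ƛ ≼ μ
remove′-≼ {s = s} [] {μ₁ ∷ []} {ƛ₁ ∷ []} r [ p ] [ q ] = [ lin (ℤₚ.≤-trans q r) (h μ₁ ƛ₁ s) ]
  where h : ∀ m l s → m - (m + l - s) ≡ s - l
        h = solve-∀
remove′-≼ {s = s} (ν₂ ∷ []) {μ₁ ∷ μ₂ ∷ []} {ƛ₁ ∷ ƛ₂ ∷ []} r (p₁ ⨾ p₂ ⨾ p) (q₁ ⨾ q₂ ⨾ q) =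
  ℤₚ.⊔-lub p₂ (lin (ℤₚ.≤-trans q₁ r) (h μ₁ ƛ₁ s)) ⨾ ℤₚ.≤-trans (≼-head p) (ℤₚ.i≤i⊔j ν₂ _)
    ⨾ remove′-≼ [] (lin (ℤₚ.i≤i⊔j 0ℤ (ν₂ - (μ₁ + ƛ₁ - s))) (h′ ν₂ _)) p q
  where h : ∀ m l s → m - (m + l - s) ≡ s - l
        h = solve-∀
        h′ : ∀ n c → n + c - n ≡ c - 0ℤ
        h′ = solve-∀
remove′-≼ {s = s} (ν₂ ∷ ν@(_ ∷ _)) {μ₁ ∷ μ₂ ∷ _ ∷ _} {ƛ₁ ∷ ƛ₂ ∷ _ ∷ _} r (p₁ ⨾ p₂ ⨾ p) (q₁ ⨾ q₂ ⨾ q) =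
  ℤₚ.⊔-lub p₂ (lin (ℤₚ.≤-trans q₁ r) (h μ₁ ƛ₁ s)) ⨾ ℤₚ.≤-trans (≼-head p) (ℤₚ.i≤i⊔j ν₂ _)
    ⨾ remove′-≼ ν (lin (ℤₚ.i≤i⊔j 0ℤ (ν₂ - (μ₁ + ƛ₁ - s))) (h′ ν₂ _)) p q
  where h : ∀ m l s → m - (m + l - s) ≡ s - l
        h = solve-∀
        h′ : ∀ n c → n + c - n ≡ c - 0ℤ
        h′ = solve-∀

remove-≼μ : {ν μ ƛ : Vec ℤ ℓ} → μ ≼ ν → ƛ ≼ ν → remove ν μ ƛ ≼ μ
remove-≼μ {ν = []} [] [] = []
remove-≼μ {ν = ν₁ ∷ ν} p q = remove′-≼ ν ℤₚ.≤-refl p q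

remove-≼ƛ : {ν μ ƛ : Vec ℤ ℓ} → μ ≼ ν → ƛ ≼ ν → remove ν μ ƛ ≼ ƛ
remove-≼ƛ {ν = ν} {μ} {ƛ} p q = subst (_≼ ƛ) (remove-comm ν ƛ μ) (remove-≼μ q p)

module Local (k m l C : ℤ) (k≤m : k ≤ m) (k≤l : k ≤ l) (C≥0 : 0ℤ ≤ C) where

  A : ℤ → ℤ
  A x = C + (x ⊓ m) + (x ⊓ l) - k - x

  S : ℤ
  S = m + l - k + C

  Carry : ℤ → Set
  Carry x = 0ℤ ⊔ A x ≡ 0ℤ ⊔ (ind x m + ind x l + (0ℤ ⊔ A (x - 1ℤ)) - 1ℤ)

  Add : ℤ → Set
  Add x = ind x S ≡ ind x m + ind x l + (0ℤ ⊔ A (x - 1ℤ)) - (0ℤ ⊔ A x)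

  private
    below : ∀ x t → (x ≤ t) ⊎ (t ≤ x - 1ℤ)
    below x t with x ℤₚ.≤? t
    ... | yes p = inj₁ p
    ... | no ¬p = inj₂ (lt ¬p)

    max0 : ∀ {y} → 0ℤ ≤ y → 0ℤ ⊔ y ≡ y
    max0 = ℤₚ.i≤j⇒i⊔j≡j

    min0 : ∀ {y} → y ≤ 0ℤ → 0ℤ ⊔ y ≡ 0ℤ
    min0 = ℤₚ.i≥j⇒i⊔j≡i

    pred-⊓ : ∀ {x t} → x ≤ t → (x - 1ℤ) ⊓ t ≡ x - 1ℤ
    pred-⊓ {x} p = ℤₚ.i≤j⇒i⊓j≡i (ℤₚ.≤-trans (pred≤ x) p)

    low-⊓ : ∀ {x t} → t ≤ x - 1ℤ → x ⊓ t ≡ t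
    low-⊓ {x} p = ℤₚ.i≥j⇒i⊓j≡j (ℤₚ.≤-trans p (pred≤ x))

  private
    ha₁ : ∀ x k m l C → m + l - k + C - x ≡ m + l + C - (x + k + 0ℤ)
    ha₁ = solve-∀
    ha₂ : ∀ x k C → C + (x - 1ℤ) + (x - 1ℤ) - k - (x - 1ℤ) - 0ℤ ≡ x - 1ℤ + C - (k + 0ℤ)
    ha₂ = solve-∀
    ha₃ : ∀ x k C → C + x + x - k - x - 0ℤ ≡ x + C - (k + 0ℤ)
    ha₃ = solve-∀
    ha₄ : ∀ x k C → C + x + x - k - x ≡ 1ℤ + 1ℤ + (C + (x - 1ℤ) + (x - 1ℤ) - k - (x - 1ℤ)) - 1ℤ
    ha₄ = solve-∀
    ha₅ : ∀ x k C → 1ℤ ≡ 1ℤ + 1ℤ + (C + (x - 1ℤ) + (x - 1ℤ) - k - (x - 1ℤ)) - (C + x + x - k - x)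
    ha₅ = solve-∀
    hb₁ : ∀ x k m l C → m + l - k + C - x ≡ m + l + C - (x + k + 0ℤ)
    hb₁ = solve-∀
    hb₂ : ∀ x k l C → C + (x - 1ℤ) + l - k - (x - 1ℤ) - 0ℤ ≡ l + C - (k + 0ℤ)
    hb₂ = solve-∀
    hb₃ : ∀ x k l C → C + x + l - k - x - 0ℤ ≡ l + C - (k + 0ℤ)
    hb₃ = solve-∀
    hb₄ : ∀ x k l C → C + x + l - k - x ≡ 1ℤ + 0ℤ + (C + (x - 1ℤ) + l - k - (x - 1ℤ)) - 1ℤ
    hb₄ = solve-∀
    hb₅ : ∀ x k l C → 1ℤ ≡ 1ℤ + 0ℤ + (C + (x - 1ℤ) + l - k - (x - 1ℤ)) - (C + x + l - k - x)
    hb₅ = solve-∀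
    hc₁ : ∀ x k m l C → m + l - k + C - x ≡ m + l + C - (k + x + 0ℤ)
    hc₁ = solve-∀
    hc₂ : ∀ x k l C → C + l + (x - 1ℤ) - k - (x - 1ℤ) - 0ℤ ≡ l + C - (k + 0ℤ)
    hc₂ = solve-∀
    hc₃ : ∀ x k l C → C + l + x - k - x - 0ℤ ≡ l + C - (k + 0ℤ)
    hc₃ = solve-∀
    hc₄ : ∀ x k l C → C + l + x - k - x ≡ 0ℤ + 1ℤ + (C + l + (x - 1ℤ) - k - (x - 1ℤ)) - 1ℤ
    hc₄ = solve-∀
    hc₅ : ∀ x k l C → 1ℤ ≡ 0ℤ + 1ℤ + (C + l + (x - 1ℤ) - k - (x - 1ℤ)) - (C + l + x - k - x)
    hc₅ = solve-∀
    he₂ : ∀ x k m l C → C + m + l - k - (x - 1ℤ) - 0ℤ ≡ m + l - k + C - (x - 1ℤ)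
    he₂ = solve-∀
    he₃ : ∀ x k m l C → C + m + l - k - x - 0ℤ ≡ m + l - k + C - x
    he₃ = solve-∀
    he₄ : ∀ x k m l C → C + m + l - k - x ≡ 0ℤ + 0ℤ + (C + m + l - k - (x - 1ℤ)) - 1ℤ
    he₄ = solve-∀
    he₅ : ∀ x k m l C → 1ℤ ≡ 0ℤ + 0ℤ + (C + m + l - k - (x - 1ℤ)) - (C + m + l - k - x)
    he₅ = solve-∀
    hf₂ : ∀ x k m l C → 0ℤ - (C + m + l - k - (x - 1ℤ)) ≡ x - 1ℤ - (m + l - k + C)
    hf₂ = solve-∀
    hf₃ : ∀ x k m l C → 0ℤ - (C + m + l - k - x) ≡ x - (m + l - k + C)
    hf₃ = solve-∀

  both : ∀ x → k ≤ x - 1ℤ → Carry x × Add x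
  both x k<x with below x m | below x l
  ... | inj₁ p | inj₁ q
    rewrite ind-yes p | ind-yes q | pred-⊓ {x} p | pred-⊓ {x} q | ℤₚ.i≤j⇒i⊓j≡i p | ℤₚ.i≤j⇒i⊓j≡i q
          | ind-yes {x} {S} (lin (ℤₚ.+-mono-≤ (ℤₚ.+-mono-≤ p k≤l) C≥0) (ha₁ x k m l C))
          | max0 (lin {d = C + (x - 1ℤ) + (x - 1ℤ) - k - (x - 1ℤ)} (ℤₚ.+-mono-≤ k<x C≥0) (ha₂ x k C))
          | max0 (lin {d = C + x + x - k - x} (ℤₚ.+-mono-≤ (ℤₚ.≤-trans k<x (pred≤ x)) C≥0) (ha₃ x k C))
    = trans (sym (max0 (lin {d = C + x + x - k - x} (ℤₚ.+-mono-≤ (ℤₚ.≤-trans k<x (pred≤ x)) C≥0) (ha₃ x k C))))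
        (cong (0ℤ ⊔_) (ha₄ x k C)) , ha₅ x k C
  ... | inj₁ p | inj₂ q
    rewrite ind-yes p | ind-no {x} q | pred-⊓ {x} p | ℤₚ.i≥j⇒i⊓j≡j q | ℤₚ.i≤j⇒i⊓j≡i p | low-⊓ {x} q
          | ind-yes {x} {S} (lin (ℤₚ.+-mono-≤ (ℤₚ.+-mono-≤ p k≤l) C≥0) (hb₁ x k m l C))
          | max0 (lin {d = C + (x - 1ℤ) + l - k - (x - 1ℤ)} (ℤₚ.+-mono-≤ k≤l C≥0) (hb₂ x k l C))
          | max0 (lin {d = C + x + l - k - x} (ℤₚ.+-mono-≤ k≤l C≥0) (hb₃ x k l C))
    = trans (sym (max0 (lin {d = C + x + l - k - x} (ℤₚ.+-mono-≤ k≤l C≥0) (hb₃ x k l C))))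
        (cong (0ℤ ⊔_) (hb₄ x k l C)) , hb₅ x k l C
  ... | inj₂ p | inj₁ q
    rewrite ind-yes q | ind-no {x} p | pred-⊓ {x} q | ℤₚ.i≥j⇒i⊓j≡j p | ℤₚ.i≤j⇒i⊓j≡i q | low-⊓ {x} p
          | ind-yes {x} {S} (lin (ℤₚ.+-mono-≤ (ℤₚ.+-mono-≤ k≤m q) C≥0) (hc₁ x k m l C))
          | max0 (lin {d = C + m + (x - 1ℤ) - k - (x - 1ℤ)} (ℤₚ.+-mono-≤ k≤m C≥0) (hc₂ x k m C))
          | max0 (lin {d = C + m + x - k - x} (ℤₚ.+-mono-≤ k≤m C≥0) (hc₃ x k m C))
    = trans (sym (max0 (lin {d = C + m + x - k - x} (ℤₚ.+-mono-≤ k≤m C≥0) (hc₃ x k m C))))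
        (cong (0ℤ ⊔_) (hc₄ x k m C)) , hc₅ x k m C
  ... | inj₂ p | inj₂ q
    rewrite ind-no {x} p | ind-no {x} q | ℤₚ.i≥j⇒i⊓j≡j p | ℤₚ.i≥j⇒i⊓j≡j q | low-⊓ {x} p | low-⊓ {x} q
    with below x S
  ... | inj₁ r
    rewrite ind-yes r
          | max0 (lin {d = C + m + l - k - (x - 1ℤ)} (ℤₚ.≤-trans (pred≤ x) r) (he₂ x k m l C))
          | max0 (lin {d = C + m + l - k - x} r (he₃ x k m l C))
    = trans (sym (max0 (lin {d = C + m + l - k - x} r (he₃ x k m l C)))) (cong (0ℤ ⊔_) (he₄ x k m l C)) , he₅ x k m l C
  ... | inj₂ r
    rewrite ind-no {x} r
          | min0 (lin {c = C + m + l - k - (x - 1ℤ)} r (hf₂ x k m l C))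
          | min0 (lin {c = C + m + l - k - x} (ℤₚ.≤-trans r (pred≤ x)) (hf₃ x k m l C))
    = refl , refl

-- The sequence c of LocalRule in closed form.
carryAt : (κ μ ƛ : Vec ℤ ℓ) → ℤ → ℤ
carryAt [] [] [] x = 0ℤ
carryAt (κ₁ ∷ κ) (μ₁ ∷ μ) (ƛ₁ ∷ ƛ) x with x ℤₚ.≤? κ₁
... | yes _ = carryAt κ μ ƛ x
... | no _  = 0ℤ ⊔ (carry κ μ ƛ κ₁ + (x ⊓ μ₁) + (x ⊓ ƛ₁) - κ₁ - x)

carryAt-low : ∀ κ₁ μ₁ ƛ₁ (κ μ ƛ : Vec ℤ ℓ) {x} → x ≤ κ₁ → carryAt (κ₁ ∷ κ) (μ₁ ∷ μ) (ƛ₁ ∷ ƛ) x ≡ carryAt κ μ ƛ x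
carryAt-low κ₁ μ₁ ƛ₁ κ μ ƛ {x} p with x ℤₚ.≤? κ₁
... | yes _ = refl
... | no ¬p = contradiction p ¬p

carryAt-top : ∀ {κ μ ƛ : Vec ℤ ℓ} {x} → All (_≤ x) μ → All (_≤ x) ƛ → κ ≼ μ → κ ≼ ƛ → carryAt κ μ ƛ x ≡ carry κ μ ƛ x

carryAt-high : ∀ {κ₁ μ₁ ƛ₁} {κ μ ƛ : Vec ℤ ℓ} {x} → κ₁ ≤ x → (κ₁ ∷ κ) ≼ (μ₁ ∷ μ) → (κ₁ ∷ κ) ≼ (ƛ₁ ∷ ƛ) →
  carryAt (κ₁ ∷ κ) (μ₁ ∷ μ) (ƛ₁ ∷ ƛ) x ≡ 0ℤ ⊔ (carry κ μ ƛ κ₁ + (x ⊓ μ₁) + (x ⊓ ƛ₁) - κ₁ - x)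
carryAt-high {κ₁ = κ₁} {μ₁} {ƛ₁} {κ} {μ} {ƛ} {x} k≤x p q with x ℤₚ.≤? κ₁
... | no _ = refl
... | yes x≤k with ℤₚ.≤-antisym k≤x x≤k
... | refl rewrite ℤₚ.i≤j⇒i⊓j≡i (≼-head p) | ℤₚ.i≤j⇒i⊓j≡i (≼-head q) =
  trans (carryAt-top (≼-boundʳ p) (≼-boundʳ q) (≼-tailˡ p) (≼-tailˡ q))
    (trans (sym (ℤₚ.i≤j⇒i⊔j≡j (carry≥0 κ μ ƛ κ₁))) (cong (0ℤ ⊔_) (h (carry κ μ ƛ κ₁) κ₁)))
  where h : ∀ C k → C ≡ C + k + k - k - k
        h = solve-∀

carryAt-top {κ = []} {[]} {[]} _ _ _ _ = refl
carryAt-top {κ = κ₁ ∷ κ} {μ₁ ∷ μ} {ƛ₁ ∷ ƛ} {x} (m≤x ∷ _) (l≤x ∷ _) p q =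
  trans (carryAt-high (ℤₚ.≤-trans (≼-head p) m≤x) p q)
    (trans (cong₂ (λ u v → 0ℤ ⊔ (C + u + v - κ₁ - x)) (ℤₚ.i≥j⇒i⊓j≡j m≤x) (ℤₚ.i≥j⇒i⊓j≡j l≤x))
           (cong (0ℤ ⊔_) (h C μ₁ ƛ₁ κ₁ x)))
  where
  C = carry κ μ ƛ κ₁
  h : ∀ C m l k x → C + m + l - k - x ≡ m + l - k + C - x
  h = solve-∀

carryAt-start : (κ μ ƛ : Vec ℤ ℓ) → ∃[ x₀ ] ∀ x → x ≤ x₀ → carryAt κ μ ƛ x ≡ 0ℤ
carryAt-start [] [] [] = 0ℤ , λ _ _ → refl
carryAt-start (κ₁ ∷ κ) (μ₁ ∷ μ) (ƛ₁ ∷ ƛ) =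
  let x₀ , f = carryAt-start κ μ ƛ in κ₁ ⊓ x₀ , λ x p →
    trans (carryAt-low κ₁ μ₁ ƛ₁ κ μ ƛ (ℤₚ.≤-trans p (ℤₚ.i⊓j≤i κ₁ x₀))) (f x (ℤₚ.≤-trans p (ℤₚ.i⊓j≤j κ₁ x₀)))

-- capping the top row at u is invisible at columns x ≤ u
conj-fill : ∀ {u x} (κ μ ƛ : Vec ℤ ℓ) → x ≤ u → conj (fill u κ μ ƛ) x ≡ conj (insert κ μ ƛ) x
conj-fill [] [] [] p = refl
conj-fill {u = u} {x} (κ₁ ∷ κ) (μ₁ ∷ μ) (ƛ₁ ∷ ƛ) p =
  trans (conj-∷ (u ⊓ s) r x) (trans (cong (_+ conj r x) e) (sym (conj-∷ s r x)))
  where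
  s = fullRow κ₁ μ₁ ƛ₁ κ μ ƛ
  r = fill κ₁ κ μ ƛ
  e : ind x (u ⊓ s) ≡ ind x s
  e with x ℤₚ.≤? s
  ... | yes q = trans (ind-yes (ℤₚ.⊓-glb p q)) refl
  ... | no ¬q = trans (ind-no {x} (ℤₚ.≤-trans (ℤₚ.i⊓j≤j u s) (lt ¬q))) refl

fill-bound : ∀ {u x} {κ μ ƛ : Vec ℤ ℓ} → u ≤ x → All (_≤ x) κ → All (_≤ x) (fill u κ μ ƛ)
fill-bound {κ = []} {[]} {[]} p [] = []
fill-bound {κ = κ₁ ∷ κ} {μ₁ ∷ μ} {ƛ₁ ∷ ƛ} p (q ∷ qs) = ℤₚ.≤-trans (ℤₚ.i⊓j≤i _ _) p ∷ fill-bound q qs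

Column : (m l k n c⁻ c : ℤ) → Set
Column m l k n c⁻ c = (c ≡ 0ℤ ⊔ ((m - k) + (l - k) + c⁻ - 1ℤ)) × (n ≡ m + l - k + c⁻ - c)

column-low : ∀ {m l k n c⁻ c m′ l′ k′ n′ c′⁻ c′} →
  m ≡ 1ℤ + m′ → l ≡ 1ℤ + l′ → k ≡ 1ℤ + k′ → n ≡ 1ℤ + n′ → c⁻ ≡ c′⁻ → c ≡ c′ →
  Column m′ l′ k′ n′ c′⁻ c′ → Column m l k n c⁻ c
column-low {m′ = m} {l} {k} {n} {c⁻} {c} refl refl refl refl refl refl (p , q) =
  trans p (cong (0ℤ ⊔_) (h₁ m l k c⁻)) , trans (cong (λ z → 1ℤ + z) q) (h₂ m l k c⁻ c)
  where
  h₁ : ∀ m l k c → (m - k) + (l - k) + c - 1ℤ ≡ (1ℤ + m - (1ℤ + k)) + (1ℤ + l - (1ℤ + k)) + c - 1ℤ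
  h₁ = solve-∀
  h₂ : ∀ m l k c c′ → 1ℤ + (m + l - k + c - c′) ≡ 1ℤ + m + (1ℤ + l) - (1ℤ + k) + c - c′
  h₂ = solve-∀

column-high : ∀ {m l k n c⁻ c m′ l′ n′ c′⁻ c′} →
  m ≡ m′ → l ≡ l′ → k ≡ 0ℤ → n ≡ n′ → c⁻ ≡ c′⁻ → c ≡ c′ →
  (c′ ≡ 0ℤ ⊔ (m′ + l′ + c′⁻ - 1ℤ)) × (n′ ≡ m′ + l′ + c′⁻ - c′) → Column m l k n c⁻ c
column-high {m′ = m} {l} {n} {c⁻} {c} refl refl refl refl refl refl (p , q) =
  trans p (cong (0ℤ ⊔_) (h₁ m l c⁻)) , trans q (h₂ m l c⁻ c)
  where
  h₁ : ∀ m l c → m + l + c - 1ℤ ≡ (m - 0ℤ) + (l - 0ℤ) + c - 1ℤ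
  h₁ = solve-∀
  h₂ : ∀ m l c c′ → m + l + c - c′ ≡ m + l - 0ℤ + c - c′
  h₂ = solve-∀

conj-top : ∀ t {v : Vec ℤ ℓ} x {y} → All (_≤ y) v → y ≤ x - 1ℤ → conj (t ∷ v) x ≡ ind x t
conj-top t {v} x p q = trans (conj-∷ t v x) (trans (cong (λ z → ind x t + z) (conj-zero {x = x} p q)) (ℤₚ.+-identityʳ _))

column : {κ μ ƛ : Vec ℤ ℓ} → κ ≼ μ → κ ≼ ƛ → ∀ x →
  Column (conj μ x) (conj ƛ x) (conj κ x) (conj (insert κ μ ƛ) x) (carryAt κ μ ƛ (x - 1ℤ)) (carryAt κ μ ƛ x)
column {κ = []} {[]} {[]} _ _ x = refl , refl
column {κ = κ₁ ∷ κ} {μ₁ ∷ μ} {ƛ₁ ∷ ƛ} p q x = case (x ℤₚ.≤? κ₁)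
  where
  case : Dec (x ≤ κ₁) → _
  case (yes x≤k) = column-low {m′ = conj μ x} {conj ƛ x} {conj κ x} {conj (insert κ μ ƛ) x}
    (conj-yes μ (ℤₚ.≤-trans x≤k (≼-head p))) (conj-yes ƛ (ℤₚ.≤-trans x≤k (≼-head q))) (conj-yes κ x≤k)
    (trans (conj-yes (fill κ₁ κ μ ƛ) (ℤₚ.≤-trans x≤k (ℤₚ.≤-trans (≼-head p) (fullRow≥ κ μ ƛ (≼-head q)))))
           (cong (λ z → 1ℤ + z) (conj-fill κ μ ƛ x≤k)))
    (carryAt-low κ₁ μ₁ ƛ₁ κ μ ƛ (ℤₚ.≤-trans (pred≤ x) x≤k))
    (carryAt-low κ₁ μ₁ ƛ₁ κ μ ƛ x≤k)
    (column (≼-tailˡ p) (≼-tailˡ q) x)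
  case (no x≰k) = column-high
    (conj-top μ₁ x (≼-boundʳ p) (lt x≰k)) (conj-top ƛ₁ x (≼-boundʳ q) (lt x≰k))
    (trans (conj-top κ₁ x (≼-boundˡ p) (lt x≰k)) (ind-no {x} (lt x≰k)))
    (conj-top _ x (fill-bound {κ = κ} {μ} {ƛ} ℤₚ.≤-refl (≼-boundˡ p)) (lt x≰k))
    (carryAt-high (lt x≰k) p q) (carryAt-high (ℤₚ.≤-trans (lt x≰k) (pred≤ x)) p q)
    (Local.both κ₁ μ₁ ƛ₁ (carry κ μ ƛ κ₁) (≼-head p) (≼-head q) (carry≥0 κ μ ƛ κ₁) x (lt x≰k))

insert-rule : {κ μ ƛ : Vec ℤ ℓ} → κ ≼ μ → κ ≼ ƛ → LocalRule κ μ ƛ (insert κ μ ƛ)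
insert-rule {κ = κ} {μ} {ƛ} p q = record
  { c = carryAt κ μ ƛ
  ; c-start = carryAt-start κ μ ƛ
  ; c-carry = λ x → proj₁ (column p q x)
  ; ν-conj = λ x → proj₂ (column p q x)
  }

cancel : ∀ a {b c} → a + b ≡ a + c → b ≡ c
cancel a {b} {c} e = trans (h a b) (trans (cong (_- a) e) (sym (h a c)))
  where h : ∀ a b → b ≡ a + b - a
        h = solve-∀

conj-injective : {v w : Vec ℤ ℓ} → Linked _≥_ v → Linked _≥_ w → (∀ x → conj v x ≡ conj w x) → v ≡ w
conj-injective {v = []} {[]} _ _ _ = refl
conj-injective {v = a ∷ v} {b ∷ w} p q f = cong₂ _∷_ a≡b (conj-injective (tl p) (tl q) λ x →
    cancel (ind x a) (trans (sym (conj-∷ a v x)) (trans (f x) (trans (conj-∷ b w x) (cong (λ z → ind x z + conj w x) (sym a≡b))))))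
  where
  tl : ∀ {n a} {v : Vec ℤ n} → Linked _≥_ (a ∷ v) → Linked _≥_ v
  tl [-] = []
  tl (_ ∷ r) = r
  bound : ∀ {n a} {v : Vec ℤ n} → Linked _≥_ (a ∷ v) → All (_≤ a) v
  bound [-] = []
  bound {v = b ∷ v} (r ∷ rs) = r ∷ All.map (λ s → ℤₚ.≤-trans s r) (bound rs)
  absurd : ∀ {n a b} {v w : Vec ℤ n} → Linked _≥_ (a ∷ v) → conj (a ∷ v) b ≡ conj (b ∷ w) b → b ≤ a
  absurd {a = a} {b} {v} {w} r e with b ℤₚ.≤? a
  ... | yes s = s
  ... | no ¬s with trans (sym (cong₂ _+_ (ind-no {b} {a} (lt ¬s)) (conj-zero {x = b} (bound r) (lt ¬s))))
                    (trans (sym (conj-∷ a v b)) (trans (e′ ¬s) (conj-yes {t = b} w ℤₚ.≤-refl)))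
    where e′ : ¬ (b ≤ a) → conj (a ∷ v) b ≡ conj (b ∷ w) b
          e′ _ rewrite dec-false (b ℤₚ.≤? a) ¬s = e
  ... | ()
  a≡b : a ≡ b
  a≡b = ℤₚ.≤-antisym (absurd {w = v} q (sym (f a))) (absurd {w = w} p (f b))

module _ {κ μ ƛ ν ν′ : Vec ℤ ℓ} (R : LocalRule κ μ ƛ ν) (R′ : LocalRule κ μ ƛ ν′) where
  private
    module R = LocalRule R
    module R′ = LocalRule R′

    x₀ : ℤ
    x₀ = proj₁ R.c-start ⊓ proj₁ R′.c-start

    above : ∀ k → R.c (x₀ + + k) ≡ R′.c (x₀ + + k)
    above zero = trans (proj₂ R.c-start _ (ℤₚ.≤-trans (ℤₚ.≤-reflexive (ℤₚ.+-identityʳ x₀)) (ℤₚ.i⊓j≤i _ _)))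
      (sym (proj₂ R′.c-start _ (ℤₚ.≤-trans (ℤₚ.≤-reflexive (ℤₚ.+-identityʳ x₀)) (ℤₚ.i⊓j≤j _ _))))
    above (suc k) = trans (R.c-carry x) (trans
       (cong (λ z → 0ℤ ⊔ (R.a x + R.b x + z - 1ℤ)) (subst (λ y → R.c y ≡ R′.c y) (h x₀ (+ k)) (above k)))
       (sym (R′.c-carry x)))
      where
      x = x₀ + + suc k
      h : ∀ x y → x + y ≡ x + (1ℤ + y) - 1ℤ
      h = solve-∀

    carries : ∀ x → R.c x ≡ R′.c x
    carries x with ℤₚ.≤-total x x₀
    ... | inj₁ p = trans (proj₂ R.c-start x (ℤₚ.≤-trans p (ℤₚ.i⊓j≤i _ _)))
                     (sym (proj₂ R′.c-start x (ℤₚ.≤-trans p (ℤₚ.i⊓j≤j _ _))))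
    ... | inj₂ p = subst (λ y → R.c y ≡ R′.c y) e (above ∣ x - x₀ ∣)
      where
      h : ∀ x y → x + (y - x) ≡ y
      h = solve-∀
      e : x₀ + + ∣ x - x₀ ∣ ≡ x
      e = trans (cong (λ z → x₀ + z) (ℤₚ.0≤i⇒+∣i∣≡i (ℤₚ.i≤j⇒0≤j-i p))) (h x₀ x)

  rule-unique : Linked _≥_ ν → Linked _≥_ ν′ → ν ≡ ν′
  rule-unique p q = conj-injective p q λ x →
    trans (R.ν-conj x) (trans (cong₂ (λ u v → conj μ x + conj ƛ x - conj κ x + u - v) (carries _) (carries x)) (sym (R′.ν-conj x)))

module _ {X : Set} where

  lookup-zero : ∀ {n} (v : Vec X (suc n)) → lookup v zero ≡ head v
  lookup-zero (x ∷ v) = refl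

  lookup-last : ∀ {n} (v : Vec X (suc n)) → lookup v (fromℕ n) ≡ last v
  lookup-last {zero} (x ∷ []) = refl
  lookup-last {suc n} (x ∷ v) = lookup-last v

  init∷ʳlast : ∀ {n} (v : Vec X (suc n)) → init v ∷ʳ last v ≡ v
  init∷ʳlast v = sym (proj₂ (proj₂ (Vec.initLast v)))

  lookup-∷ʳ : ∀ {n} (v : Vec X n) x i → lookup (v ∷ʳ x) (inject₁ i) ≡ lookup v i
  lookup-∷ʳ (y ∷ v) x zero = refl
  lookup-∷ʳ (y ∷ v) x (suc i) = lookup-∷ʳ v x i

  tabulate-∷ʳ : ∀ {n} (f : ℕ → X) →
    tabulate {n = n} (f ∘ toℕ) ∷ʳ f n ≡ tabulate {n = suc n} (f ∘ toℕ)
  tabulate-∷ʳ {zero} f = refl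
  tabulate-∷ʳ {suc n} f = cong (f 0 ∷_) (tabulate-∷ʳ (f ∘ suc))

  last-tabulate : ∀ {n} (f : ℕ → X) → last (tabulate {n = suc n} (f ∘ toℕ)) ≡ f n
  last-tabulate {zero} f = refl
  last-tabulate {suc n} f = last-tabulate (f ∘ suc)

  module _ {R : X → X → Set} where

    linked-tabulate : ∀ {n} (f : ℕ → X) → (∀ i → R (f i) (f (suc i))) → Linked R (tabulate {n = n} (f ∘ toℕ))
    linked-tabulate {zero} f r = []
    linked-tabulate {suc zero} f r = [-]
    linked-tabulate {suc (suc n)} f r = r 0 ∷ linked-tabulate (f ∘ suc) (r ∘ suc)

    linked-∷ʳ : ∀ {n} (v : Vec X (suc n)) {x} → Linked R v → R (last v) x → Linked R (v ∷ʳ x)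
    linked-∷ʳ (y ∷ []) [-] q = q ∷ [-]
    linked-∷ʳ (y ∷ z ∷ v) (p ∷ ps) q = p ∷ linked-∷ʳ (z ∷ v) ps q

    linked-init : ∀ {n} (v : Vec X (suc n)) → Linked R v → Linked R (init v)
    linked-init (y ∷ []) [-] = []
    linked-init (y ∷ z ∷ []) (p ∷ ps) = [-]
    linked-init (y ∷ z ∷ w ∷ v) (p ∷ ps) = p ∷ linked-init (z ∷ w ∷ v) ps

    linked-last : ∀ {n} (v : Vec X (suc (suc n))) → Linked R v → R (last (init v)) (last v)
    linked-last (x ∷ y ∷ []) (p ∷ _) = p
    linked-last (x ∷ y ∷ z ∷ v) (p ∷ ps) = linked-last (y ∷ z ∷ v) ps

    linked-lookup : ∀ {n} {v : Vec X (suc n)} → Linked R v → ∀ i → R (lookup v (inject₁ i)) (lookup v (suc i))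
    linked-lookup {v = _ ∷ _ ∷ _} (p ∷ ps) zero = p
    linked-lookup {v = _ ∷ _ ∷ _} (p ∷ ps) (suc i) = linked-lookup ps i

module _ (n : ℕ) .{{_ : NonZero n}} where

  quotient-unique-≤ : ∀ {r r′} q q′ → r′ ℕ.< n → + r + q * + n ≡ + r′ + q′ * + n → q ≤ q′
  quotient-unique-≤ {r} {r′} q q′ r′<n e = ℤₚ.≮⇒≥ λ q′<q → ℤₚ.<-irrefl (sym e) (ℤₚ.<-≤-trans
     (ℤₚ.+-monoˡ-< (q′ * + n) (+<+ r′<n))
     (ℤₚ.≤-trans (ℤₚ.≤-reflexive (h (+ n) q′))
     (ℤₚ.≤-trans (ℤₚ.*-monoʳ-≤-nonNeg (+ n) (ℤₚ.i<j⇒suc[i]≤j q′<q))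
       (ℤₚ.≤-trans (ℤₚ.≤-reflexive (sym (ℤₚ.+-identityˡ (q * + n)))) (ℤₚ.+-monoˡ-≤ (q * + n) (+≤+ z≤n))))))
    where h : ∀ n q → n + q * n ≡ (1ℤ + q) * n
          h = solve-∀

  quotient-unique : ∀ {r r′} q q′ → r ℕ.< n → r′ ℕ.< n → + r + q * + n ≡ + r′ + q′ * + n → q ≡ q′ × r ≡ r′
  quotient-unique {r} {r′} q q′ p p′ e
    with ℤₚ.≤-antisym (quotient-unique-≤ q q′ p′ e) (quotient-unique-≤ q′ q p (sym e))
  ... | refl = refl , ℤₚ.+-injective (trans (h (+ r) (q * + n)) (trans (cong (_- q * + n) e) (sym (h (+ r′) (q * + n)))))
    where h : ∀ a b → a ≡ a + b - b
          h = solve-∀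

  divmod : ∀ r q → r ℕ.< n → (+ r + q * + n) /ℕ n ≡ q × (+ r + q * + n) %ℕ n ≡ r
  divmod r q p = quotient-unique _ q (ℤ÷.n%ℕd<d x n) p (sym (ℤ÷.a≡a%ℕn+[a/ℕn]*n x n))
    where x = + r + q * + n

-- A local rule F (with κ at p and μ, ƛ at its two successors) that is invertible and respects ⊑.
record Growth (X : Set) : Set₁ where
  field
    _⊑_ : X → X → Set
    F B : X → X → X → X
    BF  : ∀ κ μ ƛ → B (F κ μ ƛ) μ ƛ ≡ κ
    FB  : ∀ ν μ ƛ → F (B ν μ ƛ) μ ƛ ≡ ν
    Fˡ  : ∀ {κ μ ƛ} → κ ⊑ μ → κ ⊑ ƛ → μ ⊑ F κ μ ƛ
    Fʳ  : ∀ {κ μ ƛ} → κ ⊑ μ → κ ⊑ ƛ → ƛ ⊑ F κ μ ƛ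
    Bˡ  : ∀ {ν μ ƛ} → μ ⊑ ν → ƛ ⊑ ν → B ν μ ƛ ⊑ μ
    Bʳ  : ∀ {ν μ ƛ} → μ ⊑ ν → ƛ ⊑ ν → B ν μ ƛ ⊑ ƛ

module Cylinder {X : Set} (G : Growth X) (m : ℕ) where
  open Growth G

  n : ℕ
  n = suc m

  Row : Set
  Row = Vec X (suc n)

  State : Set
  State = Row × Row

  record OK (s : State) : Set where
    constructor ok
    field
      corner : head (proj₁ s) ≡ head (proj₂ s)
      ends   : last (proj₁ s) ≡ last (proj₂ s)
      linkP  : Linked _⊑_ (proj₁ s)
      linkQ  : Linked _⊑_ (proj₂ s)
  open OK

  -- A state lists the values at (i , y) and at (0 , y + i), 0 ≤ i ≤ n; up passes from y to y + 1.
  scanF : ∀ {k} → Vec X (suc k) → X → Vec X (suc k)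
  scanF (p ∷ []) q = q ∷ []
  scanF (p ∷ p₁ ∷ ps) q = q ∷ scanF (p₁ ∷ ps) (F p p₁ q)

  scanB : ∀ {k} → Vec X (suc k) → X → Vec X (suc k)
  scanB (p ∷ []) z = z ∷ []
  scanB (p ∷ p₁ ∷ ps) z = B p₁ (head r) p ∷ r
    where r = scanB (p₁ ∷ ps) z

  head-scanF : ∀ {k} (v : Vec X (suc k)) q → head (scanF v q) ≡ q
  head-scanF (p ∷ []) q = refl
  head-scanF (p ∷ _ ∷ _) q = refl

  scanBF : ∀ {k} (v : Vec X (suc k)) q → scanB (scanF v q) (last v) ≡ v
  scanBF (p ∷ []) q = refl
  scanBF (p ∷ p₁ ∷ ps) q with scanF (p₁ ∷ ps) (F p p₁ q) | head-scanF (p₁ ∷ ps) (F p p₁ q) | scanBF (p₁ ∷ ps) (F p p₁ q)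
  ... | x ∷ xs | refl | e rewrite e = cong (_∷ p₁ ∷ ps) (BF p p₁ q)

  scanFB : ∀ {k} (v : Vec X (suc k)) z → scanF (scanB v z) (head v) ≡ v
  scanFB (p ∷ []) z = refl
  scanFB (p ∷ p₁ ∷ ps) z with scanB (p₁ ∷ ps) z | scanFB (p₁ ∷ ps) z
  ... | r₀ ∷ rs | e rewrite FB p₁ r₀ p = cong (p ∷_) e

  last-scanB : ∀ {k} (v : Vec X (suc k)) z → last (scanB v z) ≡ z
  last-scanB (p ∷ []) z = refl
  last-scanB (p ∷ p₁ ∷ ps) z = last-scanB (p₁ ∷ ps) z

  data Above : ∀ {k} → Vec X k → Vec X k → Set where
    []  : Above [] []
    _∷_ : ∀ {k p q} {ps qs : Vec X k} → p ⊑ q → Above ps qs → Above (p ∷ ps) (q ∷ qs)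

  above-head : ∀ {k} {v w : Vec X (suc k)} → Above v w → head v ⊑ head w
  above-head (p ∷ _) = p

  above-last : ∀ {k} {v w : Vec X (suc k)} → Above v w → last v ⊑ last w
  above-last {v = _ ∷ []} {_ ∷ []} (p ∷ _) = p
  above-last {v = _ ∷ _ ∷ _} {_ ∷ _ ∷ _} (_ ∷ ps) = above-last ps

  above-lookup : ∀ {k} {v w : Vec X k} → Above v w → ∀ i → lookup v i ⊑ lookup w i
  above-lookup (p ∷ _) zero = p
  above-lookup (_ ∷ ps) (suc i) = above-lookup ps i

  scanF-above : ∀ {k} {v : Vec X (suc k)} {q} → Linked _⊑_ v → head v ⊑ q → Above v (scanF v q)
  scanF-above {v = _ ∷ []} [-] p = p ∷ []
  scanF-above {v = _ ∷ _ ∷ _} (r ∷ rs) p = p ∷ scanF-above rs (Fˡ r p)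

  scanF-linked : ∀ {k} {v : Vec X (suc k)} {q} → Linked _⊑_ v → head v ⊑ q → Linked _⊑_ (scanF v q)
  scanF-linked {v = _ ∷ []} [-] p = [-]
  scanF-linked {v = a ∷ b ∷ v} {q} (r ∷ rs) p =
    subst (q ⊑_) (sym (head-scanF (b ∷ v) _)) (Fʳ r p) ∷ scanF-linked rs (Fˡ r p)

  scanB-above : ∀ {k} {v : Vec X (suc k)} {z} → Linked _⊑_ v → z ⊑ last v → Above (scanB v z) v
  scanB-above {v = _ ∷ []} [-] p = p ∷ []
  scanB-above {v = a ∷ b ∷ v} {z} (r ∷ rs) p =
    Bʳ (above-head ih) r ∷ ih
    where ih = scanB-above rs p

  scanB-linked : ∀ {k} {v : Vec X (suc k)} {z} → Linked _⊑_ v → z ⊑ last v → Linked _⊑_ (scanB v z)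
  scanB-linked {v = _ ∷ []} [-] p = [-]
  scanB-linked {v = a ∷ b ∷ v} {z} (r ∷ rs) p =
    Bˡ (above-head (scanB-above rs p)) r ∷ scanB-linked rs p

  scanF-rule : ∀ {k} (v : Vec X (suc k)) q i → lookup (scanF v q) (suc i) ≡
    F (lookup v (inject₁ i)) (lookup v (suc i)) (lookup (scanF v q) (inject₁ i))
  scanF-rule (a ∷ b ∷ v) q zero = trans (lookup-zero (scanF (b ∷ v) _)) (head-scanF (b ∷ v) _)
  scanF-rule (a ∷ b ∷ v) q (suc i) = scanF-rule (b ∷ v) _ i

  up down : State → State
  up (P , q ∷ qs) = let P′ = scanF P (head qs) in P′ , qs ∷ʳ last P′
  down (P′ , Q′) = let P = scanB P′ (last (init Q′)) in P , head P ∷ init Q′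

  down-up : ∀ s → head (proj₁ s) ≡ head (proj₂ s) → last (proj₁ s) ≡ last (proj₂ s) → down (up s) ≡ s
  down-up (P , q ∷ qs) c e
    rewrite Vecₚ.init-∷ʳ (last (scanF P (head qs))) qs | sym e | scanBF P (head qs) | c = refl

  head-init : ∀ {k} (v : Vec X (suc (suc k))) → head (init v) ≡ head v
  head-init (a ∷ b ∷ v) = refl

  up-down : ∀ s → OK s → up (down s) ≡ s
  up-down (P′ , Q′) o
    rewrite head-init Q′ | sym (corner o) | scanFB P′ (last (init Q′)) | ends o = cong (P′ ,_) (init∷ʳlast Q′)

  head-∷ʳ : ∀ {k} (v : Vec X (suc k)) x → head (v ∷ʳ x) ≡ head v
  head-∷ʳ (y ∷ v) x = refl

  up-vertical : ∀ {s} → OK s → Above (proj₁ s) (proj₁ (up s))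
  up-vertical {P , q ∷ qs@(_ ∷ _)} (ok c e l (r ∷ rs)) = scanF-above l (subst (_⊑ head qs) (sym c) r)

  up-ok : ∀ {s} → OK s → OK (up s)
  up-ok {P , q ∷ qs@(q₁ ∷ _)} o@(ok c e l (r ∷ rs)) = ok
    (trans (head-scanF P q₁) (sym (head-∷ʳ qs (last (scanF P q₁)))))
    (sym (Vecₚ.last-∷ʳ _ qs))
    (scanF-linked l (subst (_⊑ q₁) (sym c) r))
    (linked-∷ʳ qs rs (subst (_⊑ last (scanF P q₁)) e (above-last (up-vertical o))))

  down-ok : ∀ {s} → OK s → OK (down s)
  down-ok {P , Q@(_ ∷ _ ∷ _)} (ok c e l r) = ok refl
    (trans (last-scanB P (last (init Q))) (last-∷ (head (scanB P (last (init Q)))) (init Q)))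
    (scanB-linked l z) (linked-∷ (subst (head (scanB P (last (init Q))) ⊑_) (trans c (sym (head-init Q))) (above-head (scanB-above l z))) (linked-init Q r))
    where
    z = subst (last (init Q) ⊑_) (sym e) (linked-last Q r)
    last-∷ : ∀ {k} a (v : Vec X (suc k)) → last v ≡ last (a ∷ v)
    last-∷ a v = refl
    linked-∷ : ∀ {k a} {v : Vec X (suc k)} → a ⊑ head v → Linked _⊑_ v → Linked _⊑_ (a ∷ v)
    linked-∷ p ps = p ∷ ps

  iterate : State → ℤ → State
  iterate s (+ zero)      = s
  iterate s (+ suc k)     = up (iterate s (+ k))
  iterate s -[1+ zero ]   = down s
  iterate s -[1+ suc k ]  = down (iterate s -[1+ k ])

  iterate-ok : ∀ {s} → OK s → ∀ y → OK (iterate s y)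
  iterate-ok o (+ zero) = o
  iterate-ok o (+ suc k) = up-ok (iterate-ok o (+ k))
  iterate-ok o -[1+ zero ] = down-ok o
  iterate-ok o -[1+ suc k ] = down-ok (iterate-ok o -[1+ k ])

  iterate-suc : ∀ {s} → OK s → ∀ y → iterate s (ℤ.suc y) ≡ up (iterate s y)
  iterate-suc o (+ k) = refl
  iterate-suc {s} o -[1+ zero ] = sym (up-down s o)
  iterate-suc {s} o -[1+ suc k ] = sym (up-down _ (iterate-ok o -[1+ k ]))

  residue : ℤ → Fin n
  residue x = fromℕ< (ℤ÷.n%ℕd<d x n)

  -- (x , y) is represented by the point (x mod n , y + n ⌊x / n⌋) of its class.
  extend : State → ℤ → ℤ → X
  extend s x y = lookup (proj₁ (iterate s (y + (x /ℕ n) * + n))) (inject₁ (residue x))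

  split : ∀ x → x ≡ + toℕ (residue x) + (x /ℕ n) * + n
  split x = trans (ℤ÷.a≡a%ℕn+[a/ℕn]*n x n) (cong (λ r → + r + (x /ℕ n) * + n) (sym (Finₚ.toℕ-fromℕ< (ℤ÷.n%ℕd<d x n))))

  extend-inner : ∀ s (i : Fin n) q y →
    extend s (+ toℕ i + q * + n) y ≡ lookup (proj₁ (iterate s (y + q * + n))) (inject₁ i)
  extend-inner s i q y = cong₂ (λ a b → lookup (proj₁ (iterate s (y + a * + n))) (inject₁ b))
     (proj₁ d) (Finₚ.toℕ-injective (trans (Finₚ.toℕ-fromℕ< _) (proj₂ d)))
    where d = divmod n (toℕ i) q (Finₚ.toℕ<n i)

  module _ {s : State} (o : OK s) where

    private
      row : ℤ → Row
      row y = proj₁ (iterate s y)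

      col : ℤ → Row
      col y = proj₂ (iterate s y)

      up-col : ∀ s (j : Fin n) → lookup (proj₂ (up s)) (inject₁ j) ≡ lookup (proj₂ s) (suc j)
      up-col (P , q ∷ qs) j = lookup-∷ʳ qs _ j

      climb : ∀ k (j : Fin (suc n)) → toℕ j ≡ k → ∀ y → lookup (row (y + + k)) zero ≡ lookup (col y) j
      climb zero zero refl y = trans (cong (λ z → lookup (row z) zero) (ℤₚ.+-identityʳ y))
        (trans (lookup-zero (row y)) (trans (corner (iterate-ok o y)) (sym (lookup-zero (col y)))))
      climb (suc k) (suc j) refl y = trans (cong (λ z → lookup (row z) zero) (h y (+ k)))
        (trans (climb k (inject₁ j) (Finₚ.toℕ-inject₁ j) (ℤ.suc y))
        (trans (cong (λ t → lookup (proj₂ t) (inject₁ j)) (iterate-suc o y)) (up-col (iterate s y) j)))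
        where h : ∀ y k → y + (1ℤ + k) ≡ 1ℤ + y + k
              h = solve-∀

      wrap : ∀ y → lookup (row (y + + n)) zero ≡ lookup (row y) (fromℕ n)
      wrap y = trans (climb n (fromℕ n) (Finₚ.toℕ-fromℕ n) y)
        (trans (lookup-last (col y)) (trans (sym (ends (iterate-ok o y))) (sym (lookup-last (row y)))))

    extend-row : ∀ (i : Fin (suc n)) q y →
      extend s (+ toℕ i + q * + n) y ≡ lookup (row (y + q * + n)) i
    extend-row i q y with view i
    ... | ‵inject₁ j = trans (cong (λ k → extend s (+ k + q * + n) y) (Finₚ.toℕ-inject₁ j)) (extend-inner s j q y)
    ... | ‵fromℕ = trans (cong (λ x → extend s x y) (trans (cong (λ k → + k + q * + n) (Finₚ.toℕ-fromℕ n)) (h₁ (+ n) q)))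
        (trans (extend-inner s zero (1ℤ + q) y)
        (trans (cong (λ z → lookup (row z) zero) (h₂ y (+ n) q)) (wrap (y + q * + n))))
      where
      h₁ : ∀ n q → n + q * n ≡ 0ℤ + (1ℤ + q) * n
      h₁ = solve-∀
      h₂ : ∀ y n q → y + (1ℤ + q) * n ≡ y + q * n + n
      h₂ = solve-∀

    private
      -- reduce a statement about the column x to one inside a period
      reduce : (A : ℤ → Set) → (∀ (i : Fin n) q → A (+ toℕ i + q * + n)) → ∀ x → A x
      reduce A f x = subst A (sym (split x)) (f (residue x) (x /ℕ n))

      suc-y : ∀ q y → ℤ.suc y + q * + n ≡ ℤ.suc (y + q * + n)
      suc-y q y = ℤₚ.+-assoc 1ℤ y (q * + n)

      suc-x : ∀ (i : Fin n) q → ℤ.suc (+ toℕ i + q * + n) ≡ + toℕ (suc i) + q * + n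
      suc-x i q = sym (ℤₚ.+-assoc 1ℤ (+ toℕ i) (q * + n))

      up-row : ∀ y → row (ℤ.suc y) ≡ proj₁ (up (iterate s y))
      up-row y = cong proj₁ (iterate-suc o y)

    extend-periodic : ∀ k x y → extend s (x + k * + n) (y - k * + n) ≡ extend s x y
    extend-periodic k x y = reduce (λ x → extend s (x + k * + n) (y - k * + n) ≡ extend s x y) go x
      where
      h₁ : ∀ i q k n → i + q * n + k * n ≡ i + (q + k) * n
      h₁ = solve-∀
      h₂ : ∀ y q k n → y - k * n + (q + k) * n ≡ y + q * n
      h₂ = solve-∀
      go : ∀ (i : Fin n) q → extend s (+ toℕ i + q * + n + k * + n) (y - k * + n) ≡ extend s (+ toℕ i + q * + n) y
      go i q = trans (cong (λ x → extend s x (y - k * + n)) (h₁ (+ toℕ i) q k (+ n)))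
        (trans (extend-inner s i (q + k) (y - k * + n))
        (trans (cong (λ z → lookup (row z) (inject₁ i)) (h₂ y q k (+ n))) (sym (extend-inner s i q y))))

    extend-right : ∀ x y → extend s x y ⊑ extend s (ℤ.suc x) y
    extend-right x y = reduce (λ x → extend s x y ⊑ extend s (ℤ.suc x) y) go x
      where
      go : ∀ (i : Fin n) q → extend s (+ toℕ i + q * + n) y ⊑ extend s (ℤ.suc (+ toℕ i + q * + n)) y
      go i q = subst₂ _⊑_ (sym (extend-inner s i q y))
        (sym (trans (cong (λ x → extend s x y) (suc-x i q)) (extend-row (suc i) q y)))
        (linked-lookup (linkP (iterate-ok o (y + q * + n))) i)

    extend-up : ∀ x y → extend s x y ⊑ extend s x (ℤ.suc y)
    extend-up x y = reduce (λ x → extend s x y ⊑ extend s x (ℤ.suc y)) go x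
      where
      go : ∀ (i : Fin n) q → extend s (+ toℕ i + q * + n) y ⊑ extend s (+ toℕ i + q * + n) (ℤ.suc y)
      go i q = subst₂ _⊑_ (sym (extend-inner s i q y))
        (sym (trans (extend-inner s i q (ℤ.suc y)) (cong (λ r → lookup r (inject₁ i)) (trans (cong row (suc-y q y)) (up-row (y + q * + n))))))
        (above-lookup (up-vertical (iterate-ok o (y + q * + n))) (inject₁ i))

    extend-rule : ∀ x y → extend s (ℤ.suc x) (ℤ.suc y) ≡ F (extend s x y) (extend s (ℤ.suc x) y) (extend s x (ℤ.suc y))
    extend-rule x y = reduce (λ x → extend s (ℤ.suc x) (ℤ.suc y) ≡ F (extend s x y) (extend s (ℤ.suc x) y) (extend s x (ℤ.suc y))) go x
      where
      go : ∀ (i : Fin n) q → let x = + toℕ i + q * + n in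
        extend s (ℤ.suc x) (ℤ.suc y) ≡ F (extend s x y) (extend s (ℤ.suc x) y) (extend s x (ℤ.suc y))
      go i q
        rewrite suc-x i q | extend-row (suc i) q (ℤ.suc y) | extend-row (suc i) q y
              | extend-inner s i q (ℤ.suc y) | extend-inner s i q y
              | suc-y q y | up-row (y + q * + n) = scan (iterate s (y + q * + n))
        where
        scan : ∀ t → lookup (proj₁ (up t)) (suc i) ≡
          F (lookup (proj₁ t) (inject₁ i)) (lookup (proj₁ t) (suc i)) (lookup (proj₁ (up t)) (inject₁ i))
        scan (P , q ∷ qs) = scanF-rule P (head qs) i

    extend-P : ∀ (i : Fin (suc n)) → extend s (+ toℕ i) 0ℤ ≡ lookup (proj₁ s) i
    extend-P i = trans (cong (λ x → extend s x 0ℤ) (sym (ℤₚ.+-identityʳ (+ toℕ i)))) (extend-row i 0ℤ 0ℤ)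

    extend-Q : ∀ (i : Fin (suc n)) → extend s 0ℤ (+ toℕ i) ≡ lookup (proj₂ s) i
    extend-Q i = trans (extend-row zero 0ℤ (+ toℕ i)) (trans (cong (λ z → lookup (row z) zero) (ℤₚ.+-comm (+ toℕ i) 0ℤ)) (climb (toℕ i) i refl 0ℤ))

  module _ (g : ℤ → ℤ → X)
    (periodic : ∀ k x y → g (x + k * + n) (y - k * + n) ≡ g x y)
    (rule : ∀ x y → g (ℤ.suc x) (ℤ.suc y) ≡ F (g x y) (g (ℤ.suc x) y) (g x (ℤ.suc y)))
    where

    private
      frame : ℤ → State
      frame y = tabulate (λ i → g (+ toℕ i) y) , tabulate (λ i → g 0ℤ (+ toℕ i + y))

      scan : ∀ k x y → scanF (tabulate {n = suc k} (λ i → g (+ toℕ i + x) y)) (g x (ℤ.suc y)) ≡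
        tabulate {n = suc k} (λ i → g (+ toℕ i + x) (ℤ.suc y))
      scan zero x y = cong (_∷ []) (cong (λ z → g z (ℤ.suc y)) (sym (ℤₚ.+-identityˡ x)))
      scan (suc k) x y = cong₂ _∷_ (cong (λ z → g z (ℤ.suc y)) (sym (ℤₚ.+-identityˡ x)))
        (trans (cong₂ scanF (Vecₚ.tabulate-cong (λ i → cong (λ z → g z y) (h (+ toℕ i) x)))
                  (trans (cong (λ z → F (g z y) (g (ℤ.suc x) y) (g x (ℤ.suc y))) (ℤₚ.+-identityˡ x)) (sym (rule x y))))
        (trans (scan k (ℤ.suc x) y)
          (Vecₚ.tabulate-cong (λ i → cong (λ z → g z (ℤ.suc y)) (sym (h (+ toℕ i) x))))))
        where h : ∀ i x → 1ℤ + i + x ≡ i + (1ℤ + x)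
              h = solve-∀

      scan₀ : ∀ k y → scanF (tabulate {n = suc k} (λ i → g (+ toℕ i) y)) (g 0ℤ (ℤ.suc y)) ≡
        tabulate {n = suc k} (λ i → g (+ toℕ i) (ℤ.suc y))
      scan₀ k y = trans (cong (λ v → scanF v (g 0ℤ (ℤ.suc y))) (Vecₚ.tabulate-cong (λ i → cong (λ z → g z y) (sym (ℤₚ.+-identityʳ (+ toℕ i))))))
        (trans (scan k 0ℤ y) (Vecₚ.tabulate-cong (λ i → cong (λ z → g z (ℤ.suc y)) (ℤₚ.+-identityʳ (+ toℕ i)))))

      turn : ∀ y → g (+ n) y ≡ g 0ℤ (+ n + y)
      turn y = trans (cong₂ g (h₁ (+ n)) (h₂ (+ n) y)) (periodic 1ℤ 0ℤ (+ n + y))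
        where h₁ : ∀ n → n ≡ 0ℤ + 1ℤ * n
              h₁ = solve-∀
              h₂ : ∀ n y → y ≡ n + y - 1ℤ * n
              h₂ = solve-∀

      frame-up : ∀ y → up (frame y) ≡ frame (ℤ.suc y)
      frame-up y = cong₂ _,_ rows
        (trans (cong₂ _∷ʳ_ (Vecₚ.tabulate-cong (λ i → cong (g 0ℤ) (h (+ toℕ i) y)))
                  (trans (cong last rows) (trans (last-tabulate {n = n} (λ k → g (+ k) (ℤ.suc y))) (turn (ℤ.suc y)))))
               (tabulate-∷ʳ {n = n} (λ k → g 0ℤ (+ k + ℤ.suc y))))
        where
        h : ∀ i x → 1ℤ + i + x ≡ i + (1ℤ + x)
        h = solve-∀
        rows : proj₁ (up (frame y)) ≡ proj₁ (frame (ℤ.suc y))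
        rows = scan₀ n y

      frame-down : ∀ y → down (frame (ℤ.suc y)) ≡ frame y
      frame-down y = trans (cong down (sym (frame-up y))) (down-up (frame y) (cong (g 0ℤ) (sym (ℤₚ.+-identityˡ y)))
        (trans (last-tabulate {n = n} (λ k → g (+ k) y)) (trans (turn y) (sym (last-tabulate {n = n} (λ k → g 0ℤ (+ k + y)))))))

      frames : ∀ y → frame y ≡ iterate (frame 0ℤ) y
      frames (+ zero) = refl
      frames (+ suc k) = trans (sym (frame-up (+ k))) (cong up (frames (+ k)))
      frames -[1+ zero ] = sym (frame-down -[1+ 0 ])
      frames -[1+ suc k ] = trans (sym (frame-down -[1+ suc k ])) (cong down (frames -[1+ k ]))

    extend-unique : ∀ s → (∀ i → g (+ toℕ i) 0ℤ ≡ lookup (proj₁ s) i) → (∀ i → g 0ℤ (+ toℕ i) ≡ lookup (proj₂ s) i) →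
      ∀ x y → g x y ≡ extend s x y
    extend-unique s p q x y = trans (trans (cong (λ x → g x y) (split x)) (trans (cong (g _) (h₂ y (+ n) (x /ℕ n))) (periodic (x /ℕ n) (+ toℕ (residue x)) z)))
      (trans (sym (trans (Vecₚ.lookup∘tabulate (λ i → g (+ toℕ i) z) (inject₁ (residue x))) (cong (λ k → g (+ k) z) (Finₚ.toℕ-inject₁ (residue x)))))
      (cong (λ t → lookup (proj₁ t) (inject₁ (residue x))) (trans (frames z) (cong (λ t → iterate t z) start))))
      where
      z = y + (x /ℕ n) * + n
      h₂ : ∀ y n q → y ≡ y + q * n - q * n
      h₂ = solve-∀
      start : frame 0ℤ ≡ s
      start = cong₂ _,_ (trans (Vecₚ.tabulate-cong p) (Vecₚ.tabulate∘lookup (proj₁ s)))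
        (trans (Vecₚ.tabulate-cong (λ i → trans (cong (g 0ℤ) (ℤₚ.+-identityʳ (+ toℕ i))) (q i))) (Vecₚ.tabulate∘lookup (proj₂ s)))

private variable
  m n : ℕ

signature-≡ : {σ τ : Signature ℓ} → parts σ ≡ parts τ → σ ≡ τ
signature-≡ {σ = signature _ _} {signature _ _} refl = refl

_≟ₛ_ : DecidableEquality (Signature ℓ)
σ ≟ₛ τ = map′ signature-≡ (cong parts) (Vecₚ.≡-dec ℤₚ._≟_ (parts σ) (parts τ))

_⪯?_ : (σ τ : Signature ℓ) → Dec (σ ⪯ τ)
σ ⪯? τ = parts σ ≼? parts τ

decreasing : (σ : Signature ℓ) → Linked _≥_ (parts σ)
decreasing (signature v d) = recompute (linked? (flip ℤₚ._≤?_) v) d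

module _ {ρ ƛ : Signature ℓ} where

  linked : (P : SST ρ ƛ n) → Linked _⪯_ (chain P)
  linked (sst c l _ _) = recompute (linked? _⪯?_ c) l

  start : (P : SST ρ ƛ n) → Vec.head (chain P) ≡ ρ
  start (sst _ _ s _) = recompute (_ ≟ₛ _) s

  end : (P : SST ρ ƛ n) → Vec.last (chain P) ≡ ƛ
  end (sst _ _ _ e) = recompute (_ ≟ₛ _) e

  part : SST ρ ƛ n → Fin (suc n) → Fin ℓ → ℤ
  part P i j = lookup (parts (lookup (chain P) i)) j

  -- The number of labels k in row j; k : Fin n stands for the label toℕ k + 1.
  labelCount : SST ρ ƛ n → Fin ℓ → Fin n → ℕ
  labelCount P j k = ∣ part P (suc k) j - part P (inject₁ k) j ∣

  rowWord : SST ρ ƛ n → Fin ℓ → List (Fin ℓ × Fin n)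
  rowWord {n = n} P j = concatMap (λ k → replicate (labelCount P j k) (j , k)) (allFin n)

  -- Row 0 is the top row, so the rows are read in reverse order.  A letter remembers its row.
  readingWord : SST ρ ƛ n → List (Fin ℓ × Fin n)
  readingWord P = concatMap (rowWord P) (reverse (allFin ℓ))

data Paren : Set where
  ⟨ ⟩ : Paren

-- i : Fin m stands for the index toℕ i + 1 of a Kashiwara operator, hence inject₁ i for the label i
-- and suc i for the label i + 1.
paren : Fin m → Fin ℓ × Fin (suc m) → Maybe (Fin ℓ × Paren)
paren i (j , k) with k Finₚ.≟ inject₁ i | k Finₚ.≟ suc i
... | yes _ | _     = just (j , ⟩)
... | no _  | yes _ = just (j , ⟨)
... | no _  | no _  = nothing

-- Prefixing a letter to a reduced word )⋯)(⋯( and deleting the pair () this may create.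
cancel₁ : Fin ℓ × Paren → List (Fin ℓ × Paren) → List (Fin ℓ × Paren)
cancel₁ (_ , ⟨) ((_ , ⟩) ∷ w) = w
cancel₁ x       w             = x ∷ w

cancelAll : List (Fin ℓ × Paren) → List (Fin ℓ × Paren)
cancelAll = foldr cancel₁ []

openRow closeRow : Fin ℓ × Paren → Maybe (Fin ℓ)
openRow (j , ⟨)  = just j
openRow (_ , ⟩)  = nothing
closeRow (j , ⟩) = just j
closeRow (_ , ⟨) = nothing

module _ {ρ ƛ : Signature ℓ} (i : Fin m) (P : SST ρ ƛ (suc m)) where

  remaining : List (Fin ℓ × Paren)
  remaining = cancelAll (mapMaybe (paren i) (readingWord P))

  leftmostOpen : Maybe (Fin ℓ)
  leftmostOpen = List.head (mapMaybe openRow remaining)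

  rightmostClose : Maybe (Fin ℓ)
  rightmostClose = List.last (mapMaybe closeRow remaining)

module Words {ℓ : ℕ} (a b : Fin ℓ → ℕ) where

  Letter : Set
  Letter = Fin ℓ × Paren

  block : Fin ℓ → List Letter
  block j = replicate (a j) (j , ⟩) ++ replicate (b j) (j , ⟨)

  record GoodE (j : Fin ℓ) : Set where
    constructor goodE
    field
      some  : 0 ℕ.< b j
      above : ∀ j′ → toℕ j ≡ suc (toℕ j′) → a j′ ℕ.< b j

  record GoodF (j : Fin ℓ) : Set where
    constructor goodF
    field
      some  : 0 ℕ.< a j
      below : ∀ j′ → toℕ j′ ≡ suc (toℕ j) → b j′ ℕ.< a j

  push : List Letter → List Letter → List Letter
  push = foldr cancel₁

  push-close : ∀ r k j → push r (replicate k (j , ⟩)) ≡ replicate k (j , ⟩) ++ r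
  push-close r zero j = refl
  push-close r (suc k) j = cong ((j , ⟩) ∷_) (push-close r k j)

  push-same : ∀ r k x → push r (replicate (suc k) x) ≡ push (cancel₁ x r) (replicate k x)
  push-same r zero x = refl
  push-same r (suc k) x = cong (cancel₁ x) (push-same r k x)

  record Invariant (p : Fin ℓ) (r : List Letter) : Set where
    constructor inv
    field
      rest   : List Letter
      shape  : r ≡ replicate (a p) (p , ⟩) ++ rest
      opens  : ∀ j → (j , ⟨) ∈ rest → GoodE j
      closes : ∀ j → (j , ⟩) ∈ rest → GoodF j

  Final : List Letter → Set
  Final r = (∀ j → (j , ⟨) ∈ r → GoodE j) × (∀ j → (j , ⟩) ∈ r → GoodF j)

  Pushed : (p q : Fin ℓ) (A B : ℕ) (rest r : List Letter) → Set
  Pushed p q A B rest r =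
    (∀ j → (j , ⟨) ∈ r → (j , ⟨) ∈ rest ⊎ (j ≡ q × A ℕ.< B)) ×
    (∀ j → (j , ⟩) ∈ r → (j , ⟩) ∈ rest ⊎ (j ≡ p × B ℕ.< A))

  ∈-replicate : ∀ {x y} A {rest : List Letter} → x ∈ replicate A y ++ rest → (x ≡ y × 0 ℕ.< A) ⊎ x ∈ rest
  ∈-replicate zero x∈ = inj₂ x∈
  ∈-replicate (suc A) (here e) = inj₁ (e , s≤s z≤n)
  ∈-replicate (suc A) (there x∈) with ∈-replicate A x∈
  ... | inj₁ (e , _) = inj₁ (e , s≤s z≤n)
  ... | inj₂ y = inj₂ y

  cancel-⊆ : ∀ {x} q (w : List Letter) → x ∈ cancel₁ (q , ⟨) w → x ≡ (q , ⟨) ⊎ x ∈ w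
  cancel-⊆ q [] (here e) = inj₁ e
  cancel-⊆ q ((_ , ⟨) ∷ w) (here e) = inj₁ e
  cancel-⊆ q ((_ , ⟨) ∷ w) (there x∈) = inj₂ x∈
  cancel-⊆ q ((_ , ⟩) ∷ w) x∈ = inj₂ (there x∈)

  push-⊆ : ∀ {x} q B (w : List Letter) → x ∈ push w (replicate B (q , ⟨)) → (x ≡ (q , ⟨) × 0 ℕ.< B) ⊎ x ∈ w
  push-⊆ q zero w x∈ = inj₂ x∈
  push-⊆ q (suc B) w x∈ with cancel-⊆ q (push w (replicate B (q , ⟨))) x∈
  ... | inj₁ e = inj₁ (e , s≤s z≤n)
  ... | inj₂ y with push-⊆ q B w y
  ... | inj₁ (e , _) = inj₁ (e , s≤s z≤n)
  ... | inj₂ z = inj₂ z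

  pushed : ∀ p q A B rest → Pushed p q A B rest (push (replicate A (p , ⟩) ++ rest) (replicate B (q , ⟨)))
  pushed p q zero B rest = opens , closes
    where
    opens : ∀ j → (j , ⟨) ∈ push rest (replicate B (q , ⟨)) → _
    opens j x∈ with push-⊆ q B rest x∈
    ... | inj₁ (e , lt) = inj₂ (cong proj₁ e , lt)
    ... | inj₂ y = inj₁ y
    closes : ∀ j → (j , ⟩) ∈ push rest (replicate B (q , ⟨)) → _
    closes j x∈ with push-⊆ q B rest x∈
    ... | inj₁ (() , _)
    ... | inj₂ y = inj₁ y
  pushed p q (suc A) zero rest = opens , closes
    where
    opens : ∀ j → (j , ⟨) ∈ replicate (suc A) (p , ⟩) ++ rest → _
    opens j x∈ with ∈-replicate (suc A) x∈
    ... | inj₁ (() , _)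
    ... | inj₂ y = inj₁ y
    closes : ∀ j → (j , ⟩) ∈ replicate (suc A) (p , ⟩) ++ rest → _
    closes j x∈ with ∈-replicate (suc A) x∈
    ... | inj₁ (e , lt) = inj₂ (cong proj₁ e , lt)
    ... | inj₂ y = inj₁ y
  pushed p q (suc A) (suc B) rest
    rewrite push-same (replicate (suc A) (p , ⟩) ++ rest) B (q , ⟨) =
    (λ j x∈ → up (proj₁ ih j x∈)) , (λ j x∈ → up (proj₂ ih j x∈))
    where
    ih = pushed p q A B rest
    up : ∀ {X E : Set} {k l} → X ⊎ (E × k ℕ.< l) → X ⊎ (E × suc k ℕ.< suc l)
    up (inj₁ x) = inj₁ x
    up (inj₂ (e , p)) = inj₂ (e , s≤s p)

  push-block : ∀ r q → push r (block q) ≡ replicate (a q) (q , ⟩) ++ push r (replicate (b q) (q , ⟨))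
  push-block r q = trans (Listₚ.foldr-++ cancel₁ r (replicate (a q) (q , ⟩)) (replicate (b q) (q , ⟨))) (push-close _ (a q) q)

  first : ∀ q → toℕ q ≡ 0 → Invariant q (push [] (block q))
  first q e = inv _ (push-block [] q) opens closes
    where
    opens : ∀ j → (j , ⟨) ∈ push [] (replicate (b q) (q , ⟨)) → GoodE j
    opens j x∈ with proj₁ (pushed q q 0 (b q) []) j x∈
    ... | inj₁ ()
    ... | inj₂ (refl , lt) = goodE lt λ j′ e′ → contradiction (trans (sym e) e′) λ ()
    closes : ∀ j → (j , ⟩) ∈ push [] (replicate (b q) (q , ⟨)) → GoodF j
    closes j x∈ with proj₂ (pushed q q 0 (b q) []) j x∈
    ... | inj₁ ()
    ... | inj₂ (_ , ())

  next : ∀ p q r → toℕ q ≡ suc (toℕ p) → Invariant p r → Invariant q (push r (block q))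
  next p q r e (inv rest refl o c) = inv _ (push-block r q) opens closes
    where
    opens : ∀ j → (j , ⟨) ∈ push r (replicate (b q) (q , ⟨)) → GoodE j
    opens j x∈ with proj₁ (pushed p q (a p) (b q) rest) j x∈
    ... | inj₁ y = o j y
    ... | inj₂ (refl , lt) = goodE (ℕₚ.≤-<-trans z≤n lt) λ j′ e′ →
      subst (λ z → a z ℕ.< b q) (Finₚ.toℕ-injective (ℕₚ.suc-injective (trans (sym e) e′))) lt
    closes : ∀ j → (j , ⟩) ∈ push r (replicate (b q) (q , ⟨)) → GoodF j
    closes j x∈ with proj₂ (pushed p q (a p) (b q) rest) j x∈
    ... | inj₁ y = c j y
    ... | inj₂ (refl , lt) = goodF (ℕₚ.≤-<-trans z≤n lt) λ j′ e′ →
      subst (λ z → b z ℕ.< a p) (Finₚ.toℕ-injective (trans e (sym e′))) lt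

  finish : ∀ p r → suc (toℕ p) ≡ ℓ → Invariant p r → Final r
  finish p r e (inv rest refl o c) = opens , closes
    where
    opens : ∀ j → (j , ⟨) ∈ replicate (a p) (p , ⟩) ++ rest → GoodE j
    opens j x∈ with ∈-replicate (a p) x∈
    ... | inj₁ (() , _)
    ... | inj₂ y = o j y
    closes : ∀ j → (j , ⟩) ∈ replicate (a p) (p , ⟩) ++ rest → GoodF j
    closes j x∈ with ∈-replicate (a p) x∈
    ... | inj₁ (refl , lt) = goodF lt λ j′ e′ → contradiction (trans e′ e) (ℕₚ.<⇒≢ (Finₚ.toℕ<n j′))
    ... | inj₂ y = c j y

  walk : ∀ {N} (h : Fin N → Fin ℓ) p r → suc (toℕ p) ℕ.+ N ≡ ℓ →
    (∀ k → toℕ (h k) ≡ suc (toℕ p ℕ.+ toℕ k)) → Invariant p r →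
    Final (List.foldl (λ r j → push r (block j)) r (List.tabulate h))
  walk {zero} h p r e f i = finish p r (trans (sym (ℕₚ.+-identityʳ _)) e) i
  walk {suc N} h p r e f i = walk (h ∘ suc) (h zero) (push r (block (h zero)))
    (trans (cong (λ z → suc (z ℕ.+ N)) q≡) (trans (cong suc (sym (ℕₚ.+-suc (toℕ p) N))) e))
    (λ k → trans (f (suc k)) (cong suc (trans (ℕₚ.+-suc (toℕ p) (toℕ k)) (cong (ℕ._+ toℕ k) (sym q≡)))))
    (next p (h zero) r q≡ i)
    where
    q≡ : toℕ (h zero) ≡ suc (toℕ p)
    q≡ = trans (f zero) (cong suc (ℕₚ.+-identityʳ (toℕ p)))

  all-rows : ∀ {N} → N ≡ ℓ → (h : Fin N → Fin ℓ) → (∀ k → toℕ (h k) ≡ toℕ k) →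
    Final (List.foldl (λ r j → push r (block j)) [] (List.tabulate h))
  all-rows {zero} e h f = (λ _ ()) , (λ _ ())
  all-rows {suc N} e h f = walk (h ∘ suc) (h zero) _ (trans (cong (λ z → suc z ℕ.+ N) (f zero)) e)
    (λ k → trans (f (suc k)) (cong (λ z → suc (z ℕ.+ toℕ k)) (sym (f zero)))) (first (h zero) (f zero))

  push-concatMap : ∀ (xs : List (Fin ℓ)) → push [] (concatMap block xs) ≡ foldr (λ j r → push r (block j)) [] xs
  push-concatMap [] = refl
  push-concatMap (x ∷ xs) = trans (Listₚ.foldr-++ cancel₁ [] (block x) (concatMap block xs))
    (cong (λ r → push r (block x)) (push-concatMap xs))

  final : Final (cancelAll (concatMap block (reverse (allFin ℓ))))
  final = subst Final (sym (trans (push-concatMap (reverse (allFin ℓ)))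
    (Listₚ.reverse-foldr (λ j r → push r (block j)) [] (allFin ℓ)))) (all-rows refl id (λ _ → refl))

module _ {A B : Set} (f : A → Maybe B) where

  mapMaybe-concatMap : ∀ {C : Set} (g : C → List A) xs → mapMaybe f (concatMap g xs) ≡ concatMap (mapMaybe f ∘ g) xs
  mapMaybe-concatMap g [] = refl
  mapMaybe-concatMap g (x ∷ xs) = trans (Listₚ.mapMaybe-++ f (g x) (concatMap g xs)) (cong (mapMaybe f (g x) ++_) (mapMaybe-concatMap g xs))

  mapMaybe-replicate-just : ∀ {x y} k → f x ≡ just y → mapMaybe f (replicate k x) ≡ replicate k y
  mapMaybe-replicate-just zero e = refl
  mapMaybe-replicate-just {x} (suc k) e with f x | e | mapMaybe-replicate-just k e
  ... | _ | refl | ih = cong (_ ∷_) ih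

  mapMaybe-replicate-nothing : ∀ {x} k → f x ≡ nothing → mapMaybe f (replicate k x) ≡ []
  mapMaybe-replicate-nothing zero e = refl
  mapMaybe-replicate-nothing {x} (suc k) e with f x | e | mapMaybe-replicate-nothing k e
  ... | _ | refl | ih = ih

concatMap-none : ∀ {A : Set} {N k} (V : Fin N → List A) (h : Fin k → Fin N) → (∀ x → V (h x) ≡ []) → concatMap V (List.tabulate h) ≡ []
concatMap-none {k = zero} V h f = refl
concatMap-none {k = suc k} V h f = trans (cong (_++ concatMap V (List.tabulate (h ∘ suc))) (f zero)) (concatMap-none V (h ∘ suc) (f ∘ suc))

concatMap-two : ∀ {A : Set} {N} (V : Fin N → List A) {k} (h : Fin (suc k) → Fin N) (i : Fin k) →
  (∀ x → x ≢ inject₁ i → x ≢ suc i → V (h x) ≡ []) → concatMap V (List.tabulate h) ≡ V (h (inject₁ i)) ++ V (h (suc i))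
concatMap-two V {suc k} h zero f = cong (V (h zero) ++_)
  (trans (cong (V (h (suc zero)) ++_) (concatMap-none V (λ x → h (suc (suc x))) λ x → f (suc (suc x)) (λ ()) (λ ()))) (Listₚ.++-identityʳ _))
concatMap-two V {suc k} h (suc i) f = trans (cong (_++ concatMap V (List.tabulate (h ∘ suc))) (f zero (λ ()) (λ ())))
  (concatMap-two V (h ∘ suc) i λ x p q → f (suc x) (p ∘ Finₚ.suc-injective) (q ∘ Finₚ.suc-injective))

paren-close : ∀ (i : Fin m) (j : Fin ℓ) → paren i (j , inject₁ i) ≡ just (j , ⟩)
paren-close i j with inject₁ i Finₚ.≟ inject₁ i | inject₁ i Finₚ.≟ suc i
... | yes _ | _ = refl
... | no ¬p | _ = contradiction refl ¬p

inject₁≢suc : ∀ (i : Fin m) → suc i ≢ inject₁ i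
inject₁≢suc (suc i) e = inject₁≢suc i (Finₚ.suc-injective e)

paren-open : ∀ (i : Fin m) (j : Fin ℓ) → paren i (j , suc i) ≡ just (j , ⟨)
paren-open i j with suc i Finₚ.≟ inject₁ i | suc i Finₚ.≟ suc i
... | yes p | _ = contradiction p (inject₁≢suc i)
... | no _ | yes _ = refl
... | no _ | no ¬p = contradiction refl ¬p

paren-other : ∀ (i : Fin m) (j : Fin ℓ) k → k ≢ inject₁ i → k ≢ suc i → paren i (j , k) ≡ nothing
paren-other i j k p q with k Finₚ.≟ inject₁ i | k Finₚ.≟ suc i
... | yes e | _ = contradiction e p
... | no _ | yes e = contradiction e q
... | no _ | no _ = refl

module _ {ρ ƛ : Signature ℓ} (i : Fin m) (P : SST ρ ƛ (suc m)) where

  closers openers : Fin ℓ → ℕ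
  closers j = labelCount P j (inject₁ i)
  openers j = labelCount P j (suc i)

  open Words closers openers

  parens-final : Final (remaining i P)
  parens-final = subst (Final ∘ cancelAll) (sym (trans (mapMaybe-concatMap (paren i) (rowWord P) (reverse (allFin ℓ)))
      (Listₚ.concatMap-cong row (reverse (allFin ℓ))))) final
    where
    run : Fin ℓ → Fin (suc m) → List (Fin ℓ × Fin (suc m))
    run j k = replicate (labelCount P j k) (j , k)
    row : ∀ j → mapMaybe (paren i) (rowWord P j) ≡ block j
    row j = trans (mapMaybe-concatMap (paren i) (run j) (allFin (suc m)))
      (trans (concatMap-two (mapMaybe (paren i) ∘ run j) id i
                λ k p q → mapMaybe-replicate-nothing (paren i) (labelCount P j k) (paren-other i j k p q))
        (cong₂ _++_ (mapMaybe-replicate-just (paren i) (closers j) (paren-close i j))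
                    (mapMaybe-replicate-just (paren i) (openers j) (paren-open i j))))

  head-∈ : ∀ (w : List Letter) {j} → List.head (mapMaybe openRow w) ≡ just j → (j , ⟨) ∈ w
  head-∈ ((j , ⟨) ∷ w) refl = here refl
  head-∈ ((j , ⟩) ∷ w) e = there (head-∈ w e)

  last-∈′ : ∀ {j} (xs : List (Fin ℓ)) → List.last xs ≡ just j → j ∈ xs
  last-∈′ (x ∷ []) refl = here refl
  last-∈′ (x ∷ y ∷ xs) e = there (last-∈′ (y ∷ xs) e)

  close-∈ : ∀ (w : List Letter) {j} → j ∈ mapMaybe closeRow w → (j , ⟩) ∈ w
  close-∈ ((j , ⟩) ∷ w) (here refl) = here refl
  close-∈ ((j , ⟩) ∷ w) (there x) = there (close-∈ w x)
  close-∈ ((j , ⟨) ∷ w) x = there (close-∈ w x)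

  good-open : ∀ {j} → leftmostOpen i P ≡ just j → GoodE j
  good-open e = proj₁ parens-final _ (head-∈ (remaining i P) e)

  good-close : ∀ {j} → rightmostClose i P ≡ just j → GoodF j
  good-close e = proj₂ parens-final _ (close-∈ (remaining i P) (last-∈′ _ e))

≼-lookup : ∀ {κ μ : Vec ℤ ℓ} → κ ≼ μ → ∀ j → lookup κ j ≤ lookup μ j
≼-lookup [ p ] zero = p
≼-lookup (p ⨾ _ ⨾ r) zero = p
≼-lookup (_ ⨾ _ ⨾ r) (suc j) = ≼-lookup r j

≼-lookup-suc : ∀ {κ μ : Vec ℤ ℓ} → κ ≼ μ → ∀ j j′ → toℕ j ≡ suc (toℕ j′) → lookup μ j ≤ lookup κ j′
≼-lookup-suc (_ ⨾ q ⨾ r) (suc zero) zero refl = q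
≼-lookup-suc (_ ⨾ _ ⨾ r) (suc (suc j)) (suc j′) e = ≼-lookup-suc r (suc j) j′ (ℕₚ.suc-injective e)

≼-pointwise : ∀ {κ μ : Vec ℤ ℓ} → (∀ j → lookup κ j ≤ lookup μ j) →
  (∀ j j′ → toℕ j ≡ suc (toℕ j′) → lookup μ j ≤ lookup κ j′) → κ ≼ μ
≼-pointwise {κ = []} {[]} f g = []
≼-pointwise {κ = _ ∷ []} {_ ∷ []} f g = [ f zero ]
≼-pointwise {κ = _ ∷ _ ∷ _} {_ ∷ _ ∷ _} f g = f zero ⨾ g (suc zero) zero refl ⨾
  ≼-pointwise (f ∘ suc) (λ j j′ e → g (suc j) (suc j′) (cong suc e))

module _ (h : ℤ → ℤ) where

  update-≤ : ∀ {μ : Vec ℤ ℓ} j k {x} → lookup μ k ≤ x → (k ≡ j → h (lookup μ j) ≤ x) → lookup (updateAt μ j h) k ≤ x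
  update-≤ {μ = μ} j k p q with k Finₚ.≟ j
  ... | yes refl = subst (_≤ _) (sym (Vecₚ.lookup∘updateAt j μ)) (q refl)
  ... | no k≢j = subst (_≤ _) (sym (Vecₚ.lookup∘updateAt′ k j k≢j μ)) p

  update-≥ : ∀ {μ : Vec ℤ ℓ} j k {x} → x ≤ lookup μ k → (k ≡ j → x ≤ h (lookup μ j)) → x ≤ lookup (updateAt μ j h) k
  update-≥ {μ = μ} j k p q with k Finₚ.≟ j
  ... | yes refl = subst (_ ≤_) (sym (Vecₚ.lookup∘updateAt j μ)) (q refl)
  ... | no k≢j = subst (_ ≤_) (sym (Vecₚ.lookup∘updateAt′ k j k≢j μ)) p

module _ {κ μ ν : Vec ℤ ℓ} (p : κ ≼ μ) (q : μ ≼ ν) (j : Fin ℓ) where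

  private
    up-abs : ∀ {x y} → x ≤ y → + ∣ y - x ∣ ≡ y - x
    up-abs = ℤₚ.0≤i⇒+∣i∣≡i ∘ ℤₚ.i≤j⇒0≤j-i

    pk pm pn : Fin ℓ → ℤ
    pk = lookup κ
    pm = lookup μ
    pn = lookup ν

    raise≤ : 0 ℕ.< ∣ pn j - pm j ∣ → ℤ.suc (pm j) ≤ pn j
    raise≤ lt = lin (subst (1ℤ ≤_) (up-abs (≼-lookup q j)) (+≤+ lt)) (h (pn j) (pm j))
      where h : ∀ n m → n - (1ℤ + m) ≡ n - m - 1ℤ
            h = solve-∀

    lower≥ : 0 ℕ.< ∣ pm j - pk j ∣ → pk j ≤ ℤ.pred (pm j)
    lower≥ lt = lin (subst (1ℤ ≤_) (up-abs (≼-lookup p j)) (+≤+ lt)) (h (pm j) (pk j))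
      where h : ∀ n m → ℤ.-1ℤ + n - m ≡ n - m - 1ℤ
            h = solve-∀

    abs-lin : ∀ {x y u v} → x ≤ y → u ≤ v → ∣ y - x ∣ ℕ.< ∣ v - u ∣ → 1ℤ + (y - x) ≤ v - u
    abs-lin p q lt = subst₂ (λ s t → 1ℤ + s ≤ t) (up-abs p) (up-abs q) (+≤+ lt)

    raise-room : ∀ j′ → toℕ j ≡ suc (toℕ j′) → ∣ pm j′ - pk j′ ∣ ℕ.< ∣ pn j - pm j ∣ → ℤ.suc (pm j) ≤ pk j′
    raise-room j′ e lt = lin (ℤₚ.+-mono-≤ (abs-lin (≼-lookup p j′) (≼-lookup q j) lt) (≼-lookup-suc q j j′ e))
       (h (pn j) (pm j) (pm j′) (pk j′))
      where h : ∀ n m m′ k′ → k′ - (1ℤ + m) ≡ n - m + m′ - (1ℤ + (m′ - k′) + n)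
            h = solve-∀

    lower-room : ∀ j′ → toℕ j′ ≡ suc (toℕ j) → ∣ pn j′ - pm j′ ∣ ℕ.< ∣ pm j - pk j ∣ → pn j′ ≤ ℤ.pred (pm j)
    lower-room j′ e lt = lin (ℤₚ.+-mono-≤ (abs-lin (≼-lookup q j′) (≼-lookup p j) lt) (≼-lookup-suc p j′ j e))
       (h (pn j′) (pm j) (pm j′) (pk j))
      where h : ∀ n m m′ k → ℤ.-1ℤ + m - n ≡ m - k + k - (1ℤ + (n - m′) + m′)
            h = solve-∀

  raise-valid : Words.GoodE (λ j → ∣ pm j - pk j ∣) (λ j → ∣ pn j - pm j ∣) j →
    κ ≼ updateAt μ j ℤ.suc × updateAt μ j ℤ.suc ≼ ν
  raise-valid (Words.goodE some above) =
    ≼-pointwise (λ x → update-≥ ℤ.suc {μ = μ} j x (≼-lookup p x) λ { refl → ℤₚ.≤-trans (≼-lookup p j) (ℤₚ.i≤suc[i] (pm j)) })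
                (λ x x′ e → update-≤ ℤ.suc {μ = μ} j x (≼-lookup-suc p x x′ e) λ { refl → raise-room x′ e (above x′ e) }) ,
    ≼-pointwise (λ x → update-≤ ℤ.suc {μ = μ} j x (≼-lookup q x) λ { refl → raise≤ some })
                (λ x x′ e → update-≥ ℤ.suc {μ = μ} j x′ (≼-lookup-suc q x x′ e) λ { refl → ℤₚ.≤-trans (≼-lookup-suc q x j e) (ℤₚ.i≤suc[i] (pm j)) })

  lower-valid : Words.GoodF (λ j → ∣ pm j - pk j ∣) (λ j → ∣ pn j - pm j ∣) j →
    κ ≼ updateAt μ j ℤ.pred × updateAt μ j ℤ.pred ≼ ν
  lower-valid (Words.goodF some below) =
    ≼-pointwise (λ x → update-≥ ℤ.pred {μ = μ} j x (≼-lookup p x) λ { refl → lower≥ some })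
                (λ x x′ e → update-≤ ℤ.pred {μ = μ} j x (≼-lookup-suc p x x′ e) λ { refl → ℤₚ.≤-trans (ℤₚ.i≤j⇒pred[i]≤j ℤₚ.≤-refl) (≼-lookup-suc p j x′ e) }) ,
    ≼-pointwise (λ x → update-≤ ℤ.pred {μ = μ} j x (≼-lookup q x) λ { refl → ℤₚ.≤-trans (ℤₚ.i≤j⇒pred[i]≤j ℤₚ.≤-refl) (≼-lookup q j) })
                (λ x x′ e → update-≥ ℤ.pred {μ = μ} j x′ (≼-lookup-suc q x x′ e) λ { refl → lower-room x e (below x e) })

module _ {X : Set} where

  head-update : ∀ {n} (c : Vec X (2+ n)) (i : Fin n) v → Vec.head (c [ suc (inject₁ i) ]≔ v) ≡ Vec.head c
  head-update (_ ∷ _) i v = refl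

  last-update : ∀ {n} (c : Vec X (2+ n)) (i : Fin n) v → Vec.last (c [ suc (inject₁ i) ]≔ v) ≡ Vec.last c
  last-update (x ∷ y ∷ z ∷ c) zero v = refl
  last-update (x ∷ y ∷ z ∷ c) (suc i) v = last-update (y ∷ z ∷ c) i v

  linked-update : ∀ {R : X → X → Set} {n} (c : Vec X (2+ n)) (i : Fin n) v → Linked R c →
    R (lookup c (inject₁ (inject₁ i))) v → R v (lookup c (suc (suc i))) → Linked R (c [ suc (inject₁ i) ]≔ v)
  linked-update (x ∷ y ∷ z ∷ c) zero v (_ ∷ _ ∷ l) p q = p ∷ q ∷ l
  linked-update (x ∷ y ∷ z ∷ c) (suc i) v (l ∷ ls) p q = l ∷ linked-update (y ∷ z ∷ c) i v ls p q

module _ {ρ ƛ : Signature ℓ} (i : Fin m) (P : SST ρ ƛ (suc m)) where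

  private
    κ μ ν : Vec ℤ ℓ
    κ = parts (lookup (chain P) (inject₁ (inject₁ i)))
    μ = parts (lookup (chain P) (suc (inject₁ i)))
    ν = parts (lookup (chain P) (suc (suc i)))

    κ≼μ : κ ≼ μ
    κ≼μ = linked-lookup (linked P) (inject₁ i)

    μ≼ν : μ ≼ ν
    μ≼ν = linked-lookup (linked P) (suc i)

  replace : (v : Vec ℤ ℓ) → .(κ ≼ v × v ≼ ν) → SST ρ ƛ (suc m)
  replace v valid = sst
    (chain P [ suc (inject₁ i) ]≔ σ)
    (linked-update (chain P) i σ (linked P) (proj₁ valid) (proj₂ valid))
    (trans (head-update (chain P) i σ) (start P))
    (trans (last-update (chain P) i σ) (end P))
    where
    σ : Signature ℓ
    σ = signature v (≼-sortedʳ (proj₁ valid))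

  -- nothing is 𝟎.  Rows increase weakly, so the leftmost remaining ( is the first i + 1 of its row j, and
  -- turning it into i lengthens row j of λ⁽ⁱ⁾ by one box; dually the rightmost remaining ) is the last i
  -- of its row.  All other members of the chain are unchanged.
  e f : Maybe (SST ρ ƛ (suc m))
  e with leftmostOpen i P in eq
  ... | nothing = nothing
  ... | just j  = just (replace (updateAt μ j ℤ.suc) (raise-valid κ≼μ μ≼ν j (good-open i P eq)))
  f with rightmostClose i P in eq
  ... | nothing = nothing
  ... | just j  = just (replace (updateAt μ j ℤ.pred) (lower-valid κ≼μ μ≼ν j (good-close i P eq)))

growth : ∀ ℓ → Growth (Vec ℤ ℓ)
growth ℓ = record
  { _⊑_ = _≼_ ; F = insert ; B = remove
  ; BF = remove-insert ; FB = insert-remove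
  ; Fˡ = insert-≼μ ; Fʳ = insert-≼ƛ ; Bˡ = remove-≼μ ; Bʳ = remove-≼ƛ }

module _ {A B : Set} (f : A → B) where

  head-map : (v : Vec A (suc n)) → Vec.head (Vec.map f v) ≡ f (Vec.head v)
  head-map (_ ∷ _) = refl

  last-map : (v : Vec A (suc n)) → Vec.last (Vec.map f v) ≡ f (Vec.last v)
  last-map (_ ∷ []) = refl
  last-map (_ ∷ y ∷ v) = last-map (y ∷ v)

module _ {ρ ƛ : Signature ℓ} {m : ℕ} (P Q : SST ρ ƛ (suc m)) where

  private module Cyl = Cylinder (growth ℓ) m

  boundary : Cyl.State
  boundary = Vec.map parts (chain P) , Vec.map parts (chain Q)

  boundary-ok : Cyl.OK boundary
  boundary-ok = Cyl.ok
    (trans (head-map parts (chain P)) (trans (cong parts (trans (start P) (sym (start Q)))) (sym (head-map parts (chain Q)))))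
    (trans (last-map parts (chain P)) (trans (cong parts (trans (end P) (sym (end Q)))) (sym (last-map parts (chain Q)))))
    (Linkedₚ.map⁺ (linked P)) (Linkedₚ.map⁺ (linked Q))

-- The unique Fomin field with λ⁽ⁱ⁾ at (i , 0) and μ⁽ⁱ⁾ at (0 , i): see Λ-row, Λ-column, Λ-unique.
Λ[_,_] : {ρ ƛ : Signature ℓ} .{{_ : NonZero n}} → SST ρ ƛ n → SST ρ ƛ n → FominField n ℓ
Λ[_,_] {ℓ = ℓ} {n = suc m} P Q = record
  { at       = λ x y → signature (Cyl.extend s x y) (≼-sortedˡ (Cyl.extend-right o x y))
  ; periodic = λ k x y → signature-≡ (Cyl.extend-periodic o k x y)
  ; right    = Cyl.extend-right o
  ; up       = Cyl.extend-up o
  ; rule     = λ x y → subst (LocalRule _ _ _) (sym (Cyl.extend-rule o x y))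
                             (insert-rule (Cyl.extend-right o x y) (Cyl.extend-up o x y))
  }
  where
  module Cyl = Cylinder (growth ℓ) m
  s = boundary P Q
  o = boundary-ok P Q

module _ {ρ ƛ : Signature ℓ} where

  Λ-row : .{{_ : NonZero n}} (P Q : SST ρ ƛ n) → ∀ i → at Λ[ P , Q ] (+ toℕ i) 0ℤ ≡ lookup (chain P) i
  Λ-row {n = suc m} P Q i = signature-≡ (trans (Cylinder.extend-P (growth ℓ) m (boundary-ok P Q) i) (Vecₚ.lookup-map i parts (chain P)))

  Λ-column : .{{_ : NonZero n}} (P Q : SST ρ ƛ n) → ∀ i → at Λ[ P , Q ] 0ℤ (+ toℕ i) ≡ lookup (chain Q) i
  Λ-column {n = suc m} P Q i = signature-≡ (trans (Cylinder.extend-Q (growth ℓ) m (boundary-ok P Q) i) (Vecₚ.lookup-map i parts (chain Q)))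

  Λ-unique : .{{_ : NonZero n}} (P Q : SST ρ ƛ n) (Φ : FominField n ℓ) →
    (∀ i → at Φ (+ toℕ i) 0ℤ ≡ lookup (chain P) i) →
    (∀ i → at Φ 0ℤ (+ toℕ i) ≡ lookup (chain Q) i) →
    ∀ x y → at Φ x y ≡ at Λ[ P , Q ] x y
  Λ-unique {n = suc m} P Q Φ p q x y = signature-≡ (Cylinder.extend-unique (growth ℓ) m (λ x y → parts (at Φ x y))
      (λ k x y → cong parts (Φ.periodic k x y))
      (λ x y → rule-unique (Φ.rule x y) (insert-rule (Φ.right x y) (Φ.up x y))
                 (decreasing (at Φ (ℤ.suc x) (ℤ.suc y))) (≼-sortedʳ (insert-≼μ (Φ.right x y) (Φ.up x y))))
      (boundary P Q)
      (λ i → trans (cong parts (p i)) (sym (Vecₚ.lookup-map i parts (chain P))))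
      (λ i → trans (cong parts (q i)) (sym (Vecₚ.lookup-map i parts (chain Q)))) x y)
    where module Φ = FominField Φ

shift : FominField n ℓ → ℤ → ℤ → FominField n ℓ
shift {n = n} Φ x y = record
  { at       = λ u v → at Φ (x + u) (y + v)
  ; periodic = λ k u v → trans (cong₂ (at Φ) (sym (ℤₚ.+-assoc x u (k * + n))) (sym (ℤₚ.+-assoc y v (- (k * + n)))))
                               (Φ.periodic k (x + u) (y + v))
  ; right    = λ u v → subst (λ z → at Φ (x + u) (y + v) ⪯ at Φ z (y + v)) (h x u) (Φ.right (x + u) (y + v))
  ; up       = λ u v → subst (λ z → at Φ (x + u) (y + v) ⪯ at Φ (x + u) z) (h y v) (Φ.up (x + u) (y + v))
  ; rule     = λ u v → subst₂ (λ z w → LocalRule (parts (at Φ (x + u) (y + v))) (parts (at Φ z (y + v)))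
                                                 (parts (at Φ (x + u) w)) (parts (at Φ z w)))
                              (h x u) (h y v) (Φ.rule (x + u) (y + v))
  }
  where
  module Φ = FominField Φ
  h : ∀ x u → 1ℤ + (x + u) ≡ x + (1ℤ + u)
  h = solve-∀

Λ⟨_⟩ : .{{_ : NonZero n}} (T : Pairs n) → FominField n (Pairs.length T)
Λ⟨ T ⟩ = Λ[ P T , Q T ]

-- ((Φ(x + i , y))ᵢ , (Φ(x , y + i))ᵢ), 0 ≤ i ≤ n.
pairAt : FominField n ℓ → ℤ → ℤ → Pairs n
pairAt {n = n} Φ x y = pair {ρ = at Φ x y} {ƛ = at Φ (x + + n) y}
  (sst (tabulate λ i → at Φ (x + + toℕ i) y)
       (linked-tabulate (λ k → at Φ (x + + k) y)
          (λ k → subst (λ z → at Φ (x + + k) y ⪯ at Φ z y) (h x (+ k)) (Φ.right (x + + k) y)))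
       (cong (λ z → at Φ z y) (ℤₚ.+-identityʳ x))
       (last-tabulate {n = n} (λ k → at Φ (x + + k) y)))
  (sst (tabulate λ i → at Φ x (y + + toℕ i))
       (linked-tabulate (λ k → at Φ x (y + + k))
          (λ k → subst (λ z → at Φ x (y + + k) ⪯ at Φ x z) (h y (+ k)) (Φ.up x (y + + k))))
       (cong (at Φ x) (ℤₚ.+-identityʳ y))
       (trans (last-tabulate {n = n} (λ k → at Φ x (y + + k)))
         (trans (sym (Φ.periodic 1ℤ x (y + + n))) (cong₂ (at Φ) (h₁ x (+ n)) (h₂ y (+ n))))))
  where
  module Φ = FominField Φ
  h : ∀ x u → 1ℤ + (x + u) ≡ x + (1ℤ + u)
  h = solve-∀
  h₁ : ∀ x n → x + 1ℤ * n ≡ x + n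
  h₁ = solve-∀
  h₂ : ∀ y n → y + n - 1ℤ * n ≡ y
  h₂ = solve-∀

pair-≡ : {ρ ƛ ρ′ ƛ′ : Signature ℓ} {P Q : SST ρ ƛ n} {P′ Q′ : SST ρ′ ƛ′ n} →
  chain P ≡ chain P′ → chain Q ≡ chain Q′ → pair P Q ≡ pair P′ Q′
pair-≡ {P = P@(sst _ _ _ _)} {sst _ _ _ _} {P′@(sst _ _ _ _)} {sst _ _ _ _} refl refl
  with trans (sym (start P)) (start P′) | trans (sym (end P)) (end P′)
... | refl | refl = refl

module _ .{{_ : NonZero n}} (T : Pairs n) where

  Λ-pairAt : ∀ x y u v → at Λ⟨ pairAt Λ⟨ T ⟩ x y ⟩ u v ≡ at Λ⟨ T ⟩ (x + u) (y + v)
  Λ-pairAt x y u v = sym (Λ-unique (P T′) (Q T′) (shift Λ⟨ T ⟩ x y)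
      (λ i → trans (cong (at Λ⟨ T ⟩ (x + + toℕ i)) (ℤₚ.+-identityʳ y)) (sym (Vecₚ.lookup∘tabulate (λ i → at Λ⟨ T ⟩ (x + + toℕ i) y) i)))
      (λ i → trans (cong (λ z → at Λ⟨ T ⟩ z (y + + toℕ i)) (ℤₚ.+-identityʳ x)) (sym (Vecₚ.lookup∘tabulate (λ i → at Λ⟨ T ⟩ x (y + + toℕ i)) i)))
      u v)
    where T′ = pairAt Λ⟨ T ⟩ x y

  pairAt-back : ∀ x y u v → x + u ≡ 0ℤ → y + v ≡ 0ℤ → pairAt Λ⟨ pairAt Λ⟨ T ⟩ x y ⟩ u v ≡ T
  pairAt-back x y u v p q = pair-≡
    (trans (Vecₚ.tabulate-cong λ i → trans (Λ-pairAt x y (u + + toℕ i) v)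
              (trans (cong₂ (at Λ⟨ T ⟩) (cancelled x u (+ toℕ i) p) q) (Λ-row (P T) (Q T) i)))
           (Vecₚ.tabulate∘lookup (chain (P T))))
    (trans (Vecₚ.tabulate-cong λ i → trans (Λ-pairAt x y u (v + + toℕ i))
              (trans (cong₂ (at Λ⟨ T ⟩) p (cancelled y v (+ toℕ i) q)) (Λ-column (P T) (Q T) i)))
           (Vecₚ.tabulate∘lookup (chain (Q T))))
    where
    cancelled : ∀ x u i → x + u ≡ 0ℤ → x + (u + i) ≡ i
    cancelled x u i e = trans (sym (ℤₚ.+-assoc x u i)) (trans (cong (_+ i) e) (ℤₚ.+-identityˡ i))

-- (P , Q) ↦ the pair read off λ[P , Q] at (x , y).
move : .{{_ : NonZero n}} → ℤ → ℤ → Pairs n ↔ Pairs n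
move x y = mk↔ₛ′
  (λ T → pairAt Λ⟨ T ⟩ x y)
  (λ T → pairAt Λ⟨ T ⟩ (- x) (- y))
  (λ T → pairAt-back T (- x) (- y) x y (ℤₚ.+-inverseˡ x) (ℤₚ.+-inverseˡ y))
  (λ T → pairAt-back T x y (- x) (- y) (ℤₚ.+-inverseʳ x) (ℤₚ.+-inverseʳ y))

data Component : Set where
  first second : Component

-- ι first = ι₁, ι second = ι₂.
ι : .{{_ : NonZero n}} → Component → Pairs n ↔ Pairs n
ι first  = move 1ℤ 0ℤ
ι second = move 0ℤ 1ℤ

cRSK : .{{_ : NonZero n}} → Pairs n ↔ Pairs n
cRSK {n} = move (+ n) 0ℤ

on : Component → (∀ {ℓ} {ρ ƛ : Signature ℓ} → SST ρ ƛ n → Maybe (SST ρ ƛ n)) → Pairs n → Maybe (Pairs n)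
on first  g (pair P Q) = Maybe.map (λ P′ → pair P′ Q) (g P)
on second g (pair P Q) = Maybe.map (λ Q′ → pair P Q′) (g Q)

-- ι ∘ g ∘ ι⁻¹, with ι(𝟎) = 𝟎.
viaι : .{{_ : NonZero n}} → Component → (Pairs n → Maybe (Pairs n)) → Pairs n → Maybe (Pairs n)
viaι k g T = Maybe.map (Inverse.to (ι k)) (g (Inverse.from (ι k) T))

-- E k i and F k i are E⁽ᵏ⁾ᵢ and F⁽ᵏ⁾ᵢ, 0 ≤ i ≤ n - 1.
data Generator (n : ℕ) : Set where
  E F : Component → Fin n → Generator n

-- The period is 2+ m because E₀ and F₀ need the operators e₁ and f₁ (here e zero and f zero).
⟦_⟧ : Generator (2+ m) → Pairs (2+ m) → Maybe (Pairs (2+ m))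
⟦ E k (suc i) ⟧ = on k (e i)
⟦ F k (suc i) ⟧ = on k (f i)
⟦ E k zero ⟧    = viaι k (on k (e zero))
⟦ F k zero ⟧    = viaι k (on k (f zero))

{-# OPTIONS --safe #-}
module Submission where

-- Write p ≼ q ≼ r for the chain members next to the label of e, a_j = q_j - p_j and b_j = r_j - q_j for the
-- numbers of ) and ( in row j (row 1 is on top), and h_j = Σ_{k ≤ j} b_k - Σ_{k < j} a_k.  The operator e adds a
-- box to q in the topmost row where h is maximal, provided that the maximum is positive, and f removes one in the
-- bottommost such row.  Insert a strip p ≼ u from the left: v = F̄(p, q, u), w = F̄(q, r, v), and let C_j, C′_j
-- be the carries of the two insertions into row j.  Then the function h′ of u ≼ v ≼ w satisfies
-- h′_j = h_j + C′_j - C_{j-1}, while K_j = h_j + C′_j obeys K_{j-1} = max(h_{j-1}, K_j - (p_{j-1} - v_j)), and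
-- C_{j-1} = 0 if v_j < p_{j-1}.  Hence h and h′ have the same maximum.  If e acts on q in row j, going up from
-- row j the extra box is handed on by the carries as long as K is maximal and stays in the last such row, which is
-- the topmost row where h′ is maximal.  So e on the first tableau commutes with ι₂ and leaves the second tableau of
-- its value alone.  As f inverts e, the same holds for f, and by transposing the field for ι₁ and the second
-- tableau.  By periodicity cRSK = ι₁ⁿ = ι₂ⁿ, and it commutes with ι₁ and ι₂.

open import Axiom.UniquenessOfIdentityProofs.WithK using (uip)
open import Data.Fin.Base using (Fin; zero; suc; inject₁; fromℕ; toℕ)
import Data.Fin.Properties as Finₚ
open import Data.Fin.Relation.Unary.Top using (view; ‵fromℕ; ‵inject₁)
open import Data.Integer.Base as ℤ using (ℤ; 0ℤ; 1ℤ; +≤+; _+_; _-_; -_; _*_; _⊔_; _⊓_; _≤_)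
import Data.Integer.Properties as ℤₚ
open import Data.Integer.Tactic.RingSolver using (solve-∀)
open import Data.List.Base as List using (List; []; _∷_; _++_; replicate; drop; foldl; reverse; allFin)
import Data.List.Properties as Listₚ
open import Data.Maybe.Base using (Maybe; just; nothing; map)
import Data.Maybe.Properties as Maybeₚ
open import Data.Nat.Base as ℕ using (ℕ; zero; suc; 2+; _∸_; z≤n; s≤s; NonZero)
import Data.Nat.Properties as ℕₚ
open import Data.Product.Base using (∃-syntax; _×_; _,_; proj₁; proj₂)
open import Data.Sum.Base using (_⊎_; inj₁; inj₂)
open import Data.Vec.Base as Vec using (Vec; []; _∷_; lookup; updateAt; _[_]≔_)
import Data.Vec.Properties as Vecₚ
open import Function.Base using (_∘_; id)
open import Function.Bundles using (_↔_; Inverse)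
open import Relation.Binary.PropositionalEquality
  using (_≡_; refl; sym; trans; cong; cong₂; subst; subst₂)
open import Relation.Nullary.Decidable using (yes; no)
open import Relation.Nullary.Negation using (contradiction)
open import Defs

open Inverse using (to; from; strictlyInverseˡ; strictlyInverseʳ)

private variable
  ℓ m n : ℕ
  M U V : ℤ

-- Peaks of the height function h

-- M bounds h on some rows, the first of which is (p , q , r); the result is the corresponding bound for the
-- rows below it, where h is counted from the row below.
descend : ℤ → ℤ → ℤ → ℤ → ℤ
descend M p q r = M - (r - q) + (q - p)

-- max h ≤ M.  The condition 0 ≤ M on no rows says that all of Σ (b - a) is at most the initial M; it follows
-- from the bounds above it unless M has been lowered, as it is in BottomPeak.
data Bounded : ℤ → (p q r : Vec ℤ ℓ) → Set where
  []  : 0ℤ ≤ M → Bounded M [] [] []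
  _∷_ : ∀ {p₁ q₁ r₁} {p q r : Vec ℤ ℓ} → r₁ - q₁ ≤ M → Bounded (descend M p₁ q₁ r₁) p q r →
        Bounded M (p₁ ∷ p) (q₁ ∷ q) (r₁ ∷ r)

-- max h = M, attained in the given row and not above it.
data TopPeak : ℤ → Fin ℓ → (p q r : Vec ℤ ℓ) → Set where
  here  : ∀ {p₁ q₁ r₁} {p q r : Vec ℤ ℓ} → r₁ - q₁ ≡ M → Bounded (descend M p₁ q₁ r₁) p q r →
          TopPeak M zero (p₁ ∷ p) (q₁ ∷ q) (r₁ ∷ r)
  there : ∀ {p₁ q₁ r₁ j} {p q r : Vec ℤ ℓ} → r₁ - q₁ ≤ M - 1ℤ → TopPeak (descend M p₁ q₁ r₁) j p q r →
          TopPeak M (suc j) (p₁ ∷ p) (q₁ ∷ q) (r₁ ∷ r)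

-- max h = M, attained in the given row and not below it; moreover Σ (b - a) < M, that is, there is a ) to change.
data BottomPeak : ℤ → Fin ℓ → (p q r : Vec ℤ ℓ) → Set where
  here  : ∀ {p₁ q₁ r₁} {p q r : Vec ℤ ℓ} → r₁ - q₁ ≡ M → Bounded (descend M p₁ q₁ r₁ - 1ℤ) p q r →
          BottomPeak M zero (p₁ ∷ p) (q₁ ∷ q) (r₁ ∷ r)
  there : ∀ {p₁ q₁ r₁ j} {p q r : Vec ℤ ℓ} → r₁ - q₁ ≤ M → BottomPeak (descend M p₁ q₁ r₁) j p q r →
          BottomPeak M (suc j) (p₁ ∷ p) (q₁ ∷ q) (r₁ ∷ r)

TopPeak⇒Bounded : ∀ {j} {p q r : Vec ℤ ℓ} → TopPeak M j p q r → Bounded M p q r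
TopPeak⇒Bounded (here e b)   = ℤₚ.≤-reflexive e ∷ b
TopPeak⇒Bounded {M = M} (there l t) = ℤₚ.≤-trans l (Int.pred≤ M) ∷ TopPeak⇒Bounded t

-- A box added to q in row j leaves h unchanged above row j, lowers it by 1 in row j and by 2 below.
-- So the maximum drops to M - 1, and row j becomes the last row to attain it. `BottomPeak-lower` is
-- the reverse change.
TopPeak-raise : ∀ {j} {p q r : Vec ℤ ℓ} → TopPeak M j p q r → BottomPeak (M - 1ℤ) j p (updateAt q j ℤ.suc) r
TopPeak-raise {p = p₁ ∷ _} {q₁ ∷ _} {r₁ ∷ _} (here refl b) = here (h r₁ q₁) (subst (λ N → Bounded N _ _ _) (h′ r₁ q₁ p₁) b)
  where h : ∀ r q → r - (1ℤ + q) ≡ r - q - 1ℤ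
        h = solve-∀
        h′ : ∀ r q p → r - q - (r - q) + (q - p) ≡ r - q - 1ℤ - (r - (1ℤ + q)) + (1ℤ + q - p) - 1ℤ
        h′ = solve-∀
TopPeak-raise {M = M} {p = p₁ ∷ _} {q₁ ∷ _} {r₁ ∷ _} (there l t) =
  there l (subst (λ N → BottomPeak N _ _ _ _) (h M r₁ q₁ p₁) (TopPeak-raise t))
  where h : ∀ M r q p → M - (r - q) + (q - p) - 1ℤ ≡ M - 1ℤ - (r - q) + (q - p)
        h = solve-∀

BottomPeak-lower : ∀ {j} {p q r : Vec ℤ ℓ} → BottomPeak M j p q r → TopPeak (M + 1ℤ) j p (updateAt q j ℤ.pred) r
BottomPeak-lower {p = p₁ ∷ _} {q₁ ∷ _} {r₁ ∷ _} (here refl b) = here (h r₁ q₁) (subst (λ N → Bounded N _ _ _) (h′ r₁ q₁ p₁) b)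
  where h : ∀ r q → r - (ℤ.-1ℤ + q) ≡ r - q + 1ℤ
        h = solve-∀
        h′ : ∀ r q p → r - q - (r - q) + (q - p) - 1ℤ ≡ r - q + 1ℤ - (r - (ℤ.-1ℤ + q)) + (ℤ.-1ℤ + q - p)
        h′ = solve-∀
BottomPeak-lower {M = M} {p = p₁ ∷ _} {q₁ ∷ _} {r₁ ∷ _} (there l t) =
  there (Int.lin l (h₀ M (r₁ - q₁))) (subst (λ N → TopPeak N _ _ _ _) (h M r₁ q₁ p₁) (BottomPeak-lower t))
  where h₀ : ∀ M d → M + 1ℤ - 1ℤ - d ≡ M - d
        h₀ = solve-∀
        h : ∀ M r q p → M - (r - q) + (q - p) + 1ℤ ≡ M + 1ℤ - (r - q) + (q - p)
        h = solve-∀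

-- The carry rule

-- What the cap U cuts off a row is exactly the carry out of it. This makes the rows of v and w
-- linear in the carries.
⊓-excess : ∀ U s → U ⊓ s ≡ s - (0ℤ ⊔ (s - U))
⊓-excess U s with ℤₚ.≤-total s U
... | inj₁ p = trans (ℤₚ.i≥j⇒i⊓j≡j p) (trans (sym (ℤₚ.+-identityʳ s))
                 (cong (λ z → s - z) (sym (ℤₚ.i≥j⇒i⊔j≡i (ℤₚ.i≤j⇒i-j≤0 p)))))
... | inj₂ p = trans (ℤₚ.i≤j⇒i⊓j≡i p) (trans (h s U) (cong (λ z → s - z) (sym (ℤₚ.i≤j⇒i⊔j≡j (ℤₚ.i≤j⇒0≤j-i p)))))
  where h : ∀ s U → U ≡ s - (s - U)
        h = solve-∀

+-⊔-lub : ∀ a {t} → a ≤ M → a + t ≤ M → a + (0ℤ ⊔ t) ≤ M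
+-⊔-lub {M = M} a {t} p q with ℤₚ.≤-total 0ℤ t
... | inj₁ r = subst (λ z → a + z ≤ M) (sym (ℤₚ.i≤j⇒i⊔j≡j r)) q
... | inj₂ r = subst (λ z → a + z ≤ M) (sym (ℤₚ.i≥j⇒i⊔j≡i r)) (subst (_≤ M) (sym (ℤₚ.+-identityʳ a)) p)

-- One row of v = F̄(p, q, u), w = F̄(q, r, v): U and V are the rows of p and q above it, c and c′ the carries into
-- it, C and C′ the carries out of it.
module Row (U V p q r u c c′ : ℤ) where

  s = q + u - p + c
  v = U ⊓ s
  C = 0ℤ ⊔ (s - U)
  t = r + v - q + c′
  w = V ⊓ t
  C′ = 0ℤ ⊔ (t - V)

  w-v : w - v ≡ r - q + c′ - C′
  w-v = trans (cong (_- v) (⊓-excess V t)) (h r v q c′ C′)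
    where h : ∀ r v q c C → r + v - q + c - C - v ≡ r - q + c - C
          h = solve-∀

  v-u : v - u ≡ q - p + c - C
  v-u = trans (cong (_- u) (⊓-excess U s)) (h q u p c C)
    where h : ∀ q u p c C → q + u - p + c - C - u ≡ q - p + c - C
          h = solve-∀

  -- The row-by-row form of the formula for h′: the bounds for p, q, r and for u, v, w differ by the
  -- current carries, before the row by C and C′, after it by c and c′.
  descend-insert : ∀ M → descend (M - C′ + C) u v w ≡ descend M p q r - c′ + c
  descend-insert M = trans (cong₂ (λ x y → M - C′ + C - x + y) w-v v-u) (h M C′ C r q c′ p c)
    where h : ∀ M C′ C r q c′ p c → M - C′ + C - (r - q + c′ - C′) + (q - p + c - C) ≡ M - (r - q) + (q - p) - c′ + c
          h = solve-∀

  w-v-bound : r - q + c′ ≤ M → w - v ≤ M - C′ + C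
  w-v-bound {M = M} p = subst (_≤ M - C′ + C) (sym w-v)
      (Int.lin (ℤₚ.+-mono-≤ p (ℤₚ.i≤i⊔j 0ℤ (s - U))) (h M C′ C (r - q + c′)))
    where h : ∀ M C′ C d → M - C′ + C - (d - C′) ≡ M + C - (d + 0ℤ)
          h = solve-∀

  -- The two cases of the maximum in C′ are the recursion for K: without a carry the value is V - U,
  -- otherwise it is r - q + c′ - (U - v), and v ≤ U.
  level : V - U ≤ M → r - q + c′ ≤ M → V - U + C′ ≤ M
  level {M = M} p e = +-⊔-lub (V - U) p (Int.lin (ℤₚ.+-mono-≤ e (ℤₚ.i⊓j≤i U s)) (h M V U r v q c′))
    where h : ∀ M V U r v q c → M - (V - U + (r + v - q + c - V)) ≡ M + U - (r - q + c + v)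
          h = solve-∀

-- Passing from K counted from the row below to K counted from this row adds b - a of this row on
-- both sides.
descend-level : ∀ M p q r {c} → q - p + c ≤ descend M p q r → r - q + c ≤ M
descend-level M p q r {c} l = Int.lin l (h M p q r c)
  where h : ∀ M p q r c → M - (r - q + c) ≡ M - (r - q) + (q - p) - (q - p + c)
        h = solve-∀

descend-gap : ∀ M p q r → r - q ≤ M → q - p ≤ descend M p q r
descend-gap M p q r l = Int.lin l (h M p q r)
  where h : ∀ M p q r → M - (r - q) + (q - p) - (q - p) ≡ M - (r - q)
        h = solve-∀

descend-pred : ∀ M p q r → descend (M - 1ℤ) p q r ≡ descend M p q r - 1ℤ
descend-pred = h
  where h : ∀ M p q r → M - 1ℤ - (r - q) + (q - p) ≡ M - (r - q) + (q - p) - 1ℤ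
        h = solve-∀

-- V - U + carry q r v V is K in the row above, up to Σ (b - a) over the rows above the given ones.
level-bound : ∀ U V (p q r u : Vec ℤ ℓ) → Bounded M p q r → V - U ≤ M → V - U + carry q r (fill U p q u) V ≤ M
level-bound {M = M} U V [] [] [] [] b g = subst (_≤ M) (sym (ℤₚ.+-identityʳ (V - U))) g
level-bound {M = M} U V (p₁ ∷ p) (q₁ ∷ q) (r₁ ∷ r) (u₁ ∷ u) (l ∷ b) g =
  Row.level U V p₁ q₁ r₁ u₁ (carry p q u p₁) _ g
    (descend-level M p₁ q₁ r₁ (level-bound p₁ q₁ p q r u b (descend-gap M p₁ q₁ r₁ l)))

-- In each row h′ is K minus a carry that is nonnegative, and `level-bound` bounds K. The carries
-- out of the top given row account for the change in the rows above.
insert-bounded : ∀ U V (p q r u : Vec ℤ ℓ) → Bounded M p q r → V - U ≤ M →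
  Bounded (M - carry q r (fill U p q u) V + carry p q u U) u (fill U p q u) (fill V q r (fill U p q u))
insert-bounded {M = M} U V [] [] [] [] ([] l) g = [] (subst (0ℤ ≤_) (h M) l)
  where h : ∀ M → M ≡ M - 0ℤ + 0ℤ
        h = solve-∀
insert-bounded {M = M} U V (p₁ ∷ p) (q₁ ∷ q) (r₁ ∷ r) (u₁ ∷ u) (l ∷ b) g =
  R.w-v-bound (descend-level M p₁ q₁ r₁ (level-bound p₁ q₁ p q r u b gap)) ∷
  subst (λ N → Bounded N _ _ _) (sym (R.descend-insert M)) (insert-bounded p₁ q₁ p q r u b gap)
  where
  gap = descend-gap M p₁ q₁ r₁ l
  module R = Row U V p₁ q₁ r₁ u₁ (carry p q u p₁) (carry q r (fill p₁ p q u) q₁)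

carry-zero⇒≤ : ∀ {x} κ₁ μ₁ ƛ₁ (κ μ ƛ : Vec ℤ ℓ) → carry (κ₁ ∷ κ) (μ₁ ∷ μ) (ƛ₁ ∷ ƛ) x ≡ 0ℤ → fullRow κ₁ μ₁ ƛ₁ κ μ ƛ ≤ x
carry-zero⇒≤ _ _ _ κ μ ƛ e = ℤₚ.i-j≤0⇒i≤j (ℤₚ.i⊔j≡i⇒j≤i e)

≤⇒carry-zero : ∀ {x} κ₁ μ₁ ƛ₁ (κ μ ƛ : Vec ℤ ℓ) → fullRow κ₁ μ₁ ƛ₁ κ μ ƛ ≤ x → carry (κ₁ ∷ κ) (μ₁ ∷ μ) (ƛ₁ ∷ ƛ) x ≡ 0ℤ
≤⇒carry-zero _ _ _ κ μ ƛ l = ℤₚ.i≥j⇒i⊔j≡i (ℤₚ.i≤j⇒i-j≤0 l)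

carry-zero-mono : ∀ {x y} (κ μ ƛ : Vec ℤ ℓ) → x ≤ y → carry κ μ ƛ x ≡ 0ℤ → carry κ μ ƛ y ≡ 0ℤ
carry-zero-mono [] [] [] l e = refl
carry-zero-mono (κ₁ ∷ κ) (μ₁ ∷ μ) (ƛ₁ ∷ ƛ) l e =
  ≤⇒carry-zero κ₁ μ₁ ƛ₁ κ μ ƛ (ℤₚ.≤-trans (carry-zero⇒≤ κ₁ μ₁ ƛ₁ κ μ ƛ e) l)

fill-uncapped : ∀ {x} (κ μ ƛ : Vec ℤ ℓ) → carry κ μ ƛ x ≡ 0ℤ → fill x κ μ ƛ ≡ insert κ μ ƛ
fill-uncapped [] [] [] e = refl
fill-uncapped (κ₁ ∷ κ) (μ₁ ∷ μ) (ƛ₁ ∷ ƛ) e = cong (_∷ _) (ℤₚ.i≥j⇒i⊓j≡j (carry-zero⇒≤ κ₁ μ₁ ƛ₁ κ μ ƛ e))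

carry-eventually-zero : (κ μ ƛ : Vec ℤ ℓ) → ∃[ x ] carry κ μ ƛ x ≡ 0ℤ
carry-eventually-zero [] [] [] = 0ℤ , refl
carry-eventually-zero (κ₁ ∷ κ) (μ₁ ∷ μ) (ƛ₁ ∷ ƛ) = fullRow κ₁ μ₁ ƛ₁ κ μ ƛ , ≤⇒carry-zero κ₁ μ₁ ƛ₁ κ μ ƛ ℤₚ.≤-refl

-- What becomes of the tops of v and w and of the carries out of them when a box is added to q, giving q′: the
-- box is in the carries (carried), or it has stayed in row z of v (settled).
data Raised (M U V : ℤ) (p q q′ r u : Vec ℤ ℓ) : Set where
  carried :
    carry p q′ u U ≡ 1ℤ + carry p q u U →
    fill U p q′ u ≡ fill U p q u →
    carry q′ r (fill U p q u) V ≡ carry q r (fill U p q u) V - 1ℤ →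
    fill V q′ r (fill U p q u) ≡ fill V q r (fill U p q u) →
    V - U + carry q r (fill U p q u) V ≡ M →
    Raised M U V p q q′ r u
  settled : ∀ z → let v = fill U p q u in
    carry p q′ u U ≡ carry p q u U →
    fill U p q′ u ≡ updateAt v z ℤ.suc →
    carry q′ r (updateAt v z ℤ.suc) V ≡ carry q r v V →
    fill V q′ r (updateAt v z ℤ.suc) ≡ fill V q r v →
    V - U + carry q r v V ≤ M - 1ℤ →
    TopPeak (M - carry q r v V + carry p q u U) z u v (fill V q r v) →
    Raised M U V p q q′ r u

-- The box arrives in this row either because q₁ itself grows or through the carry from below. Both
-- give one box more to the first insertion and, as long as v is the same, one box less to the
-- second, so one argument serves both.
raise-row : ∀ (p₁ q₁ q₁′ r₁ u₁ : ℤ) (p q q′ r u : Vec ℤ ℓ) → let v = fill p₁ p q u in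
  fullRow p₁ q₁′ u₁ p q′ u ≡ 1ℤ + fullRow p₁ q₁ u₁ p q u →
  fill p₁ p q′ u ≡ v →
  carry q′ r v q₁′ - q₁′ ≡ carry q r v q₁ - q₁ - 1ℤ →
  fill q₁′ q′ r v ≡ fill q₁ q r v →
  r₁ - q₁ + carry q r v q₁ ≡ M → V - U ≤ M - 1ℤ → Bounded M (p₁ ∷ p) (q₁ ∷ q) (r₁ ∷ r) →
  Raised M U V (p₁ ∷ p) (q₁ ∷ q) (q₁′ ∷ q′) (r₁ ∷ r) (u₁ ∷ u)
raise-row {V = V} {U = U} p₁ q₁ q₁′ r₁ u₁ p q q′ r u e₁ e₂ e₃ e₄ refl gap (l ∷ b) = case (s ℤₚ.≤? U - 1ℤ)
  where
  c = carry p q u p₁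
  v = fill p₁ p q u
  c′ = carry q r v q₁
  open Row U V p₁ q₁ r₁ u₁ c c′ renaming (v to v₁; w to w₁)
  M′ = r₁ - q₁ + c′
  second-row : ∀ x → fullRow q₁′ r₁ x q′ r v ≡ M′ + x - 1ℤ
  second-row x = trans (h₁ r₁ x q₁′ (carry q′ r v q₁′)) (trans (cong (λ z → r₁ + x + z) e₃) (h₂ r₁ x q₁ c′))
    where h₁ : ∀ r x q c → r + x - q + c ≡ r + x + (c - q)
          h₁ = solve-∀
          h₂ : ∀ r x q c → r + x + (c - q - 1ℤ) ≡ r - q + c + x - 1ℤ
          h₂ = solve-∀
  t≡ : t ≡ M′ + v₁
  t≡ = h r₁ v₁ q₁ c′
    where h : ∀ r x q c → r + x - q + c ≡ r - q + c + x
          h = solve-∀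
  case : _ → _
  -- There is room below the cap, so the box stays: C = 0, hence h′ reaches the maximum here. The
  -- longer v₁ makes up for the box missing from the second insertion, and above this row K is
  -- smaller than the maximum.
  case (yes s<U) = settled zero
    (trans (trans (cong (λ z → 0ℤ ⊔ (z - U)) e₁) (zero⊔ 1+s≤U)) (sym (zero⊔ s≤U)))
    (cong₂ _∷_ (trans (cong (U ⊓_) e₁) (trans (ℤₚ.i≥j⇒i⊓j≡j 1+s≤U) (cong (1ℤ +_) (sym v₁≡s)))) e₂)
    (cong (λ z → 0ℤ ⊔ (z - V)) t-same)
    (cong₂ _∷_ (cong (V ⊓_) t-same) e₄)
    (level-strict)
    (here (trans w-v (trans (h (r₁ - q₁ + c′) C′) (cong (λ z → M′ - C′ + z) (sym (zero⊔ s≤U)))))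
      (subst (λ N → Bounded N _ _ _) (sym (descend-insert M′)) (insert-bounded p₁ q₁ p q r u b (descend-gap M′ p₁ q₁ r₁ l))))
    where
    zero⊔ : ∀ {x} → x ≤ U → 0ℤ ⊔ (x - U) ≡ 0ℤ
    zero⊔ x≤U = ℤₚ.i≥j⇒i⊔j≡i (ℤₚ.i≤j⇒i-j≤0 x≤U)
    s≤U : s ≤ U
    s≤U = ℤₚ.≤-trans s<U (Int.pred≤ U)
    1+s≤U : 1ℤ + s ≤ U
    1+s≤U = Int.lin s<U (h′ U s)
      where h′ : ∀ U s → U - (1ℤ + s) ≡ U - 1ℤ - s
            h′ = solve-∀
    v₁≡s : v₁ ≡ s
    v₁≡s = ℤₚ.i≥j⇒i⊓j≡j s≤U
    t-same : fullRow q₁′ r₁ (1ℤ + v₁) q′ r v ≡ t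
    t-same = trans (second-row (1ℤ + v₁)) (trans (h′ M′ v₁) (sym t≡))
      where h′ : ∀ M v → M + (1ℤ + v) - 1ℤ ≡ M + v
            h′ = solve-∀
    level-strict : V - U + C′ ≤ M′ - 1ℤ
    level-strict = +-⊔-lub (V - U) gap (Int.lin (subst (_≤ U - 1ℤ) (sym v₁≡s) s<U)
        (trans (cong (λ z → M′ - 1ℤ - (V - U + (z - V))) t≡) (h′ M′ V U v₁)))
      where h′ : ∀ M V U v → M - 1ℤ - (V - U + (M + v - V)) ≡ U - 1ℤ - v
            h′ = solve-∀
    h : ∀ M C → M - C ≡ M - C + 0ℤ
    h = solve-∀
  -- The row of v is already full, so C grows by 1. As V - U is less than M, the second insertion
  -- overflows as well; the missing box comes out of C′, and K keeps the value M.
  case (no s≮U) = carried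
    (trans (cong (λ z → 0ℤ ⊔ (z - U)) e₁) (trans (cong (0ℤ ⊔_) (ℤₚ.+-assoc 1ℤ s (ℤ.- U)))
      (trans (ℤₚ.i≤j⇒i⊔j≡j (ℤₚ.≤-trans s-U≥0 (ℤₚ.i≤suc[i] (s - U)))) (cong (1ℤ +_) (sym (ℤₚ.i≤j⇒i⊔j≡j s-U≥0))))))
    (cong₂ _∷_ v₁-same e₂)
    (trans (cong (λ z → 0ℤ ⊔ (z - V)) t′≡)
      (trans (ℤₚ.i≤j⇒i⊔j≡j (ℤₚ.i≤j⇒0≤j-i V≤t′)) (trans (h₁ t V) (cong (_- 1ℤ) (sym C′≡)))))
    (cong₂ _∷_ (trans (cong (V ⊓_) t′≡) (trans (ℤₚ.i≤j⇒i⊓j≡i V≤t′) (sym (ℤₚ.i≤j⇒i⊓j≡i V≤t)))) e₄)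
    (trans (cong (λ z → V - U + z) C′≡) (trans (cong (λ z → V - U + (z - V)) t≡M+U) (h₂ V U M′)))
    where
    U≤s : U ≤ s
    U≤s = Int.lin (Int.lt s≮U) (h U s)
      where h : ∀ U s → s - U ≡ s - 1ℤ - (U - 1ℤ)
            h = solve-∀
    s-U≥0 = ℤₚ.i≤j⇒0≤j-i U≤s
    v₁≡U : v₁ ≡ U
    v₁≡U = ℤₚ.i≤j⇒i⊓j≡i U≤s
    v₁-same : U ⊓ fullRow p₁ q₁′ u₁ p q′ u ≡ v₁
    v₁-same = trans (cong (U ⊓_) e₁) (trans (ℤₚ.i≤j⇒i⊓j≡i (ℤₚ.≤-trans U≤s (ℤₚ.i≤suc[i] s))) (sym v₁≡U))
    t≡M+U : t ≡ M′ + U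
    t≡M+U = trans t≡ (cong (M′ +_) v₁≡U)
    t′≡ : fullRow q₁′ r₁ v₁ q′ r v ≡ t - 1ℤ
    t′≡ = trans (second-row v₁) (cong (_- 1ℤ) (sym t≡))
    V≤t′ : V ≤ t - 1ℤ
    V≤t′ = Int.lin gap (trans (cong (λ z → z - 1ℤ - V) t≡M+U) (h M′ U V))
      where h : ∀ M U V → M + U - 1ℤ - V ≡ M - 1ℤ - (V - U)
            h = solve-∀
    V≤t : V ≤ t
    V≤t = ℤₚ.≤-trans V≤t′ (Int.pred≤ t)
    C′≡ : C′ ≡ t - V
    C′≡ = ℤₚ.i≤j⇒i⊔j≡j (ℤₚ.i≤j⇒0≤j-i V≤t)
    h₁ : ∀ t V → t - 1ℤ - V ≡ t - V - 1ℤ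
    h₁ = solve-∀
    h₂ : ∀ V U M → V - U + (M + U - V) ≡ M
    h₂ = solve-∀

-- The recursion descends to row j, where the box enters, and on the way back `raise-row` hands it
-- up until it settles. Rows above that one see unchanged carries and stay strictly below the peak.
raise : ∀ {j} U V (p q r u : Vec ℤ ℓ) → TopPeak M j p q r → V - U ≤ M - 1ℤ → Raised M U V p q (updateAt q j ℤ.suc) r u
raise {M = M} U V (p₁ ∷ p) (q₁ ∷ q) (r₁ ∷ r) (u₁ ∷ u) t@(here e b) gap =
  raise-row p₁ q₁ (1ℤ + q₁) r₁ u₁ p q q r u
    (h₁ q₁ u₁ p₁ (carry p q u p₁)) refl
    (trans (cong (_- (1ℤ + q₁)) c≡0′) (trans (h₂ q₁) (cong (λ z → z - q₁ - 1ℤ) (sym c≡0))))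
    (trans (fill-uncapped q r v c≡0′) (sym (fill-uncapped q r v c≡0)))
    (trans (cong (λ z → r₁ - q₁ + z) c≡0) (trans (ℤₚ.+-identityʳ _) e))
    gap (TopPeak⇒Bounded t)
  where
  v = fill p₁ p q u
  h₁ : ∀ q u p c → 1ℤ + q + u - p + c ≡ 1ℤ + (q + u - p + c)
  h₁ = solve-∀
  h₂ : ∀ q → 0ℤ - (1ℤ + q) ≡ 0ℤ - q - 1ℤ
  h₂ = solve-∀
  -- Here h equals the maximum by itself, so the bound on K leaves no room for a carry.
  c≡0 : carry q r v q₁ ≡ 0ℤ
  c≡0 = ℤₚ.≤-antisym
      (Int.lin (descend-level M p₁ q₁ r₁ (level-bound p₁ q₁ p q r u b (descend-gap M p₁ q₁ r₁ (ℤₚ.≤-reflexive e))))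
        (trans (h (r₁ - q₁) (carry q r v q₁)) (cong (λ z → z - (r₁ - q₁ + carry q r v q₁)) e)))
      (carry≥0 q r v q₁)
    where h : ∀ d c → 0ℤ - c ≡ d - (d + c)
          h = solve-∀
  c≡0′ : carry q r v (1ℤ + q₁) ≡ 0ℤ
  c≡0′ = carry-zero-mono q r v (ℤₚ.i≤suc[i] q₁) c≡0
raise {M = M} U V (p₁ ∷ p) (q₁ ∷ q) (r₁ ∷ r) (u₁ ∷ u) t@(there {j = j} l t′) gap
  with raise p₁ q₁ p q r u t′ (subst (q₁ - p₁ ≤_) (descend-pred M p₁ q₁ r₁) (descend-gap (M - 1ℤ) p₁ q₁ r₁ l))
... | carried e₁ e₂ e₃ e₄ e₅ =
  raise-row p₁ q₁ q₁ r₁ u₁ p q _ r u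
    (trans (cong (λ z → q₁ + u₁ - p₁ + z) e₁) (h₁ (q₁ + u₁ - p₁) (carry p q u p₁))) e₂
    (trans (cong (_- q₁) e₃) (h₂ (carry q r (fill p₁ p q u) q₁) q₁)) e₄
    (trans (h₃ r₁ q₁ p₁ (carry q r (fill p₁ p q u) q₁)) (trans (cong (λ z → r₁ - q₁ - (q₁ - p₁) + z) e₅) (h₄ M r₁ q₁ p₁)))
    gap (TopPeak⇒Bounded t)
  where
  h₁ : ∀ x c → x + (1ℤ + c) ≡ 1ℤ + (x + c)
  h₁ = solve-∀
  h₂ : ∀ c q → c - 1ℤ - q ≡ c - q - 1ℤ
  h₂ = solve-∀
  h₃ : ∀ r q p c → r - q + c ≡ r - q - (q - p) + (q - p + c)
  h₃ = solve-∀
  h₄ : ∀ M r q p → r - q - (q - p) + (M - (r - q) + (q - p)) ≡ M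
  h₄ = solve-∀
... | settled z e₁ e₂ e₃ e₄ lt peak = settled (suc z)
  (cong (λ c → 0ℤ ⊔ (q₁ + u₁ - p₁ + c - U)) e₁)
  (cong₂ _∷_ (cong (λ c → U ⊓ (q₁ + u₁ - p₁ + c)) e₁) e₂)
  (cong (λ c → 0ℤ ⊔ (r₁ + R.v - q₁ + c - V)) e₃)
  (cong₂ _∷_ (cong (λ c → V ⊓ (r₁ + R.v - q₁ + c)) e₃) e₄)
  (R.level gap low)
  (there (subst (R.w - R.v ≤_) (h M R.C′ R.C) (R.w-v-bound low))
         (subst (λ N → TopPeak N _ _ _ _) (sym (R.descend-insert M)) peak))
  where
  module R = Row U V p₁ q₁ r₁ u₁ (carry p q u p₁) (carry q r (fill p₁ p q u) q₁)
  low : r₁ - q₁ + carry q r (fill p₁ p q u) q₁ ≤ M - 1ℤ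
  low = descend-level (M - 1ℤ) p₁ q₁ r₁ (subst (q₁ - p₁ + _ ≤_) (sym (descend-pred M p₁ q₁ r₁)) lt)
  h : ∀ M C′ C → M - 1ℤ - C′ + C ≡ M - C′ + C - 1ℤ
  h = solve-∀

-- From capped to uncapped insertion

module _ (p q r u : Vec ℤ ℓ) where

  private
    v = insert p q u
    w = insert q r v

    -- A common cap N so large that neither insertion overflows turns both into cases of `fill`,
    -- with U = V = N.
    uncapped : ∃[ N ] fill N p q u ≡ v × carry p q u N ≡ 0ℤ × fill N q r v ≡ w × carry q r v N ≡ 0ℤ
    uncapped = let X , x = carry-eventually-zero p q u
                   Y , y = carry-eventually-zero q r v
                   x′ = carry-zero-mono p q u (ℤₚ.i≤i⊔j X Y) x
                   y′ = carry-zero-mono q r v (ℤₚ.i≤j⊔i X Y) y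
               in X ⊔ Y , fill-uncapped p q u x′ , x′ , fill-uncapped q r v y′ , y′

    M-0+0 : ∀ M → M - 0ℤ + 0ℤ ≡ M
    M-0+0 = solve-∀

  Bounded-insert : 0ℤ ≤ M → Bounded M p q r → Bounded M u v w
  Bounded-insert {M = M} M≥0 b with uncapped
  ... | N , e₁ , e₂ , e₃ , e₄ with insert-bounded N N p q r u b (subst (_≤ M) (sym (ℤₚ.+-inverseʳ N)) M≥0)
  ... | b′ rewrite e₁ | e₂ | e₃ | e₄ | M-0+0 M = b′

  TopPeak-insert : ∀ {j} → 1ℤ ≤ M → TopPeak M j p q r → ∃[ z ] TopPeak M z u v w ×
    insert p (updateAt q j ℤ.suc) u ≡ updateAt v z ℤ.suc ×
    insert (updateAt q j ℤ.suc) r (updateAt v z ℤ.suc) ≡ w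
  TopPeak-insert {M = M} {j} M>0 t with uncapped
  ... | N , e₁ , e₂ , e₃ , e₄ with raise N N p q r u t gap
    where gap : N - N ≤ M - 1ℤ
          gap = subst (_≤ M - 1ℤ) (sym (ℤₚ.+-inverseʳ N)) (ℤₚ.i≤j⇒0≤j-i M>0)
  -- With U = V and no carry out of the top row, a carried box would force M = 0; this is where
  -- positivity of the maximum enters.
  ... | carried _ _ _ _ e rewrite e₁ | e₄ | ℤₚ.+-inverseʳ N =
    contradiction (subst (1ℤ ≤_) (sym e) M>0) λ { (ℤ.+≤+ ()) }
  ... | settled z c₁ f₁ c₂ f₂ _ t′ rewrite e₁ | e₂ | e₃ | e₄ | M-0+0 M =
    z , t′ , trans (sym (fill-uncapped p q′ u c₁)) f₁ , trans (sym (fill-uncapped q′ r _ c₂)) f₂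
    where q′ = updateAt q j ℤ.suc

-- Auxiliary facts on subtraction and lists

pos-∸ : ∀ {m n} → n ℕ.≤ m → ℤ.+ (m ∸ n) ≡ ℤ.+ m - ℤ.+ n
pos-∸ {m} {n} n≤m = sym (trans (ℤₚ.m-n≡m⊖n m n) (ℤₚ.⊖-≥ n≤m))

module _ {A : Set} where

  last-++ : ∀ (xs ys : List A) → 0 ℕ.< List.length ys → List.last (xs ++ ys) ≡ List.last ys
  last-++ [] ys lt = refl
  last-++ (x ∷ []) (y ∷ ys) lt = refl
  last-++ (x ∷ x′ ∷ xs) ys lt = last-++ (x′ ∷ xs) ys lt

  last-drop : ∀ n (xs : List A) → n ℕ.< List.length xs → List.last (drop n xs) ≡ List.last xs
  last-drop zero xs lt = refl
  last-drop (suc n) (x ∷ xs@(_ ∷ _)) (s≤s lt) = last-drop n xs lt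

  last-replicate : ∀ n {x : A} → 0 ℕ.< n → List.last (replicate n x) ≡ just x
  last-replicate (suc zero) lt = refl
  last-replicate (suc (suc n)) lt = last-replicate (suc n) (s≤s z≤n)

  drop-all : ∀ n (xs : List A) → List.length xs ℕ.≤ n → drop n xs ≡ []
  drop-all n [] l = Listₚ.drop-[] n
  drop-all (suc n) (x ∷ xs) (s≤s l) = drop-all n xs l

  last-just⇒0<length : ∀ (xs : List A) {x} → List.last xs ≡ just x → 0 ℕ.< List.length xs
  last-just⇒0<length (_ ∷ _) _ = s≤s z≤n

-- Bracket words

module Scan {L : ℕ} (a b : Fin L → ℕ) where

  open Words a b using (Letter; block; push; push-block; push-same)

  word : (cs os : List (Fin L)) → List Letter
  word cs os = List.map (_, ⟩) cs ++ List.map (_, ⟨) os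

  mapMaybe-open : ∀ cs os → List.mapMaybe openRow (word cs os) ≡ os
  mapMaybe-open (c ∷ cs) os = mapMaybe-open cs os
  mapMaybe-open [] [] = refl
  mapMaybe-open [] (o ∷ os) = cong (o ∷_) (mapMaybe-open [] os)

  mapMaybe-close : ∀ cs os → List.mapMaybe closeRow (word cs os) ≡ cs
  mapMaybe-close (c ∷ cs) os = cong (c ∷_) (mapMaybe-close cs os)
  mapMaybe-close [] [] = refl
  mapMaybe-close [] (o ∷ os) = mapMaybe-close [] os

  push-opens : ∀ k n cs os → push (word cs os) (replicate n (k , ⟨)) ≡
    word (drop n cs) (replicate (n ∸ List.length cs) k ++ os)
  push-opens k zero [] os = refl
  push-opens k zero (c ∷ cs) os = refl
  push-opens k (suc n) [] os = trans (cong (cancel₁ (k , ⟨)) (push-opens k n [] os)) (no-close n os)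
    where
    no-close : ∀ n os → cancel₁ (k , ⟨) (word (drop n []) (replicate n k ++ os)) ≡ word [] (k ∷ replicate n k ++ os)
    no-close (suc n) os      = refl
    no-close zero    []      = refl
    no-close zero    (_ ∷ _) = refl
  push-opens k (suc n) (c ∷ cs) os = trans (push-same (word (c ∷ cs) os) n (k , ⟨)) (push-opens k n cs os)

  closes : Fin L → List (Fin L) → List (Fin L)
  closes k cs = replicate (a k) k ++ drop (b k) cs

  opens : Fin L → List (Fin L) → List (Fin L) → List (Fin L)
  opens k cs os = replicate (b k ∸ List.length cs) k ++ os

  push-word : ∀ k cs os → push (word cs os) (block k) ≡ word (closes k cs) (opens k cs os)
  push-word k cs os = trans (push-block (word cs os) k) (trans (cong (replicate (a k) (k , ⟩) ++_) (push-opens k (b k) cs os))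
    (trans (sym (Listₚ.++-assoc (replicate (a k) (k , ⟩)) (List.map (_, ⟩) (drop (b k) cs)) _))
      (cong (_++ List.map (_, ⟨) (opens k cs os)) (sym (trans (Listₚ.map-++ (_, ⟩) (replicate (a k) k) (drop (b k) cs))
        (cong (_++ List.map (_, ⟩) (drop (b k) cs)) (Listₚ.map-replicate (_, ⟩) (a k) k)))))))

  -- The reading word ends with the top row and its letters are prefixed from the end, so rows are
  -- processed from the top. The ( of a row cancel ) at the front of `cs`, that is, those of the
  -- nearest rows above.
  scan : List (Fin L) → (cs os : List (Fin L)) → List (Fin L) × List (Fin L)
  scan []       cs os = cs , os
  scan (k ∷ ks) cs os = scan ks (closes k cs) (opens k cs os)

  foldl-push : ∀ ks cs os → foldl (λ r k → push r (block k)) (word cs os) ks ≡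
    let cs′ , os′ = scan ks cs os in word cs′ os′
  foldl-push [] cs os = refl
  foldl-push (k ∷ ks) cs os = trans (cong (λ r → foldl (λ r k → push r (block k)) r ks) (push-word k cs os))
    (foldl-push ks (closes k cs) (opens k cs os))

  -- The map `h` lists the rows still to be scanned; inductions replace it by `h ∘ suc`.
  record Counts {N : ℕ} (h : Fin N → Fin L) (p q r : Vec ℤ N) : Set where
    constructor counts
    field
      #closes : ∀ k → ℤ.+ a (h k) ≡ lookup q k - lookup p k
      #opens  : ∀ k → ℤ.+ b (h k) ≡ lookup r k - lookup q k
  open Counts

  rest : ∀ {N} {h : Fin (suc N) → Fin L} {p₁ q₁ r₁} {p q r : Vec ℤ N} →
    Counts h (p₁ ∷ p) (q₁ ∷ q) (r₁ ∷ r) → Counts (h ∘ suc) p q r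
  rest c = counts (#closes c ∘ suc) (#opens c ∘ suc)

  length-closes : ∀ k cs → List.length (closes k cs) ≡ a k ℕ.+ (List.length cs ∸ b k)
  length-closes k cs = trans (Listₚ.length-++ (replicate (a k) k)) (cong₂ ℕ._+_ (Listₚ.length-replicate (a k)) (Listₚ.length-drop (b k) cs))

  module _ {N : ℕ} (h : Fin (suc N) → Fin L) (cs : List (Fin L)) {p₁ q₁ r₁} {p q r : Vec ℤ N}
           (c : Counts h (p₁ ∷ p) (q₁ ∷ q) (r₁ ∷ r)) where

    private
      k = h zero
      len = List.length cs

    -- While every ( finds a partner, the number of waiting ) changes exactly as the bound does
    -- under `descend`. This links cancellation to the heights h.
    closes-descend : b k ℕ.≤ len → ℤ.+ List.length (closes k cs) ≡ descend (ℤ.+ len) p₁ q₁ r₁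
    closes-descend le = trans (cong ℤ.+_ (length-closes k cs)) (trans (cong (λ z → ℤ.+ a k + z) (pos-∸ le))
        (trans (ℤₚ.+-comm (ℤ.+ a k) (ℤ.+ len - ℤ.+ b k)) (cong₂ (λ x y → ℤ.+ len - y + x) (#closes c zero) (#opens c zero))))

    closes-bound : r₁ - q₁ ≤ M → ℤ.+ len ≤ M → ℤ.+ List.length (closes k cs) ≤ descend M p₁ q₁ r₁
    closes-bound {M = M} l l′ with b k ℕₚ.≤? len
    ... | yes b≤n = Int.lin l′ (trans (cong (λ z → descend M p₁ q₁ r₁ - z) (closes-descend b≤n)) (eq M (r₁ - q₁) (q₁ - p₁) (ℤ.+ len)))
      where eq : ∀ M d g n → M - d + g - (n - d + g) ≡ M - n
            eq = solve-∀
    ... | no b≰n = Int.lin l (trans (cong (λ z → descend M p₁ q₁ r₁ - z)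
                     (trans (cong ℤ.+_ (trans (length-closes k cs) (trans (cong (a k ℕ.+_) (ℕₚ.m≤n⇒m∸n≡0 (ℕₚ.<⇒≤ (ℕₚ.≰⇒> b≰n)))) (ℕₚ.+-identityʳ (a k)))))
                       (#closes c zero))) (eq M (r₁ - q₁) (q₁ - p₁)))
      where eq : ∀ M d g → M - d + g - g ≡ M - d
            eq = solve-∀

    b≤ : ∀ {x} → r₁ - q₁ ≤ ℤ.+ x → b k ℕ.≤ x
    b≤ l = ℤₚ.drop‿+≤+ (subst (_≤ _) (sym (#opens c zero)) l)

    b≥ : ∀ {x} → ℤ.+ x ≤ r₁ - q₁ → x ℕ.≤ b k
    b≥ l = ℤₚ.drop‿+≤+ (subst (_ ≤_) (sym (#opens c zero)) l)

    opens-none : b k ℕ.≤ len → ∀ os → opens k cs os ≡ os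
    opens-none le os = cong (λ z → replicate z k ++ os) (ℕₚ.m≤n⇒m∸n≡0 le)

    opens-some : len ℕ.< b k → ∀ os → List.head (opens k cs os) ≡ just k
    opens-some lt os = head-replicate (ℕₚ.m<n⇒0<n∸m lt)
      where head-replicate : ∀ {x} → 0 ℕ.< x → List.head (replicate x k ++ os) ≡ just k
            head-replicate (s≤s _) = refl

    closes-cut : len ℕ.≤ b k → closes k cs ≡ replicate (a k) k
    closes-cut le = trans (cong (replicate (a k) k ++_) (drop-all (b k) cs le)) (Listₚ.++-identityʳ _)

    last-closes : b k ℕ.< len → List.last (closes k cs) ≡ List.last cs
    last-closes lt = trans (last-++ (replicate (a k) k) (drop (b k) cs)
        (subst (0 ℕ.<_) (sym (Listₚ.length-drop (b k) cs)) (ℕₚ.m<n⇒0<n∸m lt)))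
      (last-drop (b k) cs lt)

  Bounded⇒0≤ : ∀ {N} {h : Fin N → Fin L} {p q r} → Counts h p q r → Bounded M p q r → 0ℤ ≤ M
  Bounded⇒0≤ c ([] l) = l
  Bounded⇒0≤ c (l ∷ _) = ℤₚ.≤-trans (subst (0ℤ ≤_) (#opens c zero) (+≤+ z≤n)) l

  -- In no row do the ( outnumber the waiting ), so no new ( survives.
  head-bounded : ∀ {N} (h : Fin N → Fin L) cs os {p q r} → Counts h p q r → Bounded (ℤ.+ List.length cs) p q r →
    List.head (proj₂ (scan (List.tabulate h) cs os)) ≡ List.head os
  head-bounded h cs os c ([] _) = refl
  head-bounded h cs os c (l ∷ bd) = trans
    (head-bounded (h ∘ suc) _ _ (rest c) (subst (λ N → Bounded N _ _ _) (sym (closes-descend h cs c (b≤ h cs c l))) bd))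
    (cong List.head (opens-none h cs c (b≤ h cs c l) os))

  -- Before row j fewer than the required number of ) are waiting, so a ( of row j survives and uses
  -- up all of them. From there on the bound holds with equality, and `head-bounded` excludes any
  -- later (.
  head-peak : ∀ {N} (h : Fin N → Fin L) cs os {j p q r} → Counts h p q r → TopPeak M j p q r → ℤ.+ List.length cs ≤ M - 1ℤ →
    List.head (proj₂ (scan (List.tabulate h) cs os)) ≡ just (h j)
  head-peak h cs os c (here {p₁ = p₁} {q₁} {r₁} refl bd) l = trans
    (head-bounded (h ∘ suc) (closes k cs) (opens k cs os) (rest c) (subst (λ N → Bounded N _ _ _) (sym length≡) bd))
    (opens-some h cs c b> os)
    where
    k = h zero
    b> : List.length cs ℕ.< b k
    b> = b≥ h cs c (Int.lin l (eq (r₁ - q₁) (ℤ.+ List.length cs)))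
      where eq : ∀ d n → d - (1ℤ + n) ≡ d - 1ℤ - n
            eq = solve-∀
    length≡ : ℤ.+ List.length (closes k cs) ≡ descend (r₁ - q₁) p₁ q₁ r₁
    length≡ = trans (cong ℤ.+_ (trans (cong List.length (closes-cut h cs c (ℕₚ.<⇒≤ b>))) (Listₚ.length-replicate (a k))))
      (trans (#closes c zero) (eq (r₁ - q₁) (q₁ - p₁)))
      where eq : ∀ d g → g ≡ d - d + g
            eq = solve-∀
  head-peak {M = M} h cs os c (there {p₁ = p₁} {q₁} {r₁} l′ t) l = head-peak (h ∘ suc) _ _ (rest c) t
    (subst (_ ≤_) (descend-pred M p₁ q₁ r₁) (closes-bound h cs c l′ l))

  -- The bound, one less than the number of waiting ), means that each row leaves at least one of
  -- them; the last in the list is thus never cancelled.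
  last-bounded : ∀ {N} (h : Fin N → Fin L) cs os {p q r} → Counts h p q r → Bounded (ℤ.+ List.length cs - 1ℤ) p q r →
    List.last (proj₁ (scan (List.tabulate h) cs os)) ≡ List.last cs
  last-bounded h cs os c ([] _) = refl
  last-bounded h cs os c (_∷_ {p₁ = p₁} {q₁} {r₁} l bd) = trans
    (last-bounded (h ∘ suc) _ _ (rest c) (subst (λ N → Bounded N _ _ _)
      (trans (descend-pred (ℤ.+ List.length cs) p₁ q₁ r₁) (cong (_- 1ℤ) (sym (closes-descend h cs c (ℕₚ.<⇒≤ b<))))) bd))
    (last-closes h cs c b<)
    where
    b< : b (h zero) ℕ.< List.length cs
    b< = ℤₚ.drop‿+≤+ (Int.lin (subst (_≤ _) (sym (#opens c zero)) l) (eq (ℤ.+ List.length cs) (ℤ.+ b (h zero))))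
      where eq : ∀ n b → n - (1ℤ + b) ≡ n - 1ℤ - b
            eq = solve-∀

  -- Row j cancels every ) from above. Its own ) are then the only ones, and by `last-bounded` the
  -- last of them survives.
  last-peak : ∀ {N} (h : Fin N → Fin L) cs os {j p q r} → Counts h p q r → BottomPeak M j p q r → ℤ.+ List.length cs ≤ M →
    List.last (proj₁ (scan (List.tabulate h) cs os)) ≡ just (h j)
  last-peak h cs os c (here {p₁ = p₁} {q₁} {r₁} refl bd) l = trans
    (last-bounded (h ∘ suc) (closes k cs) (opens k cs os) (rest c) (subst (λ N → Bounded (N - 1ℤ) _ _ _) (sym length≡) bd))
    (trans (cong List.last cut) (last-replicate (a k) a>0))
    where
    k = h zero
    cut = closes-cut h cs c (b≥ h cs c l)
    a≡ : ℤ.+ a k ≡ descend (r₁ - q₁) p₁ q₁ r₁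
    a≡ = trans (#closes c zero) (eq (r₁ - q₁) (q₁ - p₁))
      where eq : ∀ d g → g ≡ d - d + g
            eq = solve-∀
    length≡ : ℤ.+ List.length (closes k cs) ≡ descend (r₁ - q₁) p₁ q₁ r₁
    length≡ = trans (cong ℤ.+_ (trans (cong List.length cut) (Listₚ.length-replicate (a k)))) a≡
    a>0 : 0 ℕ.< a k
    a>0 = ℤₚ.drop‿+≤+ (Int.lin (Bounded⇒0≤ (rest c) bd) (trans (cong (_- 1ℤ) a≡) (eq (descend (r₁ - q₁) p₁ q₁ r₁))))
      where eq : ∀ d → d - 1ℤ ≡ d - 1ℤ - 0ℤ
            eq = solve-∀
  last-peak h cs os c (there l′ t) l = last-peak (h ∘ suc) _ _ (rest c) t (closes-bound h cs c l′ l)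

  -- The surviving ) either was waiting at the start or comes from a scanned row. In the second case
  -- that row had cancelled all earlier ), which makes it a bottom peak.
  last-inverse : ∀ {N} (h : Fin N → Fin L) cs os {p q r j} → Counts h p q r →
    List.last (proj₁ (scan (List.tabulate h) cs os)) ≡ just j →
    (List.last cs ≡ just j × Bounded (ℤ.+ List.length cs - 1ℤ) p q r) ⊎
    (∃[ M ] ∃[ z ] h z ≡ j × ℤ.+ List.length cs ≤ M × BottomPeak M z p q r)
  last-inverse {zero} h cs os {[]} {[]} {[]} c e = inj₁ (e , [] (ℤₚ.i≤j⇒0≤j-i (+≤+ (last-just⇒0<length cs e))))
  last-inverse {suc N} h cs os {p₁ ∷ p} {q₁ ∷ q} {r₁ ∷ r} c e with last-inverse (h ∘ suc) _ _ (rest c) e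
  ... | inj₂ (M , z , z≡ , l , t) = inj₂ (M′ , suc z , z≡ , n≤M′ , there b≤M′ (subst (λ N → BottomPeak N _ _ _ _) (sym (eq₁ M (r₁ - q₁) (q₁ - p₁))) t))
    where
    k = h zero
    -- Chosen so that `descend` takes M′ back to M.
    M′ = M + (r₁ - q₁) - (q₁ - p₁)
    eq₁ : ∀ M d g → M + d - g - d + g ≡ M
    eq₁ = solve-∀
    length≤M : ℤ.+ a k + ℤ.+ (List.length cs ∸ b k) ≤ M
    length≤M = subst (λ x → ℤ.+ x ≤ M) (length-closes k cs) l
    b≤M′ : r₁ - q₁ ≤ M′
    b≤M′ = Int.lin (ℤₚ.≤-trans (+≤+ (ℕₚ.m≤m+n (a k) _)) length≤M)
             (trans (eq₂ M (r₁ - q₁) (q₁ - p₁)) (cong (λ z → M - z) (sym (#closes c zero))))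
      where eq₂ : ∀ M d g → M + d - g - d ≡ M - g
            eq₂ = solve-∀
    n≤M′ : ℤ.+ List.length cs ≤ M′
    n≤M′ = ℤₚ.≤-trans (+≤+ (ℕₚ.m≤n+m∸n (List.length cs) (b k)))
        (Int.lin length≤M (trans (cong₂ (λ x y → M + x - y - (ℤ.+ b k + ℤ.+ (List.length cs ∸ b k))) (sym (#opens c zero)) (sym (#closes c zero)))
                                 (eq₂ M (ℤ.+ b k) (ℤ.+ a k) (ℤ.+ (List.length cs ∸ b k)))))
      where eq₂ : ∀ M b a x → M + b - a - (b + x) ≡ M - (a + x)
            eq₂ = solve-∀
  ... | inj₁ (e′ , bd) with List.length cs ℕₚ.≤? b (h zero)
  ... | no b<n = inj₁ (trans (sym (last-closes h cs c (ℕₚ.≰⇒> b<n))) e′ ,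
      Int.lin (subst (λ z → ℤ.suc z ≤ ℤ.+ List.length cs) (#opens c zero) (+≤+ (ℕₚ.≰⇒> b<n))) (eq₁ (ℤ.+ List.length cs) (r₁ - q₁)) ∷
      subst (λ N → Bounded N p q r) (trans (cong (_- 1ℤ) (closes-descend h cs c (ℕₚ.<⇒≤ (ℕₚ.≰⇒> b<n)))) (sym (descend-pred (ℤ.+ List.length cs) p₁ q₁ r₁))) bd)
    where eq₁ : ∀ n d → n - 1ℤ - d ≡ n - (1ℤ + d)
          eq₁ = solve-∀
  ... | yes n≤b = inj₂ (r₁ - q₁ , zero , k≡j , subst (_ ≤_) (#opens c zero) (+≤+ n≤b) ,
      here refl (subst (λ N → Bounded N p q r) (cong (_- 1ℤ) length≡) bd))
    where
    k = h zero
    cut = closes-cut h cs c n≤b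
    length≡ : ℤ.+ List.length (closes k cs) ≡ descend (r₁ - q₁) p₁ q₁ r₁
    length≡ = trans (cong ℤ.+_ (trans (cong List.length cut) (Listₚ.length-replicate (a k))))
      (trans (#closes c zero) (eq₁ (r₁ - q₁) (q₁ - p₁)))
      where eq₁ : ∀ d g → g ≡ d - d + g
            eq₁ = solve-∀
    a>0 : 0 ℕ.< a k
    a>0 = subst (0 ℕ.<_) (trans (cong List.length cut) (Listₚ.length-replicate (a k))) (last-just⇒0<length (closes k cs) e′)
    k≡j : k ≡ _
    k≡j = just-inj (trans (sym (last-replicate (a k) a>0)) (trans (cong List.last (sym cut)) e′))
      where just-inj : ∀ {x y : Fin L} → just x ≡ just y → x ≡ y
            just-inj refl = refl

-- Rows are searched from the top with the record value M, which only a strictly larger height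
-- replaces; so the row found is the topmost maximum. The inequality between p and q keeps the
-- descended record nonnegative.
Bounded-or-TopPeak : ∀ {p q r : Vec ℤ ℓ} → (∀ k → lookup p k ≤ lookup q k) → 0ℤ ≤ M →
  Bounded M p q r ⊎ ∃[ N ] ∃[ j ] M + 1ℤ ≤ N × TopPeak N j p q r
Bounded-or-TopPeak {p = []} {[]} {[]} le M≥0 = inj₁ ([] M≥0)
Bounded-or-TopPeak {M = M} {p = p₁ ∷ p} {q₁ ∷ q} {r₁ ∷ r} le M≥0 = go (r₁ - q₁ ℤₚ.≤? M)
  where
  next : ∀ {N} → r₁ - q₁ ≤ N → _
  next {N} l = Bounded-or-TopPeak {M = descend N p₁ q₁ r₁} {p} {q} {r} (le ∘ suc)
    (ℤₚ.≤-trans (ℤₚ.i≤j⇒0≤j-i (le zero)) (descend-gap N p₁ q₁ r₁ l))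
  lift : ∀ {N} N₀ → descend N₀ p₁ q₁ r₁ + 1ℤ ≤ N → N₀ + 1ℤ ≤ N + (r₁ - q₁) - (q₁ - p₁)
  lift {N} N₀ l = Int.lin l (eq N N₀ (r₁ - q₁) (q₁ - p₁))
    where eq : ∀ N N₀ d g → N + d - g - (N₀ + 1ℤ) ≡ N - (N₀ - d + g + 1ℤ)
          eq = solve-∀
  below : ∀ {x N} N₀ → x ≤ N₀ → N₀ + 1ℤ ≤ N → x ≤ N - 1ℤ
  below {x} {N} N₀ l l′ = ℤₚ.≤-trans l (Int.lin l′ (eq N N₀))
    where eq : ∀ N N₀ → N - 1ℤ - N₀ ≡ N - (N₀ + 1ℤ)
          eq = solve-∀
  back : ∀ N → N + (r₁ - q₁) - (q₁ - p₁) - (r₁ - q₁) + (q₁ - p₁) ≡ N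
  back N = eq N (r₁ - q₁) (q₁ - p₁)
    where eq : ∀ N d g → N + d - g - d + g ≡ N
          eq = solve-∀
  extend : ∀ {N₀ N j} → r₁ - q₁ ≤ N₀ → M ≤ N₀ → descend N₀ p₁ q₁ r₁ + 1ℤ ≤ N → TopPeak N j p q r →
    ∃[ N ] ∃[ j ] M + 1ℤ ≤ N × TopPeak N j (p₁ ∷ p) (q₁ ∷ q) (r₁ ∷ r)
  extend {N₀} {N} {j} l M≤ lt t = _ , suc j , ℤₚ.≤-trans (ℤₚ.+-monoˡ-≤ 1ℤ M≤) (lift N₀ lt) ,
    there (below N₀ l (lift N₀ lt)) (subst (λ N → TopPeak N j p q r) (sym (back N)) t)
  go : _ → _
  go (yes l) with next l
  ... | inj₁ bd = inj₁ (l ∷ bd)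
  ... | inj₂ (N , j , lt , t) = inj₂ (extend l ℤₚ.≤-refl lt t)
  go (no ¬l) with next ℤₚ.≤-refl
  ... | inj₁ bd = inj₂ (r₁ - q₁ , zero , Int.lin (Int.lt ¬l) (eq M (r₁ - q₁)) , here refl bd)
    where eq : ∀ M d → d - (M + 1ℤ) ≡ d - 1ℤ - M
          eq = solve-∀
  ... | inj₂ (N , j , lt , t) = inj₂ (extend ℤₚ.≤-refl (ℤₚ.<⇒≤ (ℤₚ.≰⇒> ¬l)) lt t)

-- Kashiwara operators on tableaux

rows : {ρ ƛ : Signature ℓ} → SST ρ ƛ n → Vec (Vec ℤ ℓ) (suc n)
rows P = Vec.map parts (chain P)

parts-injective : ∀ {k} {v w : Vec (Signature ℓ) k} → Vec.map parts v ≡ Vec.map parts w → v ≡ w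
parts-injective {v = []}    {[]}    _  = refl
parts-injective {v = _ ∷ _} {_ ∷ _} eq =
  cong₂ _∷_ (signature-≡ (Vecₚ.∷-injectiveˡ eq)) (parts-injective (Vecₚ.∷-injectiveʳ eq))

rows-injective : {ρ ƛ : Signature ℓ} {P P′ : SST ρ ƛ n} → rows P ≡ rows P′ → P ≡ P′
rows-injective {P = sst _ _ _ _} {sst _ _ _ _} eq with refl ← parts-injective eq = refl

module _ {ρ ƛ : Signature ℓ} (i : Fin m) (P : SST ρ ƛ (suc m)) where

  before at-label after : Vec ℤ ℓ
  before   = lookup (rows P) (inject₁ (inject₁ i))
  at-label = lookup (rows P) (suc (inject₁ i))
  after    = lookup (rows P) (suc (suc i))

  private
    module W = Words (closers i P) (openers i P)
    module S = Scan (closers i P) (openers i P)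

    row : ∀ k → lookup (rows P) k ≡ parts (lookup (chain P) k)
    row k = Vecₚ.lookup-map k parts (chain P)

  ascending : ∀ k → lookup (rows P) (inject₁ k) ≼ lookup (rows P) (suc k)
  ascending k = subst₂ _≼_ (sym (row (inject₁ k))) (sym (row (suc k))) (linked-lookup (linked P) k)

  label-counts : S.Counts id before at-label after
  label-counts = S.counts (difference (inject₁ i)) (difference (suc i))
    where
    difference : ∀ k j → ℤ.+ labelCount P j k ≡ lookup (lookup (rows P) (suc k)) j - lookup (lookup (rows P) (inject₁ k)) j
    difference k j rewrite row (suc k) | row (inject₁ k) =
      ℤₚ.0≤i⇒+∣i∣≡i (ℤₚ.i≤j⇒0≤j-i (≼-lookup (linked-lookup (linked P) k) j))

  parens-row : ∀ j → List.mapMaybe (paren i) (rowWord P j) ≡ W.block j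
  parens-row j = trans (mapMaybe-concatMap (paren i) run (allFin (suc m)))
    (trans (concatMap-two (List.mapMaybe (paren i) ∘ run) id i
              λ k p q → mapMaybe-replicate-nothing (paren i) (labelCount P j k) (paren-other i j k p q))
      (cong₂ _++_ (mapMaybe-replicate-just (paren i) (closers i P j) (paren-close i j))
                  (mapMaybe-replicate-just (paren i) (openers i P j) (paren-open i j))))
    where
    run : Fin (suc m) → List (Fin ℓ × Fin (suc m))
    run k = replicate (labelCount P j k) (j , k)

  scanned : List (Fin ℓ) × List (Fin ℓ)
  scanned = S.scan (allFin ℓ) [] []

  remaining-scanned : remaining i P ≡ S.word (proj₁ scanned) (proj₂ scanned)
  remaining-scanned = trans
    (cong cancelAll (trans (mapMaybe-concatMap (paren i) (rowWord P) (reverse (allFin ℓ)))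
                           (Listₚ.concatMap-cong parens-row (reverse (allFin ℓ)))))
    (trans (W.push-concatMap (reverse (allFin ℓ)))
    (trans (Listₚ.reverse-foldr (λ j r → W.push r (W.block j)) [] (allFin ℓ))
           (S.foldl-push (allFin ℓ) [] [])))

  leftmostOpen-scanned : leftmostOpen i P ≡ List.head (proj₂ scanned)
  leftmostOpen-scanned = cong List.head (trans (cong (List.mapMaybe openRow) remaining-scanned) (S.mapMaybe-open (proj₁ scanned) (proj₂ scanned)))

  rightmostClose-scanned : rightmostClose i P ≡ List.last (proj₁ scanned)
  rightmostClose-scanned = cong List.last (trans (cong (List.mapMaybe closeRow) remaining-scanned) (S.mapMaybe-close (proj₁ scanned) (proj₂ scanned)))

  leftmostOpen-bounded : Bounded 0ℤ before at-label after → leftmostOpen i P ≡ nothing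
  leftmostOpen-bounded b = trans leftmostOpen-scanned (S.head-bounded id [] [] label-counts b)

  leftmostOpen-peak : ∀ {j} → 1ℤ ≤ M → TopPeak M j before at-label after → leftmostOpen i P ≡ just j
  leftmostOpen-peak M>0 t = trans leftmostOpen-scanned (S.head-peak id [] [] label-counts t (ℤₚ.i≤j⇒0≤j-i M>0))

  rightmostClose-peak : ∀ {j} → 0ℤ ≤ M → BottomPeak M j before at-label after → rightmostClose i P ≡ just j
  rightmostClose-peak M≥0 t = trans rightmostClose-scanned (S.last-peak id [] [] label-counts t M≥0)

  rightmostClose-inverse : ∀ {j} → rightmostClose i P ≡ just j → ∃[ M ] 0ℤ ≤ M × BottomPeak M j before at-label after
  rightmostClose-inverse eq with S.last-inverse id [] [] label-counts (trans (sym rightmostClose-scanned) eq)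
  ... | inj₁ (() , _)
  ... | inj₂ (M , z , refl , M≥0 , t) = M , M≥0 , t

  bounded-or-peak : Bounded 0ℤ before at-label after ⊎ ∃[ M ] ∃[ j ] 1ℤ ≤ M × TopPeak M j before at-label after
  bounded-or-peak = Bounded-or-TopPeak (≼-lookup (ascending (inject₁ i))) ℤₚ.≤-refl

  -- Records the chosen row and the resulting rows without the validity proofs inside `e` and `f`,
  -- so that later case distinctions need not mention these proofs.
  data Moved (h : ℤ → ℤ) : Maybe (Fin ℓ) → Maybe (SST ρ ƛ (suc m)) → Set where
    none : Moved h nothing nothing
    some : ∀ {j P′} → rows P′ ≡ rows P [ suc (inject₁ i) ]≔ updateAt at-label j h → Moved h (just j) (just P′)

  private
    rows-replace : ∀ j h → Vec.map parts (chain P) [ suc (inject₁ i) ]≔ updateAt (parts (lookup (chain P) (suc (inject₁ i)))) j h ≡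
      rows P [ suc (inject₁ i) ]≔ updateAt at-label j h
    rows-replace j h = cong (λ v → rows P [ suc (inject₁ i) ]≔ updateAt v j h) (sym (row (suc (inject₁ i))))

    -- e passes refl : leftmostOpen i P ≡ leftmostOpen i P to its with-clauses, and abstracting leftmostOpen i P
    -- in e i P is ill-typed as long as that proof mentions it twice: it is first replaced by to _ from.
    e-moved′ : ∀ x → (∀ y → x ≡ y → leftmostOpen i P ≡ y) → x ≡ leftmostOpen i P → Moved ℤ.suc x (e i P)
    e-moved′ x to from with refl {x = leftmostOpen i P}
    ... | eq with uip eq (to (leftmostOpen i P) from)
    e-moved′ x to from | _ | refl with to | leftmostOpen i P
    e-moved′ x to refl | _ | refl | _ | nothing = none
    e-moved′ x to refl | _ | refl | _ | just j =
      some (trans (Vecₚ.map-[]≔ parts (chain P) (suc (inject₁ i))) (rows-replace j ℤ.suc))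

    f-moved′ : ∀ x → (∀ y → x ≡ y → rightmostClose i P ≡ y) → x ≡ rightmostClose i P → Moved ℤ.pred x (f i P)
    f-moved′ x to from with refl {x = rightmostClose i P}
    ... | eq with uip eq (to (rightmostClose i P) from)
    f-moved′ x to from | _ | refl with to | rightmostClose i P
    f-moved′ x to refl | _ | refl | _ | nothing = none
    f-moved′ x to refl | _ | refl | _ | just j =
      some (trans (Vecₚ.map-[]≔ parts (chain P) (suc (inject₁ i))) (rows-replace j ℤ.pred))

  moved-just : ∀ {h x P′} → Moved h x (just P′) →
    ∃[ j ] x ≡ just j × rows P′ ≡ rows P [ suc (inject₁ i) ]≔ updateAt at-label j h
  moved-just (some eq) = _ , refl , eq

  e-moved : Moved ℤ.suc (leftmostOpen i P) (e i P)
  e-moved = e-moved′ (leftmostOpen i P) (λ _ → id) refl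

  f-moved : Moved ℤ.pred (rightmostClose i P) (f i P)
  f-moved = f-moved′ (rightmostClose i P) (λ _ → id) refl

  e-bounded : Bounded 0ℤ before at-label after → e i P ≡ nothing
  e-bounded b with leftmostOpen i P | leftmostOpen-bounded b | e i P | e-moved
  ... | _ | refl | _ | none = refl

  e-peak : ∀ {j} → 1ℤ ≤ M → TopPeak M j before at-label after →
    ∃[ P′ ] e i P ≡ just P′ × rows P′ ≡ rows P [ suc (inject₁ i) ]≔ updateAt at-label j ℤ.suc
  e-peak M>0 t with leftmostOpen i P | leftmostOpen-peak M>0 t | e i P | e-moved
  ... | _ | refl | _ | some eq = _ , refl , eq

  f-peak : ∀ {j} → 0ℤ ≤ M → BottomPeak M j before at-label after →
    ∃[ P′ ] f i P ≡ just P′ × rows P′ ≡ rows P [ suc (inject₁ i) ]≔ updateAt at-label j ℤ.pred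
  f-peak M≥0 t with rightmostClose i P | rightmostClose-peak M≥0 t | f i P | f-moved
  ... | _ | refl | _ | some eq = _ , refl , eq

  e-inverse : ∀ {P′} → e i P ≡ just P′ → ∃[ M ] ∃[ j ] 1ℤ ≤ M × TopPeak M j before at-label after ×
    rows P′ ≡ rows P [ suc (inject₁ i) ]≔ updateAt at-label j ℤ.suc
  e-inverse eq with bounded-or-peak
  ... | inj₁ b with () ← trans (sym (e-bounded b)) eq
  ... | inj₂ (M , j , M>0 , t) with e-peak M>0 t
  ... | P″ , eq′ , r with refl ← trans (sym eq′) eq = M , j , M>0 , t , r

  f-inverse : ∀ {P′} → f i P ≡ just P′ → ∃[ M ] ∃[ j ] 0ℤ ≤ M × BottomPeak M j before at-label after ×
    rows P′ ≡ rows P [ suc (inject₁ i) ]≔ updateAt at-label j ℤ.pred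
  f-inverse eq with moved-just (subst (Moved ℤ.pred (rightmostClose i P)) eq f-moved)
  ... | j , eq′ , r with rightmostClose-inverse eq′
  ... | M , M≥0 , t = M , j , M≥0 , t , r

-- The operators e and f are mutually inverse

module _ {ρ ƛ : Signature ℓ} (i : Fin m) (P P′ : SST ρ ƛ (suc m)) {j h}
         (r : rows P′ ≡ rows P [ suc (inject₁ i) ]≔ updateAt (at-label i P) j h) where

  before-moved : before i P′ ≡ before i P
  before-moved = trans (cong (λ c → lookup c (inject₁ (inject₁ i))) r)
    (Vecₚ.lookup∘update′ (λ eq → inject₁≢suc (inject₁ i) (sym eq)) (rows P) _)

  at-label-moved : at-label i P′ ≡ updateAt (at-label i P) j h
  at-label-moved = trans (cong (λ c → lookup c (suc (inject₁ i))) r) (Vecₚ.lookup∘update (suc (inject₁ i)) (rows P) _)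

  after-moved : after i P′ ≡ after i P
  after-moved = trans (cong (λ c → lookup c (suc (suc i))) r)
    (Vecₚ.lookup∘update′ (λ eq → inject₁≢suc i (Finₚ.suc-injective eq)) (rows P) _)

  moved-back : ∀ {h′} P″ → (∀ x → h′ (h x) ≡ x) →
    rows P″ ≡ rows P′ [ suc (inject₁ i) ]≔ updateAt (at-label i P′) j h′ → P″ ≡ P
  moved-back {h′} P″ inverse r′ = rows-injective (trans r′ (trans (cong₂ (λ c v → c [ k ]≔ updateAt v j h′) r at-label-moved)
      (trans (Vecₚ.[]≔-idempotent (rows P) k)
      (trans (cong (rows P [ k ]≔_) (trans (Vecₚ.updateAt-updateAt j (at-label i P)) (Vecₚ.updateAt-id-local j (at-label i P) (inverse _))))
             (Vecₚ.[]≔-lookup (rows P) k)))))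
    where k = suc (inject₁ i)

module _ {ρ ƛ : Signature ℓ} (i : Fin m) {P P′ : SST ρ ƛ (suc m)} where

  -- By `TopPeak-raise` the row lengthened by e is the bottom peak afterwards, so f picks the same
  -- row and removes the box. The converse uses `BottomPeak-lower`.
  e⇒f : e i P ≡ just P′ → f i P′ ≡ just P
  e⇒f eq with e-inverse i P eq
  ... | M , j , M>0 , t , r
    with f-peak i P′ (ℤₚ.i≤j⇒0≤j-i M>0) (subst₂ (λ v w → BottomPeak (M - 1ℤ) j v (at-label i P′) w)
           (sym (before-moved i P P′ r)) (sym (after-moved i P P′ r))
           (subst (λ v → BottomPeak (M - 1ℤ) j _ v _) (sym (at-label-moved i P P′ r)) (TopPeak-raise t)))
  ... | P″ , eq′ , r′ = trans eq′ (cong just (moved-back i P P′ r P″ ℤₚ.pred-suc r′))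

  f⇒e : f i P ≡ just P′ → e i P′ ≡ just P
  f⇒e eq with f-inverse i P eq
  ... | M , j , M≥0 , t , r
    with e-peak i P′ (ℤₚ.+-monoˡ-≤ 1ℤ M≥0) (subst₂ (λ v w → TopPeak (M + 1ℤ) j v (at-label i P′) w)
           (sym (before-moved i P P′ r)) (sym (after-moved i P P′ r))
           (subst (λ v → TopPeak (M + 1ℤ) j _ v _) (sym (at-label-moved i P P′ r)) (BottomPeak-lower t)))
  ... | P″ , eq′ , r′ = trans eq′ (cong just (moved-back i P P′ r P″ ℤₚ.suc-pred r′))

-- Commutation with ι₁, ι₂ and cRSK

module _ {X : Set} (G : Growth X) (m : ℕ) where
  open Growth G using () renaming (F to rule)
  open Cylinder G m using (scanF; head-scanF)

  -- The hypotheses concern the two squares next to the changed member. Beyond the second square the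
  -- scan resumes with its old value, so nothing else changes.
  scanF-update : ∀ {k} (c : Vec X (2+ k)) (i : Fin k) q {σ τ} → let d = scanF c q in
    rule (lookup c (inject₁ (inject₁ i))) σ (lookup d (inject₁ (inject₁ i))) ≡ τ →
    rule σ (lookup c (suc (suc i))) τ ≡ lookup d (suc (suc i)) →
    scanF (c [ suc (inject₁ i) ]≔ σ) q ≡ d [ suc (inject₁ i) ]≔ τ
  scanF-update (x ∷ y ∷ z ∷ c) zero q {σ} refl eq =
    cong (λ s → q ∷ rule x σ q ∷ scanF (z ∷ c) s) (trans eq (trans (lookup-zero (scanF (z ∷ c) _)) (head-scanF (z ∷ c) _)))
  scanF-update (x ∷ y ∷ c) (suc i) q eq₁ eq₂ = cong (q ∷_) (scanF-update (y ∷ c) i (rule x y q) eq₁ eq₂)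

module _ {ρ ƛ ρ′ ƛ′ : Signature ℓ} (P : SST ρ ƛ (suc m)) (u₀ : Vec ℤ ℓ) (S : SST ρ′ ƛ′ (suc m)) where

  open Cylinder (growth ℓ) m using (scanF; scanF-rule)

  module _ (s : rows S ≡ scanF (rows P) u₀) (i : Fin m) where

    private
      step : ∀ {d} → d ≡ scanF (rows P) u₀ → ∀ k →
        lookup d (suc k) ≡ insert (lookup (rows P) (inject₁ k)) (lookup (rows P) (suc k)) (lookup d (inject₁ k))
      step refl = scanF-rule (rows P) u₀

      v w : Vec ℤ ℓ
      v = insert (before i P) (at-label i P) (before i S)
      w = insert (at-label i P) (after i P) v

      v≡ : v ≡ at-label i S
      v≡ = sym (step s (inject₁ i))

      w≡ : w ≡ after i S
      w≡ = trans (cong (insert (at-label i P) (after i P)) v≡) (sym (step s (suc i)))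

    -- The squares on either side of the label are the two insertions of the carry rule, with u the
    -- member of S before the label. The last component says that the end of S stays put; it
    -- determines the end of the second tableau.
    e-scanF : (e i P ≡ nothing × e i S ≡ nothing) ⊎
      (∃[ P′ ] ∃[ S′ ] e i P ≡ just P′ × e i S ≡ just S′ × rows S′ ≡ scanF (rows P′) u₀ × lookup (rows S′) (fromℕ (suc m)) ≡ lookup (rows S) (fromℕ (suc m)))
    e-scanF with bounded-or-peak i P
    ... | inj₁ b = inj₁ (e-bounded i P b , e-bounded i S
      (subst₂ (Bounded 0ℤ (before i S)) v≡ w≡ (Bounded-insert (before i P) (at-label i P) (after i P) (before i S) ℤₚ.≤-refl b)))
    ... | inj₂ (M , j , M>0 , t)
      with z , t′ , e₁ , e₂ ← TopPeak-insert (before i P) (at-label i P) (after i P) (before i S) M>0 t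
      with P′ , eqP , rP ← e-peak i P M>0 t
      with S′ , eqS , rS ← e-peak i S M>0 (subst₂ (TopPeak M z (before i S)) v≡ w≡ t′) =
      inj₂ (P′ , S′ , eqP , eqS , trans rS (sym (trans (cong (λ c → scanF c u₀) rP) scan≡)) , last-unmoved)
      where
      σ τ : Vec ℤ ℓ
      σ = updateAt (at-label i P) j ℤ.suc
      τ = updateAt (at-label i S) z ℤ.suc
      look : ∀ k → lookup (rows S) k ≡ lookup (scanF (rows P) u₀) k
      look k = cong (λ c → lookup c k) s
      e₁′ : insert (before i P) σ (before i S) ≡ τ
      e₁′ = trans e₁ (cong (λ v → updateAt v z ℤ.suc) v≡)
      e₂′ : insert σ (after i P) τ ≡ after i S
      e₂′ = trans (cong (λ v → insert σ (after i P) (updateAt v z ℤ.suc)) (sym v≡)) (trans e₂ w≡)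
      scan≡ : scanF (rows P [ suc (inject₁ i) ]≔ σ) u₀ ≡ rows S [ suc (inject₁ i) ]≔ τ
      scan≡ = trans
        (scanF-update (growth ℓ) m (rows P) i u₀
          (trans (cong (insert (before i P) σ) (sym (look (inject₁ (inject₁ i))))) e₁′) (trans e₂′ (look (suc (suc i)))))
        (cong (λ c → c [ suc (inject₁ i) ]≔ τ) (sym s))
      last-unmoved : lookup (rows S′) (fromℕ (suc m)) ≡ lookup (rows S) (fromℕ (suc m))
      last-unmoved = trans (cong (λ c → lookup c (fromℕ (suc m))) rS)
        (Vecₚ.lookup∘update′ (λ eq → Finₚ.fromℕ≢inject₁ (Finₚ.suc-injective eq)) (rows S) τ)

module _ {ρ ƛ : Signature ℓ} (P Q : SST ρ ƛ (suc m)) where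

  private
    module Cyl = Cylinder (growth ℓ) m
    S = Pairs.P (pairAt Λ[ P , Q ] 0ℤ 1ℤ)
    u₀ = lookup (rows Q) (suc zero)

  rows-ι₂ : rows S ≡ Cyl.scanF (rows P) u₀
  rows-ι₂ = trans (sym (Vecₚ.tabulate-∘ parts (λ i → at Λ[ P , Q ] (ℤ.+ toℕ i) 1ℤ)))
    (trans (Vecₚ.tabulate-cong λ i → trans (cong (λ x → Cyl.extend (boundary P Q) x 1ℤ) (sym (ℤₚ.+-identityʳ (ℤ.+ toℕ i))))
                                           (Cyl.extend-row (boundary-ok P Q) i 0ℤ 1ℤ))
      (trans (Vecₚ.tabulate∘lookup (proj₁ (Cyl.up (boundary P Q)))) (up-row (rows P) (rows Q))))
    where
    up-row : ∀ p q → proj₁ (Cyl.up (p , q)) ≡ Cyl.scanF p (lookup q (suc zero))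
    up-row p (_ ∷ _ ∷ _) = refl

module _ (Φ : FominField (suc m) ℓ) where

  -- The points (0, n + 1) and (n, 1) of the cylinder coincide, so the only new entry of the second
  -- tableau under ι₂ is the end of the first.
  pairAt-wrap : at Φ 0ℤ (1ℤ + ℤ.+ suc m) ≡ lookup (chain (Pairs.P (pairAt Φ 0ℤ 1ℤ))) (fromℕ (suc m))
  pairAt-wrap = trans (sym (FominField.periodic Φ 1ℤ 0ℤ (1ℤ + ℤ.+ suc m)))
    (trans (cong₂ (at Φ) (h₁ (ℤ.+ suc m)) (h₂ (ℤ.+ suc m)))
    (trans (cong (λ k → at Φ (ℤ.+ k) 1ℤ) (sym (Finₚ.toℕ-fromℕ (suc m))))
           (sym (Vecₚ.lookup∘tabulate (λ i → at Φ (ℤ.+ toℕ i) 1ℤ) (fromℕ (suc m))))))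
    where h₁ : ∀ n → 0ℤ + 1ℤ * n ≡ n
          h₁ = solve-∀
          h₂ : ∀ n → 1ℤ + n - 1ℤ * n ≡ 1ℤ
          h₂ = solve-∀

module _ (Φ Φ′ : FominField (suc m) ℓ) where

  pairAt-column : (∀ (i : Fin (suc m)) → at Φ 0ℤ (ℤ.+ toℕ (suc i)) ≡ at Φ′ 0ℤ (ℤ.+ toℕ (suc i))) →
    lookup (rows (Pairs.P (pairAt Φ 0ℤ 1ℤ))) (fromℕ (suc m)) ≡ lookup (rows (Pairs.P (pairAt Φ′ 0ℤ 1ℤ))) (fromℕ (suc m)) →
    chain (Pairs.Q (pairAt Φ 0ℤ 1ℤ)) ≡ chain (Pairs.Q (pairAt Φ′ 0ℤ 1ℤ))
  pairAt-column inner outer = Vecₚ.tabulate-cong columns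
    where
    S S′ : Vec (Signature _) (2+ m)
    S  = chain (Pairs.P (pairAt Φ 0ℤ 1ℤ))
    S′ = chain (Pairs.P (pairAt Φ′ 0ℤ 1ℤ))
    outer′ : lookup S (fromℕ (suc m)) ≡ lookup S′ (fromℕ (suc m))
    outer′ = signature-≡ (trans (sym (Vecₚ.lookup-map (fromℕ (suc m)) parts S)) (trans outer (Vecₚ.lookup-map (fromℕ (suc m)) parts S′)))
    columns : ∀ (k : Fin (2+ m)) → at Φ 0ℤ (1ℤ + ℤ.+ toℕ k) ≡ at Φ′ 0ℤ (1ℤ + ℤ.+ toℕ k)
    columns k with view k
    ... | ‵inject₁ j rewrite Finₚ.toℕ-inject₁ j = inner j
    ... | ‵fromℕ rewrite Finₚ.toℕ-fromℕ m = trans (pairAt-wrap Φ) (trans outer′ (sym (pairAt-wrap Φ′)))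

module _ {ρ ƛ : Signature ℓ} (P P′ Q : SST ρ ƛ (suc m)) where

  private
    S  = Pairs.P (pairAt Λ[ P , Q ] 0ℤ 1ℤ)
    S′ = Pairs.P (pairAt Λ[ P′ , Q ] 0ℤ 1ℤ)

  ι₂-replaceP : ∀ S″ → rows S′ ≡ rows S″ → lookup (rows S″) (fromℕ (suc m)) ≡ lookup (rows S) (fromℕ (suc m)) →
    pairAt Λ[ P′ , Q ] 0ℤ 1ℤ ≡ pair S″ (Pairs.Q (pairAt Λ[ P , Q ] 0ℤ 1ℤ))
  ι₂-replaceP S″ eq eq-last = pair-≡ (parts-injective eq)
    (pairAt-column Λ[ P′ , Q ] Λ[ P , Q ]
      (λ i → trans (Λ-column P′ Q (suc i)) (sym (Λ-column P Q (suc i))))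
      (trans (cong (λ c → lookup c (fromℕ (suc m))) eq) eq-last))

-- Partial operators commuting with a bijection

Commutes : Pairs n ↔ Pairs n → (Pairs n → Maybe (Pairs n)) → Set
Commutes c g = ∀ T → map (to c) (g T) ≡ g (to c T)

module _ (g : ∀ {ℓ} {ρ ƛ : Signature ℓ} → SST ρ ƛ n → Maybe (SST ρ ƛ n)) where

  on-first-nothing : ∀ T → g (Pairs.P T) ≡ nothing → on first g T ≡ nothing
  on-first-nothing (pair P Q) eq = cong (map (λ P′ → pair P′ Q)) eq

  on-first-just : ∀ T {P′} → g (Pairs.P T) ≡ just P′ → on first g T ≡ just (pair P′ (Pairs.Q T))
  on-first-just (pair P Q) eq = cong (map (λ P′ → pair P′ Q)) eq

e-commutes-ι₂ : (i : Fin m) → Commutes (ι second) (on first (e i))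
e-commutes-ι₂ {m} i T@(pair {ℓ} P Q) = go (e-scanF P u₀ (Pairs.P T₁) (rows-ι₂ P Q) i)
  where
  open Cylinder (growth ℓ) m using (scanF)
  u₀ : Vec ℤ ℓ
  u₀ = lookup (rows Q) (suc zero)
  T₁ : Pairs (suc m)
  T₁ = pairAt Λ[ P , Q ] 0ℤ 1ℤ
  go : (e i P ≡ nothing × e i (Pairs.P T₁) ≡ nothing) ⊎
       (∃[ P′ ] ∃[ S′ ] e i P ≡ just P′ × e i (Pairs.P T₁) ≡ just S′ × rows S′ ≡ scanF (rows P′) u₀ ×
        lookup (rows S′) (fromℕ (suc m)) ≡ lookup (rows (Pairs.P T₁)) (fromℕ (suc m))) →
       map (to (ι second)) (on first (e i) T) ≡ on first (e i) T₁
  go (inj₁ (eqP , eqS)) = trans (cong (map (to (ι second))) (on-first-nothing (e i) T eqP)) (sym (on-first-nothing (e i) T₁ eqS))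
  go (inj₂ (P′ , S′ , eqP , eqS , eq , eq-last)) = trans (cong (map (to (ι second))) (on-first-just (e i) T eqP))
    (trans (cong just (ι₂-replaceP P P′ Q S′ (trans (rows-ι₂ P′ Q) (sym eq)) eq-last)) (sym (on-first-just (e i) T₁ eqS)))

-- Where g⁻ is defined, the claim is that for g read backwards. If g⁻ were undefined at T but had a
-- value Y at the image of T, then g would send the preimage of Y to T, and g⁻ would be defined at T
-- after all.
commutes-inverse : ∀ {c : Pairs n ↔ Pairs n} {g g⁻ : Pairs n → Maybe (Pairs n)} →
  (∀ {X Y} → g X ≡ just Y → g⁻ Y ≡ just X) → (∀ {X Y} → g⁻ X ≡ just Y → g Y ≡ just X) →
  Commutes c g → Commutes c g⁻
commutes-inverse {c = c} {g} {g⁻} forth back comm T with g⁻ T in eq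
... | just Y = sym (forth (trans (sym (comm Y)) (cong (map (to c)) (back eq))))
... | nothing with g⁻ (to c T) in eq′
... | nothing = refl
... | just Y with g (from c Y) in eq″ | trans (comm (from c Y)) (trans (cong g (strictlyInverseˡ c Y)) (back eq′))
... | nothing | ()
... | just Z | cZ≡cT
  with refl ← trans (sym (strictlyInverseʳ c Z)) (trans (cong (from c) (Maybeₚ.just-injective cZ≡cT)) (strictlyInverseʳ c T))
  with () ← trans (sym eq) (forth eq″)

commutes-∘ : ∀ {c c₁ c₂ : Pairs n ↔ Pairs n} {g : Pairs n → Maybe (Pairs n)} → (∀ T → to c T ≡ to c₁ (to c₂ T)) →
  Commutes c₁ g → Commutes c₂ g → Commutes c g
commutes-∘ {c = c} {c₁} {c₂} {g} eq comm₁ comm₂ T = trans (Maybeₚ.map-cong eq (g T)) (trans (Maybeₚ.map-∘ (g T))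
  (trans (cong (map (to c₁)) (comm₂ T)) (trans (comm₁ (to c₂ T)) (cong g (sym (eq T))))))

on-inverse : {g g⁻ : ∀ {ℓ} {ρ ƛ : Signature ℓ} → SST ρ ƛ n → Maybe (SST ρ ƛ n)} →
  (∀ {ℓ} {ρ ƛ : Signature ℓ} {P P′ : SST ρ ƛ n} → g P ≡ just P′ → g⁻ P′ ≡ just P) →
  ∀ k {X Y} → on k g X ≡ just Y → on k g⁻ Y ≡ just X
on-inverse {g = g} inverse first {pair P Q} eq with g P in eqP
on-inverse inverse first {pair P Q} refl | just P′ = cong (map (λ P → pair P Q)) (inverse eqP)
on-inverse {g = g} inverse second {pair P Q} eq with g Q in eqQ
on-inverse inverse second {pair P Q} refl | just Q′ = cong (map (λ Q → pair P Q)) (inverse eqQ)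

-- Translations of the field

module _ .{{_ : NonZero n}} where

  -- By `Λ-pairAt` the field of a pair read off at a point is the old field translated to that
  -- point, so the displacements add up.
  move-+ : ∀ x y x′ y′ (T : Pairs n) → to (move x y) (to (move x′ y′) T) ≡ to (move (x′ + x) (y′ + y)) T
  move-+ x y x′ y′ T = pair-≡
    (Vecₚ.tabulate-cong λ i → trans (Λ-pairAt T x′ y′ (x + ℤ.+ toℕ i) y)
      (cong (λ z → at Λ⟨ T ⟩ z (y′ + y)) (sym (ℤₚ.+-assoc x′ x (ℤ.+ toℕ i)))))
    (Vecₚ.tabulate-cong λ i → trans (Λ-pairAt T x′ y′ x (y + ℤ.+ toℕ i))
      (cong (at Λ⟨ T ⟩ (x′ + x)) (sym (ℤₚ.+-assoc y′ y (ℤ.+ toℕ i)))))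

  move-comm : ∀ x y x′ y′ (T : Pairs n) → to (move x y) (to (move x′ y′) T) ≡ to (move x′ y′) (to (move x y) T)
  move-comm x y x′ y′ T = trans (move-+ x y x′ y′ T)
    (trans (cong₂ (λ u v → to (move u v) T) (ℤₚ.+-comm x′ x) (ℤₚ.+-comm y′ y)) (sym (move-+ x′ y′ x y T)))

  -- Periodicity identifies the two base points; this is what makes cRSK a power of ι₂ as well as of
  -- ι₁.
  move-turn : ∀ (T : Pairs n) → to (move (ℤ.+ n) 0ℤ) T ≡ to (move 0ℤ (ℤ.+ n)) T
  move-turn T = pair-≡ (Vecₚ.tabulate-cong λ i → trans (turn (ℤ.+ toℕ i) 0ℤ) (cong (at Λ⟨ T ⟩ (0ℤ + ℤ.+ toℕ i)) (ℤₚ.+-identityʳ (ℤ.+ n))))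
    (Vecₚ.tabulate-cong λ i → trans (cong (λ x → at Λ⟨ T ⟩ x (0ℤ + ℤ.+ toℕ i)) (sym (ℤₚ.+-identityʳ (ℤ.+ n)))) (turn 0ℤ (ℤ.+ toℕ i)))
    where
    turn : ∀ x y → at Λ⟨ T ⟩ (ℤ.+ n + x) (0ℤ + y) ≡ at Λ⟨ T ⟩ (0ℤ + x) (ℤ.+ n + y)
    turn x y = trans (cong₂ (at Λ⟨ T ⟩) (h₁ x (ℤ.+ n)) (h₂ y (ℤ.+ n))) (FominField.periodic Λ⟨ T ⟩ 1ℤ (0ℤ + x) (ℤ.+ n + y))
      where h₁ : ∀ x n → n + x ≡ 0ℤ + x + 1ℤ * n
            h₁ = solve-∀
            h₂ : ∀ y n → 0ℤ + y ≡ n + y - 1ℤ * n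
            h₂ = solve-∀

  commutes-ι₁-power : ∀ g → Commutes (ι first) g → ∀ k → Commutes (move (ℤ.+ suc k) 0ℤ) g
  commutes-ι₁-power g comm zero    = comm
  commutes-ι₁-power g comm (suc k) = commutes-∘ {c = move (ℤ.+ 2+ k) 0ℤ} {move (ℤ.+ suc k) 0ℤ} {ι first} {g}
    (λ T → sym (move-+ (ℤ.+ suc k) 0ℤ 1ℤ 0ℤ T)) (commutes-ι₁-power g comm k) comm

  commutes-ι₂-power : ∀ g → Commutes (ι second) g → ∀ k → Commutes (move 0ℤ (ℤ.+ suc k)) g
  commutes-ι₂-power g comm zero    = comm
  commutes-ι₂-power g comm (suc k) = commutes-∘ {c = move 0ℤ (ℤ.+ 2+ k)} {move 0ℤ (ℤ.+ suc k)} {ι second} {g}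
    (λ T → sym (move-+ 0ℤ (ℤ.+ suc k) 0ℤ 1ℤ T)) (commutes-ι₂-power g comm k) comm

  -- Translations commute with ι and its inverse, so commutation survives conjugation by ι. This
  -- yields the operators of index 0 from those of index 1.
  commutes-viaι : ∀ x y g k → Commutes (move x y) g → Commutes (move x y) (viaι k g)
  commutes-viaι x y g k comm T = trans (sym (Maybeₚ.map-∘ (g (from (ι k) T))))
    (trans (Maybeₚ.map-cong (ι-comm k) (g (from (ι k) T)))
    (trans (Maybeₚ.map-∘ (g (from (ι k) T)))
      (cong (map (to (ι k))) (trans (comm (from (ι k) T)) (cong g (from-comm k))))))
    where
    ι-comm : ∀ k S → to (move x y) (to (ι k) S) ≡ to (ι k) (to (move x y) S)
    ι-comm first  = move-comm x y 1ℤ 0ℤ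
    ι-comm second = move-comm x y 0ℤ 1ℤ
    from-comm : ∀ k → to (move x y) (from (ι k) T) ≡ from (ι k) (to (move x y) T)
    from-comm first  = move-comm x y (- 1ℤ) 0ℤ T
    from-comm second = move-comm x y 0ℤ (- 1ℤ) T

-- Transposition, exchanging the two tableaux

swap : Pairs n → Pairs n
swap (pair P Q) = pair Q P

-- The local rule is symmetric in μ and ƛ, and exchanging the coordinates negates the period.
transpose : FominField n ℓ → FominField n ℓ
transpose {n = n} Φ = record
  { at       = λ x y → at Φ y x
  ; periodic = λ k x y → trans (cong₂ (at Φ) (h₁ y k (ℤ.+ n)) (h₂ x k (ℤ.+ n))) (Φ.periodic (- k) y x)
  ; right    = λ x y → Φ.up y x
  ; up       = λ x y → Φ.right y x
  ; rule     = λ x y → flip-rule (Φ.rule y x)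
  }
  where
  module Φ = FominField Φ
  h₁ : ∀ y k n → y - k * n ≡ y + - k * n
  h₁ = solve-∀
  h₂ : ∀ x k n → x + k * n ≡ x - - k * n
  h₂ = solve-∀
  flip-rule : ∀ {κ μ ƛ ν : Vec ℤ _} → LocalRule κ μ ƛ ν → LocalRule κ ƛ μ ν
  flip-rule {κ} {μ} {ƛ} R = record
    { c       = R.c
    ; c-start = R.c-start
    ; c-carry = λ x → trans (R.c-carry x) (cong (λ z → 0ℤ ℤ.⊔ (z + R.c (x - 1ℤ) - 1ℤ)) (ℤₚ.+-comm (R.a x) (R.b x)))
    ; ν-conj  = λ x → trans (R.ν-conj x) (cong (λ z → z - conj κ x + R.c (x - 1ℤ) - R.c x) (ℤₚ.+-comm (conj μ x) (conj ƛ x)))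
    }
    where module R = LocalRule R

module _ .{{_ : NonZero n}} where

  Λ-swap : ∀ {ρ ƛ : Signature ℓ} (P Q : SST ρ ƛ n) x y → at Λ[ Q , P ] x y ≡ at Λ[ P , Q ] y x
  Λ-swap P Q x y = sym (Λ-unique Q P (transpose Λ[ P , Q ]) (Λ-column P Q) (Λ-row P Q) x y)

  swap-move : ∀ x y (T : Pairs n) → swap (to (move x y) T) ≡ to (move y x) (swap T)
  swap-move x y (pair P Q) = pair-≡
    (Vecₚ.tabulate-cong λ i → sym (Λ-swap P Q (y + ℤ.+ toℕ i) x))
    (Vecₚ.tabulate-cong λ i → sym (Λ-swap P Q y (x + ℤ.+ toℕ i)))

  on-swap : (g : ∀ {ℓ} {ρ ƛ : Signature ℓ} → SST ρ ƛ n → Maybe (SST ρ ƛ n)) → ∀ T → on second g T ≡ map swap (on first g (swap T))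
  on-swap g (pair P Q) = Maybeₚ.map-∘ (g Q)

  -- Conjugation by `swap` turns ι₂ into ι₁ and the action on the first tableau into that on the
  -- second.
  commutes-swap : (g : ∀ {ℓ} {ρ ƛ : Signature ℓ} → SST ρ ƛ n → Maybe (SST ρ ƛ n)) →
    Commutes (ι second) (on first g) → Commutes (ι first) (on second g)
  commutes-swap g comm T = trans (cong (map (to (ι first))) (on-swap g T))
    (trans (sym (Maybeₚ.map-∘ (on first g (swap T))))
    (trans (Maybeₚ.map-cong (λ S → sym (swap-move 0ℤ 1ℤ S)) (on first g (swap T)))
    (trans (Maybeₚ.map-∘ (on first g (swap T)))
    (trans (cong (map swap) (trans (comm (swap T)) (cong (on first g) (sym (swap-move 1ℤ 0ℤ T)))))
           (sym (on-swap g (to (ι first) T)))))))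

-- The component decides how cRSK is written: as a power of ι₂ for the first tableau, of ι₁ for the
-- second.
e-commutes : ∀ k (i : Fin m) → Commutes cRSK (on k (e i))
e-commutes {m} first i T = trans (Maybeₚ.map-cong move-turn (on first (e i) T))
  (trans (commutes-ι₂-power (on first (e i)) (e-commutes-ι₂ i) m T) (cong (on first (e i)) (sym (move-turn T))))
e-commutes {m} second i = commutes-ι₁-power (on second (e i)) (commutes-swap (e i) (e-commutes-ι₂ i)) m

f-commutes : ∀ k (i : Fin m) → Commutes cRSK (on k (f i))
f-commutes k i = commutes-inverse {c = cRSK} {on k (e i)} {on k (f i)} (on-inverse (e⇒f i) k) (on-inverse (f⇒e i) k) (e-commutes k i)

theorem6p9 : (m : ℕ) (G : Generator (2+ m)) (T : Pairs (2+ m)) →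
    map (Inverse.to cRSK) (⟦ G ⟧ T) ≡ ⟦ G ⟧ (Inverse.to cRSK T)
theorem6p9 m (E k (suc i)) = e-commutes k i
theorem6p9 m (F k (suc i)) = f-commutes k i
theorem6p9 m (E k zero)    = commutes-viaι (ℤ.+ 2+ m) 0ℤ (on k (e zero)) k (e-commutes k zero)
theorem6p9 m (F k zero)    = commutes-viaι (ℤ.+ 2+ m) 0ℤ (on k (f zero)) k (f-commutes k zero)
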